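{- For all integers $n \geq 0$, \begin{align*} dp(6n+4) & \equiv 0 \pmod{2}, \\ dp(18n+10) & \equiv 0 \pmod{4}, \\ dp(54n+52) & \equiv 0 \pmod{8}. \end{align*}
   Context: A partition of a positive integer $n$ is a nonincreasing sequence of positive integers (called parts) whose sum is $n$. For $n\ge 0$, $dp(n)$ denotes the number of partitions of $n$ in which every part is either divisible by $4$ or congruent to $\pm 1 \pmod 6$ (with $dp(0)=1$). Equivalently, its generating function is $$\sum_{n=0}^{\infty} dp(n)q^n = \frac{1}{(q;q^6)_\infty (q^5;q^6)_\infty (q^4;q^4)_\infty},$$ where $(a;q)_\infty := (1-a)(1-aq)(1-aq^2)\cdots$. -}

module Defs where

open import Data.List.Base using (List; []; _∷_; length; filter; upTo; cartesianProductWith)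
open import Data.List.Membership.Propositional using (_∈_)
open import Data.List.Membership.Propositional.Properties
  using (∈-filter⁺; ∈-filter⁻; ∈-cartesianProductWith⁺; ∈-cartesianProductWith⁻; ∈-upTo⁺)
open import Data.List.Properties using (∷-injective)
open import Data.List.Relation.Unary.All using (All; []; _∷_; all?)
open import Data.List.Relation.Unary.All.Properties using (¬Any⇒All¬)
open import Data.List.Relation.Unary.Any using (here; there)
open import Data.List.Relation.Unary.AllPairs using ([]; _∷_)
open import Data.List.Relation.Unary.Linked using (Linked; linked?)
open import Data.List.Relation.Unary.Unique.Propositional using (Unique)
open import Data.List.Relation.Unary.Unique.Propositional.Properties
  using (filter⁺; upTo⁺; cartesianProductWith⁺)
open import Data.Nat.Base using (ℕ; zero; suc; _%_; _≤_; _<_; _≥_; s≤s)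
open import Data.Nat.Divisibility using (_∣_; _∣?_)
open import Data.Nat.ListAction using (sum)
open import Data.Nat.Properties using (_≟_; _<?_; _≥?_; ≤-refl; ≤-trans; m≤m+n; m≤n+m; +-mono-≤)
open import Data.Product.Base using (_×_; _,_; proj₂)
open import Data.Sum.Base using (_⊎_)
open import Function.Bundles using (_⇔_; mk⇔)
open import Relation.Binary.PropositionalEquality using (_≡_; refl)
open import Relation.Nullary.Decidable using (Dec; _×-dec_; _⊎-dec_)
open import Relation.Nullary.Negation using (¬_)

IsPartition : ℕ → List ℕ → Set
IsPartition n ps = Linked _≥_ ps × All (0 <_) ps × sum ps ≡ n

AllowedPart : ℕ → Set
AllowedPart p = 4 ∣ p ⊎ p % 6 ≡ 1 ⊎ p % 6 ≡ 5

IsDP : ℕ → List ℕ → Set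
IsDP n ps = IsPartition n ps × All AllowedPart ps

isPartition? : ∀ n ps → Dec (IsPartition n ps)
isPartition? n ps = linked? _≥?_ ps ×-dec all? (0 <?_) ps ×-dec (sum ps ≟ n)

allowedPart? : ∀ p → Dec (AllowedPart p)
allowedPart? p = (4 ∣? p) ⊎-dec ((p % 6 ≟ 1) ⊎-dec (p % 6 ≟ 5))

isDP? : ∀ n ps → Dec (IsDP n ps)
isDP? n ps = isPartition? n ps ×-dec all? allowedPart? ps

-- All lists of length at most k with entries at most b, without repetition.
boundedLists : ℕ → ℕ → List (List ℕ)
boundedLists b zero    = [] ∷ []
boundedLists b (suc k) = [] ∷ cartesianProductWith _∷_ (upTo (suc b)) (boundedLists b k)

-- A partition of n has at most n parts, each at most n, so the search below
-- is exhaustive; ∈-dpPartitions and dpPartitions-unique state that it lists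
-- every admissible partition exactly once.
dpPartitions : ℕ → List (List ℕ)
dpPartitions n = filter (isDP? n) (boundedLists n n)

dp : ℕ → ℕ
dp n = length (dpPartitions n)

private
  ∈-boundedLists : ∀ {b} k {ps} → All (0 <_) ps → sum ps ≤ b → length ps ≤ k →
                   ps ∈ boundedLists b k
  ∈-boundedLists zero    {[]}     _        _   _         = here refl
  ∈-boundedLists (suc k) {[]}     _        _   _         = here refl
  ∈-boundedLists (suc k) {p ∷ ps} (_ ∷ ps>0) s≤b (s≤s l≤k) =
    there (∈-cartesianProductWith⁺ _∷_
      (∈-upTo⁺ (s≤s (≤-trans (m≤m+n p (sum ps)) s≤b)))
      (∈-boundedLists k ps>0 (≤-trans (m≤n+m (sum ps) p) s≤b) l≤k))

  length≤sum : ∀ {ps} → All (0 <_) ps → length ps ≤ sum ps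
  length≤sum []           = ≤-refl
  length≤sum (p>0 ∷ ps>0) = +-mono-≤ p>0 (length≤sum ps>0)

  boundedLists-unique : ∀ b k → Unique (boundedLists b k)
  boundedLists-unique b zero    = [] ∷ []
  boundedLists-unique b (suc k) =
    ¬Any⇒All¬ _ []∉ ∷ cartesianProductWith⁺ _∷_ ∷-injective (upTo⁺ (suc b)) (boundedLists-unique b k)
    where
    []∉ : ¬ ([] ∈ cartesianProductWith _∷_ (upTo (suc b)) (boundedLists b k))
    []∉ []∈ with ∈-cartesianProductWith⁻ _∷_ (upTo (suc b)) (boundedLists b k) []∈
    ... | _ , _ , _ , _ , ()

∈-dpPartitions : ∀ n ps → ps ∈ dpPartitions n ⇔ IsDP n ps
∈-dpPartitions n ps = mk⇔ to from
  where
  to : ps ∈ dpPartitions n → IsDP n ps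
  to ps∈ = proj₂ (∈-filter⁻ (isDP? n) {xs = boundedLists n n} ps∈)

  from : IsDP n ps → ps ∈ dpPartitions n
  from d@((_ , ps>0 , refl) , _) =
    ∈-filter⁺ (isDP? n) (∈-boundedLists n ps>0 ≤-refl (length≤sum ps>0)) d

dpPartitions-unique : ∀ n → Unique (dpPartitions n)
dpPartitions-unique n = filter⁺ (isDP? n) (boundedLists-unique n n)

{-# OPTIONS --safe #-}
module Submission where

-- Write f_k = (q^k;q^k)_∞, let φ = φ(-q), ψ = ψ(q), A = f(q,q²), Ω = f(-q,-q⁵) be
-- theta functions, and let D be the generating function of dp. The Jacobi triple
-- product turns ψ(-q) into a product, which gives D ψ(-q) = f₃/f₆. Replacing q by
-- -q and using the dissection ψ = A(q³) + q ψ(q⁹), one inverts ψ through the norm of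
-- the cubic extension ℤ[[q]]/ℤ[[q³]]; the norm is multiplicative, so it is again a
-- product. Hence Σ (-1)ⁿ dp(3n+1) qⁿ = φ f₆³/(f₂⁴ f₄), and since the part of φ with
-- odd exponents is -2q ψ(q⁸), the series G = Σ dp(6n+4) qⁿ satisfies
-- f₁⁴ f₂ G = 2 f₃³ ψ(q⁴). From f₁³ = φ² ψ and φ² ≡ 1 (mod 4) one gets
-- G ≡ 2 φ(-q²) ψ(q²) ψ(q³) (mod 8), and the dissections of φ and ψ modulo 3 show
-- which coefficients vanish: no exponent of ψ is 2 modulo 3, and the part
-- of φ(-q²) ψ(q²) with exponents 2 modulo 3 is -q² f₁₈ f₃₆ because Ω A = f₃ f₆.

open import Defs
open import Data.Nat using (ℕ; _+_; _*_)
open import Data.Nat.Divisibility using (_∣_)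
open import Data.Product using (_×_)

open import Algebra.Bundles using (CommutativeRing)
import Algebra.Solver.Ring
open import Algebra.Solver.Ring.AlmostCommutativeRing
  using (AlmostCommutativeRing; fromCommutativeRing; _-Raw-AlmostCommutative⟶_)
open import Data.Bool.Base using (Bool; if_then_else_)
open import Data.Empty using (⊥-elim)
open import Data.Integer.Base as ℤ using (ℤ; 0ℤ; 1ℤ; -1ℤ)
import Data.Integer.Divisibility.Signed as ℤ
import Data.Integer.Properties as ℤ
open import Data.Integer.Tactic.RingSolver using (solve-∀)
open import Data.List.Base using (List; []; _∷_; _++_; map; filter; length)
open import Data.List.Membership.Propositional using (_∈_)
open import Data.List.Membership.Propositional.Properties
  using (∈-filter⁺; ∈-filter⁻; ∈-map⁺; ∈-map⁻; ∈-++⁺ˡ; ∈-++⁺ʳ; ∈-++⁻)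
open import Data.List.Membership.Propositional.Properties.WithK using (unique∧set⇒bag)
open import Data.List.Properties using (∷-injectiveʳ; length-++; length-map)
open import Data.List.Relation.Binary.BagAndSetEquality using (∼bag⇒↭)
open import Data.List.Relation.Binary.Permutation.Propositional.Properties using (↭-length)
open import Data.List.Relation.Unary.All as All using (All; []; _∷_; all?)
open import Data.List.Relation.Unary.AllPairs using ([]; _∷_)
open import Data.List.Relation.Unary.Linked as Linked using (Linked; []; [-]; _∷_)
open import Data.List.Relation.Unary.Linked.Properties using (Linked⇒AllPairs)
open import Data.List.Relation.Unary.Unique.Propositional using (Unique)
open import Data.List.Relation.Unary.Unique.Propositional.Properties using (filter⁺; map⁺; ++⁺)
open import Data.Maybe.Base as Maybe using (Maybe)
open import Data.Nat.Base as ℕ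
  using (zero; suc; _∸_; _≤_; _<_; _≥_; z≤n; s≤s; z<s; s<s; _%_)
open import Data.Nat.Divisibility using (divides; ∣m∣n⇒∣m+n; ∣m+n∣m⇒∣n)
open import Data.Nat.DivMod using ([m+kn]%n≡m%n)
open import Data.Nat.ListAction using (sum)
open import Data.Nat.Properties as ℕ using (_≤?_)
import Data.Nat.Tactic.RingSolver as ℕ
open import Data.Product.Base using (_,_; ∃; proj₁; proj₂)
open import Data.Sum.Base as Sum using (_⊎_; inj₁; inj₂)
open import Function.Bundles using (_⇔_; mk⇔; Equivalence)
open import Level using (0ℓ)
open import Relation.Binary.PropositionalEquality
  using (_≡_; _≢_; refl; sym; trans; cong; cong₂; subst; module ≡-Reasoning)
import Relation.Binary.Reasoning.Setoid
open import Relation.Nullary.Decidable using (Dec; yes; no; does; does-⇔; dec⇒maybe)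
open import Relation.Nullary.Negation using (¬_)

-- No division takes place in ℤ[[q]]: a quotient such as f₂²/f₁ is stated with its denominator
-- multiplied out, and common factors are removed because a series with constant term 1 can be
-- cancelled, both exactly and modulo d. The norm avoids cube roots of unity: to extract exponents 1
-- modulo 3 from 1/ψ one would multiply by ψ(ωq) ψ(ω²q), and the cubic form in the three sections
-- yields the same product with integer coefficients. All three congruences come from the single G ≡
-- 2Z (mod 8) with Z = φ(-q²) ψ(q²) ψ(q³). The factor 2 gives the first. At exponents 3n+1 the
-- series Z is even, because φ(-q²) ≡ 1 (mod 2) and ψ(q²) has no exponent 1 modulo 3. At exponents
-- 9n+8 it vanishes, by two successive sections modulo 3. The indices are 18n+10 = 6(3n+1)+4 and
-- 54n+52 = 6(9n+8)+4; since 6n+4 is even, the sign change of q leaves no trace.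

-- Formal power series over the integers

Series : Set
Series = ℕ → ℤ

infix  4 _≈_ _≡[_]_
infixl 6 _⊕_ _⊖_
infixl 7 _⊗_
infix  8 ⊝_

record _≈_ (f g : Series) : Set where
  constructor pointwise
  field coeff : ∀ n → f n ≡ g n
open _≈_ public

-- Congruence modulo q^N.
record _≡[_]_ (f : Series) (N : ℕ) (g : Series) : Set where
  constructor below
  field agree : ∀ n → n < N → f n ≡ g n
open _≡[_]_ public

tail : Series → Series
tail f n = f (suc n)

shift : Series → Series
shift f zero    = 0ℤ
shift f (suc n) = f n

𝟘 : Series
𝟘 _ = 0ℤ

-- Opaque, so that unification sees f ⊕ g and ⊝ f as irreducible.
opaque
  _⊕_ : Series → Series → Series
  (f ⊕ g) n = f n ℤ.+ g n

  ⊝_ : Series → Series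
  (⊝ f) n = ℤ.- f n

  ⊕-coeff : ∀ f g n → (f ⊕ g) n ≡ f n ℤ.+ g n
  ⊕-coeff f g n = refl

  ⊝-coeff : ∀ f n → (⊝ f) n ≡ ℤ.- f n
  ⊝-coeff f n = refl

-- The Cauchy product by way of f = f(0) + q · tail f: the recursion peels `f` and leaves `g` alone,
-- so no convolution sum appears.
_⊗_ : Series → Series → Series
(f ⊗ g) zero    = f 0 ℤ.* g 0
(f ⊗ g) (suc n) = f 0 ℤ.* g (suc n) ℤ.+ (tail f ⊗ g) n

_⊖_ : Series → Series → Series
f ⊖ g = f ⊕ ⊝ g

mono : ℤ → ℕ → Series
mono s zero    zero    = s
mono s zero    (suc n) = 0ℤ
mono s (suc k) = shift (mono s k)

const : ℤ → Series
const s = mono s 0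

𝟙 : Series
𝟙 = const 1ℤ

≈-refl : ∀ {f} → f ≈ f
≈-refl = pointwise λ _ → refl

≈-sym : ∀ {f g} → f ≈ g → g ≈ f
≈-sym p = pointwise λ n → sym (coeff p n)

≈-trans : ∀ {f g h} → f ≈ g → g ≈ h → f ≈ h
≈-trans p q = pointwise λ n → trans (coeff p n) (coeff q n)

⊗-coeff-cong : ∀ n {f f′ g g′} → (∀ k → k ≤ n → f k ≡ f′ k) → (∀ k → k ≤ n → g k ≡ g′ k) →
               (f ⊗ g) n ≡ (f′ ⊗ g′) n
⊗-coeff-cong zero    p q = cong₂ ℤ._*_ (p 0 z≤n) (q 0 z≤n)
⊗-coeff-cong (suc n) p q = cong₂ ℤ._+_
  (cong₂ ℤ._*_ (p 0 z≤n) (q (suc n) ℕ.≤-refl))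
  (⊗-coeff-cong n (λ k k≤n → p (suc k) (s≤s k≤n)) (λ k k≤n → q k (ℕ.m≤n⇒m≤1+n k≤n)))

⊗-cong : ∀ {f f′ g g′} → f ≈ f′ → g ≈ g′ → f ⊗ g ≈ f′ ⊗ g′
⊗-cong p q = pointwise λ n → ⊗-coeff-cong n (λ k _ → coeff p k) (λ k _ → coeff q k)

opaque
  unfolding _⊕_ ⊝_
  ⊕-cong : ∀ {f f′ g g′} → f ≈ f′ → g ≈ g′ → f ⊕ g ≈ f′ ⊕ g′
  ⊕-cong p q = pointwise λ n → cong₂ ℤ._+_ (coeff p n) (coeff q n)

  ⊝-cong : ∀ {f f′} → f ≈ f′ → ⊝ f ≈ ⊝ f′
  ⊝-cong p = pointwise λ n → cong ℤ.-_ (coeff p n)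

-- The definition peels only the left factor; commutativity needs the same expansion with the right
-- factor peeled.
⊗-sucʳ : ∀ f g n → (f ⊗ g) (suc n) ≡ f (suc n) ℤ.* g 0 ℤ.+ (f ⊗ tail g) n
⊗-sucʳ f g zero    = ℤ.+-comm (f 0 ℤ.* g 1) (f 1 ℤ.* g 0)
⊗-sucʳ f g (suc n) = trans
  (cong (λ x → f 0 ℤ.* g (suc (suc n)) ℤ.+ x) (⊗-sucʳ (tail f) g n))
  (swap (f 0 ℤ.* g (suc (suc n))) (f (suc (suc n)) ℤ.* g 0) _)
  where
  swap : ∀ x y z → x ℤ.+ (y ℤ.+ z) ≡ y ℤ.+ (x ℤ.+ z)
  swap = solve-∀

⊗-comm : ∀ f g → f ⊗ g ≈ g ⊗ f
⊗-comm f g = pointwise (go f g)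
  where
  go : ∀ f g n → (f ⊗ g) n ≡ (g ⊗ f) n
  go f g zero    = ℤ.*-comm (f 0) (g 0)
  go f g (suc n) = trans (cong₂ ℤ._+_ (ℤ.*-comm (f 0) (g (suc n))) (go (tail f) g n))
                         (sym (⊗-sucʳ g f n))

opaque
  unfolding _⊕_ ⊝_
  ⊗-distribʳ : ∀ h f g → (f ⊕ g) ⊗ h ≈ (f ⊗ h) ⊕ (g ⊗ h)
  ⊗-distribʳ h f g = pointwise (go f g)
    where
    interchange : ∀ a b c d e → (a ℤ.+ b) ℤ.* c ℤ.+ (d ℤ.+ e) ≡ (a ℤ.* c ℤ.+ d) ℤ.+ (b ℤ.* c ℤ.+ e)
    interchange = solve-∀
    go : ∀ f g n → ((f ⊕ g) ⊗ h) n ≡ ((f ⊗ h) ⊕ (g ⊗ h)) n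
    go f g zero    = ℤ.*-distribʳ-+ (h 0) (f 0) (g 0)
    go f g (suc n) = trans (cong (λ x → (f 0 ℤ.+ g 0) ℤ.* h (suc n) ℤ.+ x) (go (tail f) (tail g) n))
                           (interchange (f 0) (g 0) (h (suc n)) _ _)

⊗-distribˡ : ∀ h f g → h ⊗ (f ⊕ g) ≈ (h ⊗ f) ⊕ (h ⊗ g)
⊗-distribˡ h f g = ≈-trans (⊗-comm h (f ⊕ g))
  (≈-trans (⊗-distribʳ h f g) (⊕-cong (⊗-comm f h) (⊗-comm g h)))

scale-⊗ : ∀ c g h n → ((λ k → c ℤ.* g k) ⊗ h) n ≡ c ℤ.* (g ⊗ h) n
scale-⊗ c g h zero    = ℤ.*-assoc c (g 0) (h 0)
scale-⊗ c g h (suc n) = trans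
  (cong₂ ℤ._+_ (ℤ.*-assoc c (g 0) (h (suc n))) (scale-⊗ c (tail g) h n))
  (sym (ℤ.*-distribˡ-+ c (g 0 ℤ.* h (suc n)) ((tail g ⊗ h) n)))

opaque
  unfolding _⊕_ ⊝_
  ⊗-assoc : ∀ f g h → (f ⊗ g) ⊗ h ≈ f ⊗ (g ⊗ h)
  ⊗-assoc f g h = pointwise (go f g h)
    where
    open ≡-Reasoning
    regroup : ∀ a b c d e → a ℤ.* b ℤ.* c ℤ.+ (a ℤ.* d ℤ.+ e) ≡ a ℤ.* (b ℤ.* c ℤ.+ d) ℤ.+ e
    regroup = solve-∀
    go : ∀ f g h n → ((f ⊗ g) ⊗ h) n ≡ (f ⊗ (g ⊗ h)) n
    go f g h zero    = ℤ.*-assoc (f 0) (g 0) (h 0)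
    go f g h (suc n) = begin
      -- `tail (f ⊗ g)` is by definition a scalar multiple of `tail g` plus `tail f ⊗ g`.
      f 0 ℤ.* g 0 ℤ.* h (suc n) ℤ.+ (((λ k → f 0 ℤ.* tail g k) ⊕ (tail f ⊗ g)) ⊗ h) n
        ≡⟨ cong (λ x → f 0 ℤ.* g 0 ℤ.* h (suc n) ℤ.+ x) (coeff (⊗-distribʳ h _ (tail f ⊗ g)) n) ⟩
      f 0 ℤ.* g 0 ℤ.* h (suc n) ℤ.+ (((λ k → f 0 ℤ.* tail g k) ⊗ h) n ℤ.+ ((tail f ⊗ g) ⊗ h) n)
        ≡⟨ cong (λ x → f 0 ℤ.* g 0 ℤ.* h (suc n) ℤ.+ x) (cong₂ ℤ._+_ (scale-⊗ (f 0) (tail g) h n) (go (tail f) g h n)) ⟩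
      f 0 ℤ.* g 0 ℤ.* h (suc n) ℤ.+ (f 0 ℤ.* (tail g ⊗ h) n ℤ.+ (tail f ⊗ (g ⊗ h)) n)
        ≡⟨ regroup (f 0) (g 0) (h (suc n)) _ _ ⟩
      f 0 ℤ.* (g ⊗ h) (suc n) ℤ.+ (tail f ⊗ (g ⊗ h)) n ∎

⊗-zeroˡ : ∀ f → 𝟘 ⊗ f ≈ 𝟘
⊗-zeroˡ f = pointwise go
  where
  go : ∀ n → (𝟘 ⊗ f) n ≡ 0ℤ
  go zero    = refl
  go (suc n) = trans (ℤ.+-identityˡ _) (go n)

const-⊗ : ∀ c f n → (const c ⊗ f) n ≡ c ℤ.* f n
const-⊗ c f zero    = refl
const-⊗ c f (suc n) = trans (cong (λ x → c ℤ.* f (suc n) ℤ.+ x) (coeff (⊗-zeroˡ f) n)) (ℤ.+-identityʳ _)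

⊗-identityˡ : ∀ f → 𝟙 ⊗ f ≈ f
⊗-identityˡ f = pointwise λ n → trans (const-⊗ 1ℤ f n) (ℤ.*-identityˡ (f n))

opaque
  unfolding _⊕_ ⊝_

  ⊕-assoc : ∀ f g h → (f ⊕ g) ⊕ h ≈ f ⊕ (g ⊕ h)
  ⊕-assoc f g h = pointwise λ n → ℤ.+-assoc (f n) (g n) (h n)

  ⊕-comm : ∀ f g → f ⊕ g ≈ g ⊕ f
  ⊕-comm f g = pointwise λ n → ℤ.+-comm (f n) (g n)

  ⊕-identityˡ : ∀ f → 𝟘 ⊕ f ≈ f
  ⊕-identityˡ f = pointwise λ n → ℤ.+-identityˡ (f n)

  ⊝-inverseˡ : ∀ f → ⊝ f ⊕ f ≈ 𝟘
  ⊝-inverseˡ f = pointwise λ n → ℤ.+-inverseˡ (f n)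

  const-⊕ : ∀ a b → const (a ℤ.+ b) ≈ const a ⊕ const b
  const-⊕ a b = pointwise λ { zero → refl ; (suc n) → refl }

  const-⊝ : ∀ a → const (ℤ.- a) ≈ ⊝ const a
  const-⊝ a = pointwise λ { zero → refl ; (suc n) → refl }

⊕-identityʳ : ∀ f → f ⊕ 𝟘 ≈ f
⊕-identityʳ f = ≈-trans (⊕-comm f 𝟘) (⊕-identityˡ f)

⊗-identityʳ : ∀ f → f ⊗ 𝟙 ≈ f
⊗-identityʳ f = ≈-trans (⊗-comm f 𝟙) (⊗-identityˡ f)

seriesRing : CommutativeRing 0ℓ 0ℓ
seriesRing = record
  { Carrier = Series ; _≈_ = _≈_ ; _+_ = _⊕_ ; _*_ = _⊗_ ; -_ = ⊝_ ; 0# = 𝟘 ; 1# = 𝟙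
  ; isCommutativeRing = record
    { isRing = record
      { +-isAbelianGroup = record
        { isGroup = record
          { isMonoid = record
            { isSemigroup = record
              { isMagma = record
                { isEquivalence = record { refl = ≈-refl ; sym = ≈-sym ; trans = ≈-trans }
                ; ∙-cong = ⊕-cong }
              ; assoc = ⊕-assoc }
            ; identity = ⊕-identityˡ , ⊕-identityʳ }
          ; inverse = ⊝-inverseˡ , (λ f → ≈-trans (⊕-comm f (⊝ f)) (⊝-inverseˡ f))
          ; ⁻¹-cong = ⊝-cong }
        ; comm = ⊕-comm }
      ; *-cong = ⊗-cong
      ; *-assoc = ⊗-assoc
      ; *-identity = ⊗-identityˡ , ⊗-identityʳ
      ; distrib = ⊗-distribˡ , ⊗-distribʳ }
    ; *-comm = ⊗-comm } }

open Relation.Binary.Reasoning.Setoid (CommutativeRing.setoid seriesRing)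

seriesAlmostRing : AlmostCommutativeRing 0ℓ 0ℓ
seriesAlmostRing = fromCommutativeRing seriesRing

constMorphism : CommutativeRing.rawRing ℤ.+-*-commutativeRing -Raw-AlmostCommutative⟶ seriesAlmostRing
constMorphism = record
  { ⟦_⟧    = const
  ; +-homo = const-⊕
  ; *-homo = λ a b → pointwise λ
      { zero → refl ; (suc n) → sym (trans (const-⊗ a (const b) (suc n)) (ℤ.*-zeroʳ a)) }
  ; -‿homo = const-⊝
  ; 0-homo = pointwise λ { zero → refl ; (suc n) → refl }
  ; 1-homo = ≈-refl
  }

const≈? : ∀ a b → Maybe (const a ≈ const b)
const≈? a b = Maybe.map (λ { refl → ≈-refl }) (dec⇒maybe (a ℤ.≟ b))

open Algebra.Solver.Ring (CommutativeRing.rawRing ℤ.+-*-commutativeRing)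
  seriesAlmostRing constMorphism
  const≈?
  using (solve; _:=_; _:+_; _:*_; _:-_; :-_; con)

≡⇒≈ : ∀ {f g : Series} → f ≡ g → f ≈ g
≡⇒≈ refl = ≈-refl

-- Agreement below a bound, and cancellation

≈⇒≡[] : ∀ {f g N} → f ≈ g → f ≡[ N ] g
≈⇒≡[] p = below λ n _ → coeff p n

≡[]⇒≈ : ∀ {f g} → (∀ N → f ≡[ N ] g) → f ≈ g
≡[]⇒≈ p = pointwise λ n → agree (p (suc n)) n ℕ.≤-refl

≡[]-sym : ∀ {f g N} → f ≡[ N ] g → g ≡[ N ] f
≡[]-sym p = below λ n n<N → sym (agree p n n<N)

≡[]-trans : ∀ {f g h N} → f ≡[ N ] g → g ≡[ N ] h → f ≡[ N ] h
≡[]-trans p q = below λ n n<N → trans (agree p n n<N) (agree q n n<N)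

≡[]-weaken : ∀ {f g M N} → M ≤ N → f ≡[ N ] g → f ≡[ M ] g
≡[]-weaken M≤N p = below λ n n<M → agree p n (ℕ.≤-trans n<M M≤N)

opaque
  unfolding _⊕_ ⊝_
  ⊕-cong[] : ∀ {N f f′ g g′} → f ≡[ N ] f′ → g ≡[ N ] g′ → f ⊕ g ≡[ N ] f′ ⊕ g′
  ⊕-cong[] p q = below λ n n<N → cong₂ ℤ._+_ (agree p n n<N) (agree q n n<N)

  ⊝-cong[] : ∀ {N f f′} → f ≡[ N ] f′ → ⊝ f ≡[ N ] ⊝ f′
  ⊝-cong[] p = below λ n n<N → cong ℤ.-_ (agree p n n<N)

⊗-cong[] : ∀ {N f f′ g g′} → f ≡[ N ] f′ → g ≡[ N ] g′ → f ⊗ g ≡[ N ] f′ ⊗ g′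
⊗-cong[] p q = below λ n n<N → ⊗-coeff-cong n
  (λ k k≤n → agree p k (ℕ.≤-<-trans k≤n n<N)) (λ k k≤n → agree q k (ℕ.≤-<-trans k≤n n<N))

shift-cong : ∀ {f g} → f ≈ g → shift f ≈ shift g
shift-cong p = pointwise λ { zero → refl ; (suc n) → coeff p n }

shift-⊗ : ∀ f g → shift f ⊗ g ≈ shift (f ⊗ g)
shift-⊗ f g = pointwise λ { zero → refl ; (suc n) → ℤ.+-identityˡ _ }

mono-⊗ : ∀ s t k l → mono s k ⊗ mono t l ≈ mono (s ℤ.* t) (k + l)
mono-⊗ s t zero    l = pointwise λ n → trans (const-⊗ s (mono t l) n) (go l n)
  where
  go : ∀ l n → s ℤ.* mono t l n ≡ mono (s ℤ.* t) l n
  go zero    zero    = refl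
  go zero    (suc n) = ℤ.*-zeroʳ s
  go (suc l) zero    = ℤ.*-zeroʳ s
  go (suc l) (suc n) = go l n
mono-⊗ s t (suc k) l = ≈-trans (shift-⊗ (mono s k) (mono t l)) (shift-cong (mono-⊗ s t k l))

mono-coeff-< : ∀ s {k n} → n < k → mono s k n ≡ 0ℤ
mono-coeff-< s {suc k} {zero}  _         = refl
mono-coeff-< s {suc k} {suc n} (s<s n<k) = mono-coeff-< s n<k

mono-coeff-≢ : ∀ s k {n} → n ≢ k → mono s k n ≡ 0ℤ
mono-coeff-≢ s zero    {zero}  0≢0 = ⊥-elim (0≢0 refl)
mono-coeff-≢ s zero    {suc n} _   = refl
mono-coeff-≢ s (suc k) {zero}  _   = refl
mono-coeff-≢ s (suc k) {suc n} n≢k = mono-coeff-≢ s k λ n≡k → n≢k (cong suc n≡k)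

mono≡[]𝟘 : ∀ s {k N} → N ≤ k → mono s k ≡[ N ] 𝟘
mono≡[]𝟘 s N≤k = below λ n n<N → mono-coeff-< s (ℕ.≤-trans n<N N≤k)

mono-⊗-coeff-< : ∀ s k f {n} → n < k → (mono s k ⊗ f) n ≡ 0ℤ
mono-⊗-coeff-< s (suc k) f {zero}  _         = refl
mono-⊗-coeff-< s (suc k) f {suc n} (s<s n<k) =
  trans (coeff (shift-⊗ (mono s k) f) (suc n)) (mono-⊗-coeff-< s k f n<k)

mono-⊗-coeff-+ : ∀ s k f n → (mono s k ⊗ f) (k + n) ≡ s ℤ.* f n
mono-⊗-coeff-+ s zero    f n = const-⊗ s f n
mono-⊗-coeff-+ s (suc k) f n =
  trans (coeff (shift-⊗ (mono s k) f) (suc (k + n))) (mono-⊗-coeff-+ s k f n)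

mono-⊗-cong[] : ∀ s k {f g N} → f ≡[ N ] g → mono s k ⊗ f ≡[ k + N ] mono s k ⊗ g
mono-⊗-cong[] s zero    p = ⊗-cong[] (≈⇒≡[] ≈-refl) p
mono-⊗-cong[] s (suc k) {f} {g} p = ≡[]-trans (≈⇒≡[] (shift-⊗ (mono s k) f))
  (≡[]-trans (below λ { zero _ → refl ; (suc n) (s<s n<N) → agree (mono-⊗-cong[] s k p) n n<N })
             (≈⇒≡[] (≈-sym (shift-⊗ (mono s k) g))))

⊗-∣ : ∀ {d} f x n → (∀ k → k ≤ n → d ℤ.∣ x k) → d ℤ.∣ (f ⊗ x) n
⊗-∣ f x zero    d∣x = ℤ.∣n⇒∣m*n (f 0) {x 0} (d∣x 0 z≤n)
⊗-∣ f x (suc n) d∣x = ℤ.∣m∣n⇒∣m+n {m = f 0 ℤ.* x (suc n)} {(tail f ⊗ x) n}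
  (ℤ.∣n⇒∣m*n (f 0) {x (suc n)} (d∣x (suc n) ℕ.≤-refl))
  (⊗-∣ (tail f) x n λ k k≤n → d∣x k (ℕ.m≤n⇒m≤1+n k≤n))

-- Coefficient n of `f ⊗ x` is x n plus a combination of earlier coefficients of `x`, because f 0 is
-- 1; strong induction on n then passes divisibility to x n.
⊗-cancel-∣ : ∀ {d N} f x → f 0 ≡ 1ℤ → (∀ n → n < N → d ℤ.∣ (f ⊗ x) n) → ∀ n → n < N → d ℤ.∣ x n
⊗-cancel-∣ {d} {N} f x f₀≡1 d∣fx n n<N = upto n n<N n ℕ.≤-refl
  where
  lead : ∀ n → (f 0 ℤ.* x n) ≡ x n
  lead n = trans (cong (ℤ._* x n) f₀≡1) (ℤ.*-identityˡ (x n))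
  upto : ∀ n → n < N → ∀ k → k ≤ n → d ℤ.∣ x k
  upto zero    n<N .zero z≤n = subst (d ℤ.∣_) (lead 0) (d∣fx 0 n<N)
  upto (suc n) n<N k k≤1+n with ℕ.m≤n⇒m<n∨m≡n k≤1+n
  ... | inj₁ (s<s k≤n) = upto n (ℕ.<-trans ℕ.≤-refl n<N) k k≤n
  ... | inj₂ refl      = subst (d ℤ.∣_) (lead (suc n))
    (ℤ.∣m+n∣n⇒∣m {m = f 0 ℤ.* x (suc n)} {(tail f ⊗ x) n} (d∣fx (suc n) n<N)
      (⊗-∣ (tail f) x n (upto n (ℕ.<-trans ℕ.≤-refl n<N))))

-- The case d = 0 of cancellation for divisibility, applied to x - y: only 0 is divisible by 0.
⊗-cancelˡ[] : ∀ {N} f {x y} → f 0 ≡ 1ℤ → f ⊗ x ≡[ N ] f ⊗ y → x ≡[ N ] y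
⊗-cancelˡ[] {N} f {x} {y} f₀≡1 p = below λ n n<N → ℤ.i-j≡0⇒i≡j (x n) (y n)
  (trans (sym (difference x y n))
    (ℤ.0∣⇒≡0 (⊗-cancel-∣ f (x ⊖ y) f₀≡1 (λ n n<N → ≡0⇒0∣ (product n n<N)) n n<N)))
  where
  ≡0⇒0∣ : ∀ {i} → i ≡ 0ℤ → 0ℤ ℤ.∣ i
  ≡0⇒0∣ refl = ℤ.∣-refl {0ℤ}
  difference : ∀ g h n → (g ⊖ h) n ≡ g n ℤ.- h n
  difference g h n = trans (⊕-coeff g (⊝ h) n) (cong (λ z → g n ℤ.+ z) (⊝-coeff h n))
  product : ∀ n → n < N → (f ⊗ (x ⊖ y)) n ≡ 0ℤ
  product n n<N = trans
    (coeff (solve 3 (λ f x y → f :* (x :- y) := f :* x :- f :* y) ≈-refl f x y) n)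
    (trans (difference (f ⊗ x) (f ⊗ y) n) (ℤ.i≡j⇒i-j≡0 (agree p n n<N)))

⊗-cancelˡ : ∀ f {x y} → f 0 ≡ 1ℤ → f ⊗ x ≈ f ⊗ y → x ≈ y
⊗-cancelˡ f f₀≡1 p = ≡[]⇒≈ λ N → ⊗-cancelˡ[] f f₀≡1 (≈⇒≡[] p)

-- Limits of sequences of series

infix 4 _⟶_

-- Convergence at a fixed rate: stage m is already right below m. Sums, products and substitutions
-- keep this rate, so no modulus of convergence has to be carried along.
_⟶_ : (ℕ → Series) → Series → Set
a ⟶ L = ∀ m → a m ≡[ m ] L

⟶-unique : ∀ {a K L} → a ⟶ K → a ⟶ L → K ≈ L
⟶-unique p q = ≡[]⇒≈ λ N → ≡[]-trans (≡[]-sym (p N)) (q N)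

⟶-cong : ∀ {a b L} → (∀ m → a m ≈ b m) → a ⟶ L → b ⟶ L
⟶-cong e p m = ≡[]-trans (≈⇒≡[] (≈-sym (e m))) (p m)

⟶-⊗ : ∀ {a b K L} → a ⟶ K → b ⟶ L → (λ m → a m ⊗ b m) ⟶ K ⊗ L
⟶-⊗ p q m = ⊗-cong[] (p m) (q m)

⟶-⊕ : ∀ {a b K L} → a ⟶ K → b ⟶ L → (λ m → a m ⊕ b m) ⟶ K ⊕ L
⟶-⊕ p q m = ⊕-cong[] (p m) (q m)

⟶-⊝ : ∀ {a L} → a ⟶ L → (λ m → ⊝ a m) ⟶ ⊝ L
⟶-⊝ p m = ⊝-cong[] (p m)

⟶-const : ∀ {L} → (λ _ → L) ⟶ L
⟶-const m = ≈⇒≡[] ≈-refl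

⟶-subsequence : ∀ {a L} (φ : ℕ → ℕ) → (∀ m → m ≤ φ m) → a ⟶ L → (λ m → a (φ m)) ⟶ L
⟶-subsequence φ m≤φm p m = ≡[]-weaken (m≤φm m) (p (φ m))

m≤m*k : ∀ k .{{_ : ℕ.NonZero k}} m → m ≤ m * k
m≤m*k k m = ℕ.m≤m*n m k

-- Coefficient n is read at stage n + 1, the first stage at which `_⟶_` fixes it.
limit : (ℕ → Series) → Series
limit a n = a (suc n) n

⟶-limit : ∀ {a} → (∀ m → a (suc m) ≡[ m ] a m) → a ⟶ limit a
⟶-limit {a} cauchy m = below λ n n<m →
  subst (λ m → a m n ≡ a (suc n) n) (ℕ.m∸n+n≡m n<m) (go n (m ∸ suc n))
  where
  go : ∀ n d → a (d + suc n) n ≡ a (suc n) n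
  go n zero    = refl
  go n (suc d) = trans (agree (cauchy (d + suc n)) n (ℕ.m≤n+m (suc n) d)) (go n d)

-- Finite sums and products

∑ ∏ : (ℕ → Series) → ℕ → Series
∑ h zero    = 𝟘
∑ h (suc n) = ∑ h n ⊕ h n
∏ h zero    = 𝟙
∏ h (suc n) = ∏ h n ⊗ h n

∑-⟶ : ∀ h → (∀ n → h n ≡[ n ] 𝟘) → ∑ h ⟶ limit (∑ h)
∑-⟶ h p = ⟶-limit λ m →
  ≡[]-trans (⊕-cong[] (≈⇒≡[] ≈-refl) (p m)) (≈⇒≡[] (⊕-identityʳ _))

∏-⟶ : ∀ h → (∀ n → h n ≡[ n ] 𝟙) → ∏ h ⟶ limit (∏ h)
∏-⟶ h p = ⟶-limit λ m →
  ≡[]-trans (⊗-cong[] (≈⇒≡[] ≈-refl) (p m)) (≈⇒≡[] (⊗-identityʳ _))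

∑-cong : ∀ {h h′} n → (∀ i → i < n → h i ≈ h′ i) → ∑ h n ≈ ∑ h′ n
∑-cong zero    p = ≈-refl
∑-cong (suc n) p = ⊕-cong (∑-cong n λ i i<n → p i (ℕ.m<n⇒m<1+n i<n)) (p n ℕ.≤-refl)

∑-cong[] : ∀ {N h h′} n → (∀ i → i < n → h i ≡[ N ] h′ i) → ∑ h n ≡[ N ] ∑ h′ n
∑-cong[] zero    p = ≈⇒≡[] ≈-refl
∑-cong[] (suc n) p = ⊕-cong[] (∑-cong[] n λ i i<n → p i (ℕ.m<n⇒m<1+n i<n)) (p n ℕ.≤-refl)

∏-cong : ∀ {h h′} n → (∀ i → h i ≈ h′ i) → ∏ h n ≈ ∏ h′ n
∏-cong zero    p = ≈-refl
∏-cong (suc n) p = ⊗-cong (∏-cong n p) (p n)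

∑-⊕ : ∀ h h′ n → ∑ (λ i → h i ⊕ h′ i) n ≈ ∑ h n ⊕ ∑ h′ n
∑-⊕ h h′ zero    = ≈-sym (⊕-identityʳ 𝟘)
∑-⊕ h h′ (suc n) = ≈-trans (⊕-cong (∑-⊕ h h′ n) ≈-refl)
  (solve 4 (λ a b c d → a :+ b :+ (c :+ d) := a :+ c :+ (b :+ d)) ≈-refl _ _ (h n) (h′ n))

∑-⊗ : ∀ f h n → ∑ (λ i → f ⊗ h i) n ≈ f ⊗ ∑ h n
∑-⊗ f h zero    = ≈-sym (≈-trans (⊗-comm f 𝟘) (⊗-zeroˡ f))
∑-⊗ f h (suc n) = ≈-trans (⊕-cong (∑-⊗ f h n) ≈-refl) (≈-sym (⊗-distribˡ f _ (h n)))

∑-head : ∀ h n → ∑ h (suc n) ≈ h 0 ⊕ ∑ (λ i → h (suc i)) n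
∑-head h zero    = ⊕-comm 𝟘 (h 0)
∑-head h (suc n) = ≈-trans (⊕-cong (∑-head h n) ≈-refl)
  (solve 3 (λ a b c → a :+ b :+ c := a :+ (b :+ c)) ≈-refl (h 0) _ (h (suc n)))

∑-+ : ∀ h m n → ∑ h (m + n) ≈ ∑ h m ⊕ ∑ (λ i → h (m + i)) n
∑-+ h m zero    = ≈-trans (≡⇒≈ (cong (∑ h) (ℕ.+-identityʳ m))) (≈-sym (⊕-identityʳ _))
∑-+ h m (suc n) = ≈-trans (≡⇒≈ (cong (∑ h) (ℕ.+-suc m n)))
  (≈-trans (⊕-cong (∑-+ h m n) ≈-refl)
    (solve 3 (λ a b c → a :+ b :+ c := a :+ (b :+ c)) ≈-refl (∑ h m) _ (h (m + n))))

∑-block : ∀ k h n → ∑ h (n * k) ≈ ∑ (λ i → ∑ (λ r → h (i * k + r)) k) n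
∑-block k h zero    = ≈-refl
∑-block k h (suc n) = ≈-trans (≡⇒≈ (cong (∑ h) (ℕ.+-comm k (n * k))))
  (≈-trans (∑-+ h (n * k) k) (⊕-cong (∑-block k h n) ≈-refl))

∑-reverse : ∀ h n → ∑ h n ≈ ∑ (λ i → h (n ∸ suc i)) n
∑-reverse h zero    = ≈-refl
∑-reverse h (suc n) = ≈-trans (⊕-cong (∑-reverse h n) ≈-refl)
  (≈-trans (solve 2 (λ a b → a :+ b := b :+ a) ≈-refl _ (h n))
    (≈-sym (∑-head (λ i → h (suc n ∸ suc i)) n)))

∏-⊗ : ∀ h h′ n → ∏ (λ i → h i ⊗ h′ i) n ≈ ∏ h n ⊗ ∏ h′ n
∏-⊗ h h′ zero    = ≈-sym (⊗-identityˡ 𝟙)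
∏-⊗ h h′ (suc n) = ≈-trans (⊗-cong (∏-⊗ h h′ n) ≈-refl)
  (solve 4 (λ a b c d → a :* b :* (c :* d) := a :* c :* (b :* d)) ≈-refl _ _ (h n) (h′ n))

∏-+ : ∀ h m n → ∏ h (m + n) ≈ ∏ h m ⊗ ∏ (λ i → h (m + i)) n
∏-+ h m zero    = ≈-trans (≡⇒≈ (cong (∏ h) (ℕ.+-identityʳ m))) (≈-sym (⊗-identityʳ _))
∏-+ h m (suc n) = ≈-trans (≡⇒≈ (cong (∏ h) (ℕ.+-suc m n)))
  (≈-trans (⊗-cong (∏-+ h m n) ≈-refl)
    (solve 3 (λ a b c → a :* b :* c := a :* (b :* c)) ≈-refl (∏ h m) _ (h (m + n))))

∏-block : ∀ k h n → ∏ h (n * k) ≈ ∏ (λ i → ∏ (λ r → h (i * k + r)) k) n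
∏-block k h zero    = ≈-refl
∏-block k h (suc n) = ≈-trans (≡⇒≈ (cong (∏ h) (ℕ.+-comm k (n * k))))
  (≈-trans (∏-+ h (n * k) k) (⊗-cong (∏-block k h n) ≈-refl))

∏-𝟙 : ∀ n → ∏ (λ _ → 𝟙) n ≈ 𝟙
∏-𝟙 zero    = ≈-refl
∏-𝟙 (suc n) = ≈-trans (⊗-identityʳ _) (∏-𝟙 n)

∏-swap : ∀ (h : ℕ → ℕ → Series) n k → ∏ (λ i → ∏ (λ r → h i r) k) n ≈ ∏ (λ r → ∏ (λ i → h i r) n) k
∏-swap h n zero    = ∏-𝟙 n
∏-swap h n (suc k) = ≈-trans (∏-⊗ (λ i → ∏ (h i) k) (λ i → h i k) n) (⊗-cong (∏-swap h n k) ≈-refl)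

⟶-∏ : ∀ {a : ℕ → ℕ → Series} {L : ℕ → Series} k → (∀ r → (λ m → a m r) ⟶ L r) →
      (λ m → ∏ (a m) k) ⟶ ∏ L k
⟶-∏ zero    p = ⟶-const
⟶-∏ (suc k) p = ⟶-⊗ (⟶-∏ k p) (p k)

opaque
  unfolding _⊕_ ⊝_

  tail-⊕ : ∀ f g → tail (f ⊕ g) ≈ tail f ⊕ tail g
  tail-⊕ f g = ≈-refl

  tail-⊗ : ∀ f g → tail (f ⊗ g) ≈ const (f 0) ⊗ tail g ⊕ tail f ⊗ g
  tail-⊗ f g = pointwise λ n → cong (ℤ._+ (tail f ⊗ g) n) (sym (const-⊗ (f 0) (tail g) n))

  ≈-const⊕shift : ∀ f → f ≈ const (f 0) ⊕ shift (tail f)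
  ≈-const⊕shift f = pointwise λ
    { zero → sym (ℤ.+-identityʳ (f 0)) ; (suc n) → sym (ℤ.+-identityˡ (f (suc n))) }

-- Substitutions q ↦ s q^k

-- delayed s k j f is q^j f(s q^k), for k ≥ 1.
delayed : ℤ → ℕ → ℕ → Series → Series
delayed s k zero    f zero    = f 0
delayed s k zero    f (suc n) = s ℤ.* delayed s k (k ∸ 1) (tail f) n
delayed s k (suc j) f zero    = 0ℤ
delayed s k (suc j) f (suc n) = delayed s k j f n

subs : ℤ → ℕ → Series → Series
subs s k = delayed s k 0

delayed≈ : ∀ s k j f → delayed s k j f ≈ mono 1ℤ j ⊗ subs s k f
delayed≈ s k zero    f = ≈-sym (⊗-identityˡ _)
delayed≈ s k (suc j) f = ≈-sym (≈-trans (shift-⊗ (mono 1ℤ j) (subs s k f))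
  (≈-trans (shift-cong (≈-sym (delayed≈ s k j f)))
           (pointwise λ { zero → refl ; (suc n) → refl })))

subs-unfold : ∀ s k f → subs s (suc k) f ≈ const (f 0) ⊕ mono s (suc k) ⊗ subs s (suc k) (tail f)
subs-unfold s k f = begin
  subs s (suc k) f
    ≈⟨ ≈-const⊕shift (subs s (suc k) f) ⟩
  const (f 0) ⊕ shift (λ n → s ℤ.* delayed s (suc k) k (tail f) n)
    ≈⟨ ⊕-cong ≈-refl (shift-cong (begin
         (λ n → s ℤ.* delayed s (suc k) k (tail f) n)
           ≈⟨ pointwise (λ n → sym (const-⊗ s (delayed s (suc k) k (tail f)) n)) ⟩
         const s ⊗ delayed s (suc k) k (tail f)
           ≈⟨ ⊗-cong ≈-refl (delayed≈ s (suc k) k (tail f)) ⟩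
         const s ⊗ (mono 1ℤ k ⊗ subs s (suc k) (tail f))
           ≈⟨ ≈-sym (⊗-assoc _ _ _) ⟩
         const s ⊗ mono 1ℤ k ⊗ subs s (suc k) (tail f)
           ≈⟨ ⊗-cong (≈-trans (mono-⊗ s 1ℤ 0 k) (≡⇒≈ (cong (λ s → mono s k) (ℤ.*-identityʳ s)))) ≈-refl ⟩
         mono s k ⊗ subs s (suc k) (tail f) ∎)) ⟩
  const (f 0) ⊕ shift (mono s k ⊗ subs s (suc k) (tail f))
    ≈⟨ ⊕-cong ≈-refl (≈-sym (shift-⊗ (mono s k) _)) ⟩
  const (f 0) ⊕ mono s (suc k) ⊗ subs s (suc k) (tail f) ∎

subs-cong[] : ∀ s k {f g N} → f ≡[ N ] g → subs s k f ≡[ N ] subs s k g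
subs-cong[] s k p = go 0 p
  where
  go : ∀ j {f g N} → f ≡[ N ] g → delayed s k j f ≡[ N ] delayed s k j g
  go j {N = zero}  p = below λ n ()
  go j {f} {g} {N = suc N} p = below (coeffs j)
    where
    coeffs : ∀ j n → n < suc N → delayed s k j f n ≡ delayed s k j g n
    coeffs zero    zero    _         = agree p 0 z<s
    coeffs zero    (suc n) (s<s n<N) = cong (s ℤ.*_)
      (agree (go (k ∸ 1) {N = N} (below λ m m<N → agree p (suc m) (s<s m<N))) n n<N)
    coeffs (suc j) zero    _         = refl
    coeffs (suc j) (suc n) n<N       = coeffs j n (ℕ.<-trans ℕ.≤-refl n<N)

subs-cong : ∀ s k {f g} → f ≈ g → subs s k f ≈ subs s k g
subs-cong s k p = ≡[]⇒≈ λ N → subs-cong[] s k (≈⇒≡[] p)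

⟶-subs : ∀ s k {a L} → a ⟶ L → (λ m → subs s k (a m)) ⟶ subs s k L
⟶-subs s k p m = subs-cong[] s k (p m)

-- One unfolding of a substitution multiplies by a positive power of q, so precision N for the tails
-- gives N + 1 for the series. This drives the inductions on precision by which substitutions
-- respect sums and products and commute with each other.
unfold-cong[] : ∀ c s k {f g N} → f ≡[ N ] g →
                const c ⊕ mono s (suc k) ⊗ f ≡[ suc N ] const c ⊕ mono s (suc k) ⊗ g
unfold-cong[] c s k {N = N} p = ⊕-cong[] (≈⇒≡[] ≈-refl)
  (≡[]-weaken (s≤s (ℕ.m≤n+m N k)) (mono-⊗-cong[] s (suc k) p))

subs-𝟘 : ∀ s k → subs s k 𝟘 ≈ 𝟘
subs-𝟘 s k = pointwise (go 0)
  where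
  go : ∀ j n → delayed s k j 𝟘 n ≡ 0ℤ
  go zero    zero    = refl
  go zero    (suc n) = trans (cong (s ℤ.*_) (go (k ∸ 1) n)) (ℤ.*-zeroʳ s)
  go (suc j) zero    = refl
  go (suc j) (suc n) = go j n

subs-const : ∀ s k c → subs s (suc k) (const c) ≈ const c
subs-const s k c = ≈-trans (subs-unfold s k (const c))
  (≈-trans (⊕-cong ≈-refl (≈-trans (⊗-cong ≈-refl (subs-𝟘 s (suc k))) (≈-trans (⊗-comm _ 𝟘) (⊗-zeroˡ _))))
           (⊕-identityʳ _))

subs-mono : ∀ s k t l → subs s (suc k) (mono t l) ≈ mono (t ℤ.* s ℤ.^ l) (l * suc k)
subs-mono s k t zero    = ≈-trans (subs-const s k t) (≡⇒≈ (cong const (sym (ℤ.*-identityʳ t))))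
subs-mono s k t (suc l) = begin
  subs s (suc k) (shift (mono t l))
    ≈⟨ subs-unfold s k (shift (mono t l)) ⟩
  const 0ℤ ⊕ mono s (suc k) ⊗ subs s (suc k) (mono t l)
    ≈⟨ ⊕-cong (pointwise λ { zero → refl ; (suc n) → refl }) ≈-refl ⟩
  𝟘 ⊕ mono s (suc k) ⊗ subs s (suc k) (mono t l)
    ≈⟨ ⊕-identityˡ _ ⟩
  mono s (suc k) ⊗ subs s (suc k) (mono t l)
    ≈⟨ ⊗-cong ≈-refl (subs-mono s k t l) ⟩
  mono s (suc k) ⊗ mono (t ℤ.* s ℤ.^ l) (l * suc k)
    ≈⟨ mono-⊗ s _ (suc k) (l * suc k) ⟩
  mono (s ℤ.* (t ℤ.* s ℤ.^ l)) (suc l * suc k)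
    ≈⟨ ≡⇒≈ (cong (λ x → mono x (suc l * suc k)) (swap s t (s ℤ.^ l))) ⟩
  mono (t ℤ.* s ℤ.^ suc l) (suc l * suc k) ∎
  where
  swap : ∀ s t u → s ℤ.* (t ℤ.* u) ≡ t ℤ.* (s ℤ.* u)
  swap = solve-∀

subs-⊕ : ∀ s k f g → subs s (suc k) (f ⊕ g) ≈ subs s (suc k) f ⊕ subs s (suc k) g
subs-⊕ s k f g = ≡[]⇒≈ λ N → go N f g
  where
  Φ : Series → Series
  Φ = subs s (suc k)
  go : ∀ N f g → Φ (f ⊕ g) ≡[ N ] Φ f ⊕ Φ g
  go zero    f g = below λ n ()
  go (suc N) f g = ≡[]-trans (≈⇒≡[] (subs-unfold s k (f ⊕ g))) (≡[]-trans
    (unfold-cong[] ((f ⊕ g) 0) s k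
      (≡[]-trans (≈⇒≡[] (subs-cong s (suc k) (tail-⊕ f g))) (go N (tail f) (tail g))))
    (≈⇒≡[] (begin
      const ((f ⊕ g) 0) ⊕ mono s (suc k) ⊗ (Φ (tail f) ⊕ Φ (tail g))
        ≈⟨ ⊕-cong (≈-trans (≡⇒≈ (cong const (⊕-coeff f g 0))) (const-⊕ (f 0) (g 0))) ≈-refl ⟩
      const (f 0) ⊕ const (g 0) ⊕ mono s (suc k) ⊗ (Φ (tail f) ⊕ Φ (tail g))
        ≈⟨ solve 5 (λ a b x y z → a :+ b :+ x :* (y :+ z) := a :+ x :* y :+ (b :+ x :* z)) ≈-refl
             (const (f 0)) (const (g 0)) (mono s (suc k)) (Φ (tail f)) (Φ (tail g)) ⟩
      const (f 0) ⊕ mono s (suc k) ⊗ Φ (tail f) ⊕ (const (g 0) ⊕ mono s (suc k) ⊗ Φ (tail g))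
        ≈⟨ ≈-sym (⊕-cong (subs-unfold s k f) (subs-unfold s k g)) ⟩
      Φ f ⊕ Φ g ∎)))

subs-⊗ : ∀ s k f g → subs s (suc k) (f ⊗ g) ≈ subs s (suc k) f ⊗ subs s (suc k) g
subs-⊗ s k f g = ≡[]⇒≈ λ N → go N f g
  where
  Φ : Series → Series
  Φ = subs s (suc k)
  m : Series
  m = mono s (suc k)
  go : ∀ N f g → Φ (f ⊗ g) ≡[ N ] Φ f ⊗ Φ g
  go zero    f g = below λ n ()
  go (suc N) f g = ≡[]-trans (≈⇒≡[] (subs-unfold s k (f ⊗ g))) (≡[]-trans
    (unfold-cong[] (f 0 ℤ.* g 0) s k (≡[]-trans
      (≈⇒≡[] (≈-trans (subs-cong s (suc k) (tail-⊗ f g)) (subs-⊕ s k _ _)))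
      (⊕-cong[] (≡[]-trans (go N (const (f 0)) (tail g)) (⊗-cong[] (≈⇒≡[] (subs-const s k (f 0))) (≈⇒≡[] ≈-refl)))
                (go N (tail f) g))))
    (≈⇒≡[] (begin
      const (f 0 ℤ.* g 0) ⊕ m ⊗ (const (f 0) ⊗ Φ (tail g) ⊕ Φ (tail f) ⊗ Φ g)
        ≈⟨ ⊕-cong (≈-sym (mono-⊗ (f 0) (g 0) 0 0)) ≈-refl ⟩
      const (f 0) ⊗ const (g 0) ⊕ m ⊗ (const (f 0) ⊗ Φ (tail g) ⊕ Φ (tail f) ⊗ Φ g)
        ≈⟨ solve 6 (λ a b x y z w → a :* b :+ x :* (a :* y :+ z :* w) := a :* (b :+ x :* y) :+ x :* z :* w)
             ≈-refl (const (f 0)) (const (g 0)) m (Φ (tail g)) (Φ (tail f)) (Φ g) ⟩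
      const (f 0) ⊗ (const (g 0) ⊕ m ⊗ Φ (tail g)) ⊕ m ⊗ Φ (tail f) ⊗ Φ g
        ≈⟨ ⊕-cong (⊗-cong ≈-refl (≈-sym (subs-unfold s k g))) ≈-refl ⟩
      const (f 0) ⊗ Φ g ⊕ m ⊗ Φ (tail f) ⊗ Φ g
        ≈⟨ ≈-sym (⊗-distribʳ (Φ g) _ _) ⟩
      (const (f 0) ⊕ m ⊗ Φ (tail f)) ⊗ Φ g
        ≈⟨ ⊗-cong (≈-sym (subs-unfold s k f)) ≈-refl ⟩
      Φ f ⊗ Φ g ∎)))

subs-⊝ : ∀ s k f → subs s (suc k) (⊝ f) ≈ ⊝ subs s (suc k) f
subs-⊝ s k f = begin
  subs s (suc k) (⊝ f)
    ≈⟨ subs-cong s (suc k) (⊝≈ f) ⟩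
  subs s (suc k) (const -1ℤ ⊗ f)
    ≈⟨ subs-⊗ s k (const -1ℤ) f ⟩
  subs s (suc k) (const -1ℤ) ⊗ subs s (suc k) f
    ≈⟨ ⊗-cong (subs-const s k -1ℤ) ≈-refl ⟩
  const -1ℤ ⊗ subs s (suc k) f
    ≈⟨ ≈-sym (⊝≈ (subs s (suc k) f)) ⟩
  ⊝ subs s (suc k) f ∎
  where
  ⊝≈ : ∀ f → ⊝ f ≈ const -1ℤ ⊗ f
  ⊝≈ = solve 1 (λ f → :- f := con -1ℤ :* f) ≈-refl

subs-∏ : ∀ s k h n → subs s (suc k) (∏ h n) ≈ ∏ (λ i → subs s (suc k) (h i)) n
subs-∏ s k h zero    = subs-const s k 1ℤ
subs-∏ s k h (suc n) = ≈-trans (subs-⊗ s k _ _) (⊗-cong (subs-∏ s k h n) ≈-refl)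

subs-∑ : ∀ s k h n → subs s (suc k) (∑ h n) ≈ ∑ (λ i → subs s (suc k) (h i)) n
subs-∑ s k h zero    = subs-𝟘 s (suc k)
subs-∑ s k h (suc n) = ≈-trans (subs-⊕ s k _ _) (⊕-cong (subs-∑ s k h n) ≈-refl)

σ : Series → Series
σ = subs -1ℤ 1

σ-coeff : ∀ f n → σ f n ≡ -1ℤ ℤ.^ n ℤ.* f n
σ-coeff f zero    = sym (ℤ.*-identityˡ (f 0))
σ-coeff f (suc n) = trans (cong (-1ℤ ℤ.*_) (σ-coeff (tail f) n)) (sym (ℤ.*-assoc -1ℤ (-1ℤ ℤ.^ n) (f (suc n))))

δ : ℕ → Series → Series
δ = subs 1ℤ

δ-mono : ∀ k s l → δ (suc k) (mono s l) ≈ mono s (l * suc k)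
δ-mono k s l = ≈-trans (subs-mono 1ℤ k s l) (≡⇒≈ (cong (λ x → mono x (l * suc k))
  (trans (cong (s ℤ.*_) (ℤ.^-zeroˡ l)) (ℤ.*-identityʳ s))))

X^ : ℕ → Series
X^ k = mono 1ℤ k

δ-comm : ∀ k l f → δ (suc k) (δ (suc l) f) ≈ δ (suc l) (δ (suc k) f)
δ-comm k l f = ≡[]⇒≈ λ N → go N f
  where
  both : ∀ k l f → δ (suc k) (δ (suc l) f) ≈ const (f 0) ⊕ X^ (suc l * suc k) ⊗ δ (suc k) (δ (suc l) (tail f))
  both k l f = ≈-trans (subs-cong 1ℤ (suc k) (subs-unfold 1ℤ l f)) (≈-trans (subs-⊕ 1ℤ k _ _)
    (⊕-cong (subs-const 1ℤ k (f 0)) (≈-trans (subs-⊗ 1ℤ k _ _) (⊗-cong (δ-mono k 1ℤ (suc l)) ≈-refl))))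
  go : ∀ N f → δ (suc k) (δ (suc l) f) ≡[ N ] δ (suc l) (δ (suc k) f)
  go zero    f = below λ n ()
  go (suc N) f = ≡[]-trans (≈⇒≡[] (both k l f))
    (≡[]-trans (unfold-cong[] (f 0) 1ℤ (k + l * suc k) (go N (tail f)))
      (≈⇒≡[] (≈-sym (≈-trans (both l k f)
        (⊕-cong ≈-refl (⊗-cong (≡⇒≈ (cong X^ (ℕ.*-comm (suc k) (suc l)))) ≈-refl))))))

-- Sections: the exponents in one residue class

sec : ℕ → ℕ → Series → Series
sec k r f n = f (n * k + r)

sec-cong : ∀ k r {f g} → f ≈ g → sec k r f ≈ sec k r g
sec-cong k r p = pointwise λ n → coeff p (n * k + r)

opaque
  unfolding _⊕_ ⊝_

  sec-⊕ : ∀ k r f g → sec k r (f ⊕ g) ≈ sec k r f ⊕ sec k r g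
  sec-⊕ k r f g = ≈-refl

  sec-⊝ : ∀ k r f → sec k r (⊝ f) ≈ ⊝ sec k r f
  sec-⊝ k r f = ≈-refl

sec-const⊗ : ∀ k r c f → sec k r (const c ⊗ f) ≈ const c ⊗ sec k r f
sec-const⊗ k r c f = pointwise λ n → trans (const-⊗ c f (n * k + r)) (sym (const-⊗ c (sec k r f) n))

sec-X^⊗ : ∀ k r f → r < k → sec k r (X^ k ⊗ f) ≈ shift (sec k r f)
sec-X^⊗ k r f r<k = pointwise λ
  { zero    → mono-⊗-coeff-< 1ℤ k f r<k
  ; (suc n) → trans (cong (X^ k ⊗ f) (ℕ.+-assoc k (n * k) r))
                (trans (mono-⊗-coeff-+ 1ℤ k f (n * k + r)) (ℤ.*-identityˡ _)) }

X⊗ : ∀ f → X^ 1 ⊗ f ≈ shift f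
X⊗ f = ≈-trans (shift-⊗ 𝟙 f) (shift-cong (⊗-identityˡ f))

⊗-unfold : ∀ x g → x ⊗ g ≈ const (x 0) ⊗ g ⊕ shift (tail x ⊗ g)
⊗-unfold x g = ≈-trans (⊗-cong (≈-const⊕shift x) ≈-refl)
  (≈-trans (⊗-distribʳ g _ _) (⊕-cong ≈-refl (shift-⊗ (tail x) g)))

shift-cong[] : ∀ {f g N} → f ≡[ N ] g → shift f ≡[ suc N ] shift g
shift-cong[] p = below λ { zero _ → refl ; (suc n) (s<s n<N) → agree p n n<N }

-- Sections are linear over the series in q^(k+1), because multiplication by q^(k+1) only shifts a
-- section by one place. Moving such a factor out is how nearly every section below is computed.
sec-δ⊗ : ∀ k r x f → r < suc k → sec (suc k) r (δ (suc k) x ⊗ f) ≈ x ⊗ sec (suc k) r f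
sec-δ⊗ k r x f r<k = ≡[]⇒≈ λ N → go N x
  where
  go : ∀ N x → sec (suc k) r (δ (suc k) x ⊗ f) ≡[ N ] x ⊗ sec (suc k) r f
  go zero    x = below λ n ()
  go (suc N) x = ≡[]-trans (≈⇒≡[] (begin
      sec (suc k) r (δ (suc k) x ⊗ f)
        ≈⟨ sec-cong (suc k) r (≈-trans (⊗-cong (subs-unfold 1ℤ k x) ≈-refl)
             (solve 4 (λ a b c d → (a :+ b :* c) :* d := a :* d :+ b :* (c :* d))
                ≈-refl (const (x 0)) (X^ (suc k)) (δ (suc k) (tail x)) f)) ⟩
      sec (suc k) r (const (x 0) ⊗ f ⊕ X^ (suc k) ⊗ (δ (suc k) (tail x) ⊗ f))
        ≈⟨ sec-⊕ (suc k) r _ _ ⟩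
      sec (suc k) r (const (x 0) ⊗ f) ⊕ sec (suc k) r (X^ (suc k) ⊗ (δ (suc k) (tail x) ⊗ f))
        ≈⟨ ⊕-cong (sec-const⊗ (suc k) r (x 0) f) (sec-X^⊗ (suc k) r _ r<k) ⟩
      const (x 0) ⊗ sec (suc k) r f ⊕ shift (sec (suc k) r (δ (suc k) (tail x) ⊗ f)) ∎))
    (≡[]-trans (⊕-cong[] (≈⇒≡[] ≈-refl) (shift-cong[] (go N (tail x))))
      (≈⇒≡[] (≈-sym (⊗-unfold x (sec (suc k) r f)))))

sec-X^δ : ∀ k r x → r < suc k → sec (suc k) r (X^ r ⊗ δ (suc k) x) ≈ x
sec-X^δ k r x r<k = ≈-trans (sec-cong (suc k) r (⊗-comm _ _)) (≈-trans (sec-δ⊗ k r x (X^ r) r<k)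
  (≈-trans (⊗-cong ≈-refl unit) (⊗-identityʳ x)))
  where
  mono-diagonal : ∀ j → mono 1ℤ j j ≡ 1ℤ
  mono-diagonal zero    = refl
  mono-diagonal (suc j) = mono-diagonal j
  unit : sec (suc k) r (X^ r) ≈ 𝟙
  unit = pointwise λ
    { zero    → mono-diagonal r
    ; (suc n) → mono-coeff-≢ 1ℤ r (λ e → ℕ.m≢1+n+m r {k + n * suc k} (sym e)) }

sec-X^δ≢ : ∀ k j r x → j < suc k → r < suc k → r ≢ j → sec (suc k) r (X^ j ⊗ δ (suc k) x) ≈ 𝟘
sec-X^δ≢ k j r x j<k r<k r≢j = ≈-trans (sec-cong (suc k) r (⊗-comm _ _)) (≈-trans (sec-δ⊗ k r x (X^ j) r<k)
  (≈-trans (⊗-cong ≈-refl vanish) (≈-trans (⊗-comm x 𝟘) (⊗-zeroˡ x))))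
  where
  vanish : sec (suc k) r (X^ j) ≈ 𝟘
  vanish = pointwise λ
    { zero    → mono-coeff-≢ 1ℤ j r≢j
    ; (suc n) → mono-coeff-≢ 1ℤ j λ e → ℕ.<⇒≱ j<k
        (subst (suc k ≤_) e (ℕ.≤-trans (ℕ.m≤m+n (suc k) (n * suc k)) (ℕ.m≤m+n _ r))) }

-- Dissection modulo 3 and the cubic norm

combine₃ : Series → Series → Series → Series
combine₃ a b c = δ 3 a ⊕ X^ 1 ⊗ δ 3 b ⊕ X^ 2 ⊗ δ 3 c

module _ (a b c : Series) where
  private
    sections : ∀ r → sec 3 r (combine₃ a b c) ≈
      sec 3 r (X^ 0 ⊗ δ 3 a) ⊕ sec 3 r (X^ 1 ⊗ δ 3 b) ⊕ sec 3 r (X^ 2 ⊗ δ 3 c)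
    sections r = ≈-trans (sec-⊕ 3 r _ _)
      (⊕-cong (≈-trans (sec-⊕ 3 r _ _) (⊕-cong (sec-cong 3 r (≈-sym (⊗-identityˡ (δ 3 a)))) ≈-refl)) ≈-refl)

  sec-combine₃-0 : sec 3 0 (combine₃ a b c) ≈ a
  sec-combine₃-0 = ≈-trans (sections 0) (≈-trans
    (⊕-cong (⊕-cong (sec-X^δ 2 0 a z<s) (sec-X^δ≢ 2 1 0 b (s<s z<s) z<s λ ()))
            (sec-X^δ≢ 2 2 0 c (s<s (s<s z<s)) z<s λ ()))
    (≈-trans (⊕-identityʳ _) (⊕-identityʳ a)))

  sec-combine₃-1 : sec 3 1 (combine₃ a b c) ≈ b
  sec-combine₃-1 = ≈-trans (sections 1) (≈-trans
    (⊕-cong (⊕-cong (sec-X^δ≢ 2 0 1 a z<s (s<s z<s) λ ()) (sec-X^δ 2 1 b (s<s z<s)))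
            (sec-X^δ≢ 2 2 1 c (s<s (s<s z<s)) (s<s z<s) λ ()))
    (≈-trans (⊕-identityʳ _) (⊕-identityˡ b)))

  sec-combine₃-2 : sec 3 2 (combine₃ a b c) ≈ c
  sec-combine₃-2 = ≈-trans (sections 2) (≈-trans
    (⊕-cong (⊕-cong (sec-X^δ≢ 2 0 2 a z<s (s<s (s<s z<s)) λ ()) (sec-X^δ≢ 2 1 2 b (s<s z<s) (s<s (s<s z<s)) λ ()))
            (sec-X^δ 2 2 c (s<s (s<s z<s))))
    (≈-trans (⊕-cong (⊕-identityʳ 𝟘) ≈-refl) (⊕-identityˡ c)))

-- Peeling three coefficients off a series peels one off each of its sections, so the series and its
-- recombination satisfy the same recursion.
≈-combine₃ : ∀ f → f ≈ combine₃ (sec 3 0 f) (sec 3 1 f) (sec 3 2 f)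
≈-combine₃ f = ≡[]⇒≈ λ N → go N f
  where
  go : ∀ N f → f ≡[ N ] combine₃ (sec 3 0 f) (sec 3 1 f) (sec 3 2 f)
  go zero    f = below λ n ()
  go (suc N) f = ≡[]-trans (≈⇒≡[] expand)
    (≡[]-trans (⊕-cong[] (≈⇒≡[] ≈-refl) (≡[]-weaken (s≤s (ℕ.m≤n+m N 2)) (mono-⊗-cong[] 1ℤ 3 (go N f₃))))
      (≈⇒≡[] collect))
    where
    f₃ : Series
    f₃ = tail (tail (tail f))
    head₃ : Series
    head₃ = const (f 0) ⊕ X^ 1 ⊗ (const (f 1) ⊕ X^ 1 ⊗ const (f 2))
    uncons : ∀ f → f ≈ const (f 0) ⊕ X^ 1 ⊗ tail f
    uncons f = ≈-trans (≈-const⊕shift f) (⊕-cong ≈-refl (≈-sym (X⊗ (tail f))))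
    X² : X^ 1 ⊗ X^ 1 ≈ X^ 2
    X² = mono-⊗ 1ℤ 1ℤ 1 1
    X³ : X^ 1 ⊗ (X^ 1 ⊗ X^ 1) ≈ X^ 3
    X³ = ≈-trans (⊗-cong ≈-refl X²) (mono-⊗ 1ℤ 1ℤ 1 2)
    expand : f ≈ head₃ ⊕ X^ 3 ⊗ f₃
    expand = begin
      f ≈⟨ ≈-trans (uncons f) (⊕-cong ≈-refl (⊗-cong ≈-refl (≈-trans (uncons (tail f))
             (⊕-cong ≈-refl (⊗-cong ≈-refl (uncons (tail (tail f)))))))) ⟩
      const (f 0) ⊕ X^ 1 ⊗ (const (f 1) ⊕ X^ 1 ⊗ (const (f 2) ⊕ X^ 1 ⊗ f₃))
        ≈⟨ solve 5 (λ a b c x y → a :+ x :* (b :+ x :* (c :+ x :* y)) :=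
             a :+ x :* (b :+ x :* c) :+ x :* (x :* x) :* y) ≈-refl (const (f 0)) (const (f 1)) (const (f 2)) (X^ 1) f₃ ⟩
      head₃ ⊕ X^ 1 ⊗ (X^ 1 ⊗ X^ 1) ⊗ f₃ ≈⟨ ⊕-cong ≈-refl (⊗-cong X³ ≈-refl) ⟩
      head₃ ⊕ X^ 3 ⊗ f₃ ∎
    collect : head₃ ⊕ X^ 3 ⊗ combine₃ (sec 3 0 f₃) (sec 3 1 f₃) (sec 3 2 f₃) ≈
              combine₃ (sec 3 0 f) (sec 3 1 f) (sec 3 2 f)
    collect = begin
      head₃ ⊕ X^ 3 ⊗ combine₃ (sec 3 0 f₃) (sec 3 1 f₃) (sec 3 2 f₃)
        ≈⟨ ⊕-cong ≈-refl (⊗-cong ≈-refl (⊕-cong ≈-refl (⊗-cong (≈-sym X²) ≈-refl))) ⟩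
      head₃ ⊕ X^ 3 ⊗ (δ 3 (sec 3 0 f₃) ⊕ X^ 1 ⊗ δ 3 (sec 3 1 f₃) ⊕ X^ 1 ⊗ X^ 1 ⊗ δ 3 (sec 3 2 f₃))
        ≈⟨ solve 8 (λ a b c x y u v w → a :+ x :* (b :+ x :* c) :+ y :* (u :+ x :* v :+ x :* x :* w) :=
             a :+ y :* u :+ x :* (b :+ y :* v) :+ x :* x :* (c :+ y :* w)) ≈-refl
             (const (f 0)) (const (f 1)) (const (f 2)) (X^ 1) (X^ 3)
             (δ 3 (sec 3 0 f₃)) (δ 3 (sec 3 1 f₃)) (δ 3 (sec 3 2 f₃)) ⟩
      const (f 0) ⊕ X^ 3 ⊗ δ 3 (sec 3 0 f₃) ⊕ X^ 1 ⊗ (const (f 1) ⊕ X^ 3 ⊗ δ 3 (sec 3 1 f₃))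
        ⊕ X^ 1 ⊗ X^ 1 ⊗ (const (f 2) ⊕ X^ 3 ⊗ δ 3 (sec 3 2 f₃))
        ≈⟨ ≈-sym (⊕-cong (⊕-cong (subs-unfold 1ℤ 2 (sec 3 0 f)) (⊗-cong ≈-refl (subs-unfold 1ℤ 2 (sec 3 1 f))))
             (⊗-cong (≈-sym X²) (subs-unfold 1ℤ 2 (sec 3 2 f)))) ⟩
      combine₃ (sec 3 0 f) (sec 3 1 f) (sec 3 2 f) ∎

-- f(q) f(ωq) f(ω²q) = (norm f)(q³) for a primitive cube root of unity ω.
cubic : Series → Series → Series → Series
cubic a b c = a ⊗ a ⊗ a ⊕ X^ 1 ⊗ (b ⊗ b ⊗ b) ⊕ X^ 1 ⊗ X^ 1 ⊗ (c ⊗ c ⊗ c)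
            ⊖ const (ℤ.+ 3) ⊗ X^ 1 ⊗ a ⊗ b ⊗ c

norm : Series → Series
norm f = cubic (sec 3 0 f) (sec 3 1 f) (sec 3 2 f)

cubic-cong[] : ∀ {N a a′ b b′ c c′} → a ≡[ N ] a′ → b ≡[ N ] b′ → c ≡[ N ] c′ → cubic a b c ≡[ N ] cubic a′ b′ c′
cubic-cong[] {N} p q r =
  ⊕-cong[] (⊕-cong[] (⊕-cong[] (cube p) (⊗-cong[] (≈⇒≡[] ≈-refl) (cube q))) (⊗-cong[] (≈⇒≡[] ≈-refl) (cube r)))
    (⊝-cong[] (⊗-cong[] (⊗-cong[] (⊗-cong[] (≈⇒≡[] ≈-refl) p) q) r))
  where
  cube : ∀ {f f′} → f ≡[ N ] f′ → f ⊗ f ⊗ f ≡[ N ] f′ ⊗ f′ ⊗ f′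
  cube p = ⊗-cong[] (⊗-cong[] p p) p

cubic-cong : ∀ {a a′ b b′ c c′} → a ≈ a′ → b ≈ b′ → c ≈ c′ → cubic a b c ≈ cubic a′ b′ c′
cubic-cong p q r = ≡[]⇒≈ λ N → cubic-cong[] (≈⇒≡[] p) (≈⇒≡[] q) (≈⇒≡[] r)

norm-cong : ∀ {f g} → f ≈ g → norm f ≈ norm g
norm-cong p = cubic-cong (sec-cong 3 0 p) (sec-cong 3 1 p) (sec-cong 3 2 p)

norm-combine₃ : ∀ {f} a b c → f ≈ combine₃ a b c → norm f ≈ cubic a b c
norm-combine₃ a b c p = ≈-trans (norm-cong p)
  (cubic-cong (sec-combine₃-0 a b c) (sec-combine₃-1 a b c) (sec-combine₃-2 a b c))

-- Coefficient n < m of a section is coefficient n * 3 + r < m * 3 of the series; hence stage m * 3.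
⟶-norm : ∀ {a L} → a ⟶ L → (λ m → norm (a (m * 3))) ⟶ norm L
⟶-norm {a} {L} p m = cubic-cong[] (section 0 z<s) (section 1 (s<s z<s)) (section 2 (s<s (s<s z<s)))
  where
  section : ∀ r → r < 3 → sec 3 r (a (m * 3)) ≡[ m ] sec 3 r L
  section r r<3 = below λ n n<m → agree (p (m * 3)) (n * 3 + r) (ℕ.<-≤-trans
    (subst (n * 3 + r <_) (ℕ.+-comm (n * 3) 3) (ℕ.+-monoʳ-< (n * 3) r<3)) (ℕ.*-monoˡ-≤ 3 n<m))

-- A series in q³ is unchanged under q ↦ ωq, so its three conjugates coincide.
norm-δ : ∀ f → norm (δ 3 f) ≈ f ⊗ f ⊗ f
norm-δ f = ≈-trans (norm-combine₃ f 𝟘 𝟘 split) (≈-trans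
    (cubic-cong ≈-refl 𝟘≈ 𝟘≈)
    (solve 2 (λ f x → f :* f :* f :+ x :* (con 0ℤ :* con 0ℤ :* con 0ℤ) :+ x :* x :* (con 0ℤ :* con 0ℤ :* con 0ℤ)
      :- con (ℤ.+ 3) :* x :* f :* con 0ℤ :* con 0ℤ := f :* f :* f) ≈-refl f (X^ 1)))
  where
  𝟘≈ : 𝟘 ≈ const 0ℤ
  𝟘≈ = pointwise λ { zero → refl ; (suc n) → refl }
  vanish : ∀ j → X^ j ⊗ δ 3 𝟘 ≈ 𝟘
  vanish j = ≈-trans (⊗-cong ≈-refl (subs-𝟘 1ℤ 3)) (≈-trans (⊗-comm _ 𝟘) (⊗-zeroˡ _))
  split : δ 3 f ≈ combine₃ f 𝟘 𝟘
  split = ≈-sym (≈-trans (⊕-cong (⊕-cong ≈-refl (vanish 1)) (vanish 2))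
    (≈-trans (⊕-identityʳ _) (⊕-identityʳ _)))

-- Multiplication in the basis 1, q, q² over the series in q³. Products of degree 3 and 4 wrap
-- around, and the resulting q³ is `X^ 1` under `δ 3`.
combine₃-⊗ : ∀ a b c a′ b′ c′ → combine₃ a b c ⊗ combine₃ a′ b′ c′ ≈
  combine₃ (a ⊗ a′ ⊕ X^ 1 ⊗ (b ⊗ c′ ⊕ c ⊗ b′)) (a ⊗ b′ ⊕ b ⊗ a′ ⊕ X^ 1 ⊗ (c ⊗ c′)) (a ⊗ c′ ⊕ b ⊗ b′ ⊕ c ⊗ a′)
combine₃-⊗ a b c a′ b′ c′ = ≈-sym (begin
  combine₃ (a ⊗ a′ ⊕ X^ 1 ⊗ (b ⊗ c′ ⊕ c ⊗ b′)) (a ⊗ b′ ⊕ b ⊗ a′ ⊕ X^ 1 ⊗ (c ⊗ c′)) (a ⊗ c′ ⊕ b ⊗ b′ ⊕ c ⊗ a′)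
    ≈⟨ ⊕-cong (⊕-cong (δ⊕ (δ⊗ _ _) (δ-x⊗ (δ⊕ (δ⊗ _ _) (δ⊗ _ _))))
         (⊗-cong ≈-refl (δ⊕ (δ⊕ (δ⊗ _ _) (δ⊗ _ _)) (δ-x⊗ (δ⊗ _ _)))))
         (⊗-cong X² (δ⊕ (δ⊕ (δ⊗ _ _) (δ⊗ _ _)) (δ⊗ _ _))) ⟩
  _ ≈⟨ solve 7 (λ a b c a′ b′ c′ x →
         a :* a′ :+ x :* (x :* x) :* (b :* c′ :+ c :* b′)
           :+ x :* (a :* b′ :+ b :* a′ :+ x :* (x :* x) :* (c :* c′))
           :+ x :* x :* (a :* c′ :+ b :* b′ :+ c :* a′)
         := (a :+ x :* b :+ x :* x :* c) :* (a′ :+ x :* b′ :+ x :* x :* c′)) ≈-refl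
         (δ 3 a) (δ 3 b) (δ 3 c) (δ 3 a′) (δ 3 b′) (δ 3 c′) (X^ 1) ⟩
  (δ 3 a ⊕ X^ 1 ⊗ δ 3 b ⊕ X^ 1 ⊗ X^ 1 ⊗ δ 3 c) ⊗ (δ 3 a′ ⊕ X^ 1 ⊗ δ 3 b′ ⊕ X^ 1 ⊗ X^ 1 ⊗ δ 3 c′)
    ≈⟨ ≈-sym (⊗-cong (⊕-cong ≈-refl (⊗-cong X² ≈-refl)) (⊕-cong ≈-refl (⊗-cong X² ≈-refl))) ⟩
  combine₃ a b c ⊗ combine₃ a′ b′ c′ ∎)
  where
  X² : X^ 2 ≈ X^ 1 ⊗ X^ 1
  X² = ≈-sym (mono-⊗ 1ℤ 1ℤ 1 1)
  δ⊗ : ∀ f g → δ 3 (f ⊗ g) ≈ δ 3 f ⊗ δ 3 g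
  δ⊗ = subs-⊗ 1ℤ 2
  δ⊕ : ∀ {f g f′ g′} → δ 3 f ≈ f′ → δ 3 g ≈ g′ → δ 3 (f ⊕ g) ≈ f′ ⊕ g′
  δ⊕ p q = ≈-trans (subs-⊕ 1ℤ 2 _ _) (⊕-cong p q)
  δ-x⊗ : ∀ {f f′} → δ 3 f ≈ f′ → δ 3 (X^ 1 ⊗ f) ≈ X^ 1 ⊗ (X^ 1 ⊗ X^ 1) ⊗ f′
  δ-x⊗ p = ≈-trans (δ⊗ _ _) (⊗-cong (≈-trans (δ-mono 2 1ℤ 1)
    (≈-sym (≈-trans (⊗-cong ≈-refl (≈-sym X²)) (mono-⊗ 1ℤ 1ℤ 1 2)))) p)

-- `cubic` is the determinant of multiplication by the series in the basis 1, q, q². Once the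
-- product is written in sections, multiplicativity is a polynomial identity in the six sections and
-- q.
norm-⊗ : ∀ f g → norm (f ⊗ g) ≈ norm f ⊗ norm g
norm-⊗ f g = ≈-trans
  (norm-combine₃ _ _ _ (≈-trans (⊗-cong (≈-combine₃ f) (≈-combine₃ g)) (combine₃-⊗ _ _ _ _ _ _)))
  (solve 7 (λ a b c q x y z →
      let cubic′ = λ a b c → a :* a :* a :+ q :* (b :* b :* b) :+ q :* q :* (c :* c :* c)
                             :- con (ℤ.+ 3) :* q :* a :* b :* c in
      cubic′ (a :* x :+ q :* (b :* z :+ c :* y)) (a :* y :+ b :* x :+ q :* (c :* z)) (a :* z :+ b :* y :+ c :* x)
        := cubic′ a b c :* cubic′ x y z)
    ≈-refl (sec 3 0 f) (sec 3 1 f) (sec 3 2 f) (X^ 1) (sec 3 0 g) (sec 3 1 g) (sec 3 2 g))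

norm-𝟙 : norm 𝟙 ≈ 𝟙
norm-𝟙 = ≈-trans (norm-cong (≈-sym (subs-const 1ℤ 2 1ℤ))) (≈-trans (norm-δ 𝟙)
  (≈-trans (⊗-cong (⊗-identityˡ 𝟙) ≈-refl) (⊗-identityˡ 𝟙)))

norm-∏ : ∀ h n → norm (∏ h n) ≈ ∏ (λ i → norm (h i)) n
norm-∏ h zero    = norm-𝟙
norm-∏ h (suc n) = ≈-trans (norm-⊗ _ _) (⊗-cong (norm-∏ h n) ≈-refl)

δ2-⊗ : ∀ {f g f′ g′} → δ 2 f ≈ f′ → δ 2 g ≈ g′ → δ 2 (f ⊗ g) ≈ f′ ⊗ g′
δ2-⊗ p q = ≈-trans (subs-⊗ 1ℤ 1 _ _) (⊗-cong p q)

δ2-⊕ : ∀ {f g f′ g′} → δ 2 f ≈ f′ → δ 2 g ≈ g′ → δ 2 (f ⊕ g) ≈ f′ ⊕ g′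
δ2-⊕ p q = ≈-trans (subs-⊕ 1ℤ 1 _ _) (⊕-cong p q)

-- q ↦ q² permutes the residue classes mod 3.
δ2-combine₃ : ∀ a b c → δ 2 (combine₃ a b c) ≈ combine₃ (δ 2 a) (X^ 1 ⊗ δ 2 c) (δ 2 b)
δ2-combine₃ a b c = begin
  δ 2 (combine₃ a b c)
    ≈⟨ δ2-⊕ (δ2-⊕ (δ-comm 1 2 a) (δ2-⊗ (δ-mono 1 1ℤ 1) (δ-comm 1 2 b))) (δ2-⊗ (δ-mono 1 1ℤ 2) (δ-comm 1 2 c)) ⟩
  δ 3 (δ 2 a) ⊕ X^ 2 ⊗ δ 3 (δ 2 b) ⊕ X^ 4 ⊗ δ 3 (δ 2 c)
    ≈⟨ ⊕-cong ≈-refl (⊗-cong (≈-trans (≈-sym (mono-⊗ 1ℤ 1ℤ 1 3)) (⊗-cong ≈-refl (≈-sym (δ-mono 2 1ℤ 1)))) ≈-refl) ⟩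
  δ 3 (δ 2 a) ⊕ X^ 2 ⊗ δ 3 (δ 2 b) ⊕ X^ 1 ⊗ δ 3 (X^ 1) ⊗ δ 3 (δ 2 c)
    ≈⟨ solve 6 (λ a x b y z c → a :+ x :* b :+ y :* z :* c := a :+ y :* (z :* c) :+ x :* b) ≈-refl
         (δ 3 (δ 2 a)) (X^ 2) (δ 3 (δ 2 b)) (X^ 1) (δ 3 (X^ 1)) (δ 3 (δ 2 c)) ⟩
  δ 3 (δ 2 a) ⊕ X^ 1 ⊗ (δ 3 (X^ 1) ⊗ δ 3 (δ 2 c)) ⊕ X^ 2 ⊗ δ 3 (δ 2 b)
    ≈⟨ ⊕-cong (⊕-cong ≈-refl (⊗-cong ≈-refl (≈-sym (subs-⊗ 1ℤ 2 (X^ 1) (δ 2 c))))) ≈-refl ⟩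
  combine₃ (δ 2 a) (X^ 1 ⊗ δ 2 c) (δ 2 b) ∎

-- Doubling the exponents exchanges the sections b and c up to a factor q, and the monomials of
-- `cubic` match again after this exchange. It carries the norm of f₁ over to f₂.
norm-δ2 : ∀ f → norm (δ 2 f) ≈ δ 2 (norm f)
norm-δ2 f = ≈-trans (norm-combine₃ (δ 2 a) (X^ 1 ⊗ δ 2 c) (δ 2 b) (≈-trans (subs-cong 1ℤ 2 (≈-combine₃ f)) (δ2-combine₃ a b c))) (≈-sym (begin
  δ 2 (cubic a b c)
    ≈⟨ hom⊖ (δ2-⊕ (δ2-⊕ (cube a) (δ2-⊗ δx (cube b))) (δ2-⊗ (δ2-⊗ δx δx) (cube c)))
         (δ2-⊗ (δ2-⊗ (δ2-⊗ (δ2-⊗ (subs-const 1ℤ 1 (ℤ.+ 3)) δx) ≈-refl) ≈-refl) ≈-refl) ⟩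
  _ ≈⟨ solve 4 (λ a b c x → a :* a :* a :+ x :* x :* (b :* b :* b) :+ x :* x :* (x :* x) :* (c :* c :* c)
           :- con (ℤ.+ 3) :* (x :* x) :* a :* b :* c
         := a :* a :* a :+ x :* (x :* c :* (x :* c) :* (x :* c)) :+ x :* x :* (b :* b :* b)
           :- con (ℤ.+ 3) :* x :* a :* (x :* c) :* b) ≈-refl (δ 2 a) (δ 2 b) (δ 2 c) (X^ 1) ⟩
  cubic (δ 2 a) (X^ 1 ⊗ δ 2 c) (δ 2 b) ∎))
  where
  a b c : Series
  a = sec 3 0 f
  b = sec 3 1 f
  c = sec 3 2 f
  hom⊖ : ∀ {f g f′ g′} → δ 2 f ≈ f′ → δ 2 g ≈ g′ → δ 2 (f ⊖ g) ≈ f′ ⊖ g′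
  hom⊖ p q = δ2-⊕ p (≈-trans (subs-⊝ 1ℤ 1 _) (⊝-cong q))
  cube : ∀ f → δ 2 (f ⊗ f ⊗ f) ≈ δ 2 f ⊗ δ 2 f ⊗ δ 2 f
  cube f = δ2-⊗ (δ2-⊗ ≈-refl ≈-refl) ≈-refl
  δx : δ 2 (X^ 1) ≈ X^ 1 ⊗ X^ 1
  δx = ≈-trans (δ-mono 1 1ℤ 1) (≈-sym (mono-⊗ 1ℤ 1ℤ 1 1))

-- Infinite products over arithmetic progressions

fac : ℤ → ℕ → Series
fac s k = 𝟙 ⊖ mono s k

fac≡[]𝟙 : ∀ s {k N} → N ≤ k → fac s k ≡[ N ] 𝟙
fac≡[]𝟙 s N≤k = ≡[]-trans (⊕-cong[] (≈⇒≡[] ≈-refl) (⊝-cong[] (mono≡[]𝟘 s N≤k)))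
  (≈⇒≡[] (≈-trans (⊕-cong ≈-refl ⊝𝟘) (⊕-identityʳ 𝟙)))
  where
  ⊝𝟘 : ⊝ 𝟘 ≈ 𝟘
  ⊝𝟘 = pointwise (⊝-coeff 𝟘)

fac-cong : ∀ {s t k l} → s ≡ t → k ≡ l → fac s k ≈ fac t l
fac-cong refl refl = ≈-refl

-- Meaningful only for c ≥ 1: for c = 0 the partial products need not converge.
P : ℤ → ℕ → ℕ → Series
P s c a = limit (∏ λ i → fac s (i * c + a))

P-⟶ : ∀ s c a .{{_ : ℕ.NonZero c}} → (∏ λ i → fac s (i * c + a)) ⟶ P s c a
P-⟶ s c a = ∏-⟶ _ λ i → fac≡[]𝟙 s (ℕ.≤-trans (ℕ.m≤m*n i c) (ℕ.m≤m+n (i * c) a))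

P-0 : ∀ s c a → P s c (suc a) 0 ≡ 1ℤ
P-0 s c a = trans (ℤ.*-identityˡ (fac s (suc a) 0)) (trans (⊕-coeff 𝟙 (⊝ mono s (suc a)) 0)
  (trans (cong (λ z → 1ℤ ℤ.+ z) (⊝-coeff (mono s (suc a)) 0)) refl))

P-split : ∀ k s c a .{{_ : ℕ.NonZero c}} .{{_ : ℕ.NonZero k}} → P s c a ≈ ∏ (λ r → P s (k * c) (r * c + a)) k
P-split k s c a = ⟶-unique
  (⟶-subsequence (_* k) (m≤m*k k) (P-⟶ s c a))
  (⟶-cong regroup (⟶-∏ k λ r → P-⟶ s (k * c) (r * c + a) {{ℕ.m*n≢0 k c}}))
  where
  exponent : ∀ c a k i r → i * (k * c) + (r * c + a) ≡ (i * k + r) * c + a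
  exponent = ℕ.solve-∀
  regroup : ∀ m → ∏ (λ r → ∏ (λ i → fac s (i * (k * c) + (r * c + a))) m) k ≈ ∏ (λ i → fac s (i * c + a)) (m * k)
  regroup m = ≈-sym (≈-trans (∏-block k _ m) (≈-trans
    (∏-cong m λ i → ∏-cong k λ r → fac-cong refl (sym (exponent c a k i r)))
    (∏-swap (λ i r → fac s (i * (k * c) + (r * c + a))) m k)))

-- The hypothesis makes the power of t the same in every factor, so that the image is again a
-- product with one coefficient. It holds for t = 1 and, if c is even, for t = -1.
P-subs : ∀ t k s c a .{{_ : ℕ.NonZero c}} → (∀ i → t ℤ.^ (i * c + a) ≡ t ℤ.^ a) →
         subs t (suc k) (P s c a) ≈ P (s ℤ.* t ℤ.^ a) (c * suc k) (a * suc k)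
P-subs t k s c a periodic = ⟶-unique (⟶-subs t (suc k) (P-⟶ s c a))
  (⟶-cong (λ m → ≈-sym (≈-trans (subs-∏ t k _ m) (∏-cong m factor))) (P-⟶ _ (c * suc k) (a * suc k) {{ℕ.m*n≢0 c (suc k)}}))
  where
  exponent : ∀ i c a k → (i * c + a) * k ≡ i * (c * k) + a * k
  exponent = ℕ.solve-∀
  factor : ∀ i → subs t (suc k) (fac s (i * c + a)) ≈ fac (s ℤ.* t ℤ.^ a) (i * (c * suc k) + a * suc k)
  factor i = ≈-trans (subs-⊕ t k _ _) (⊕-cong (subs-const t k 1ℤ) (≈-trans (subs-⊝ t k _) (⊝-cong
    (≈-trans (subs-mono t k s (i * c + a)) (≡⇒≈ (cong₂ mono (cong (s ℤ.*_) (periodic i)) (exponent i c a (suc k))))))))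

P-δ : ∀ k s c a .{{_ : ℕ.NonZero c}} → δ (suc k) (P s c a) ≈ P s (c * suc k) (a * suc k)
P-δ k s c a = ≈-trans (P-subs 1ℤ k s c a (λ i → trans (ℤ.^-zeroˡ (i * c + a)) (sym (ℤ.^-zeroˡ a))))
  (≡⇒≈ (cong (λ s → P s (c * suc k) (a * suc k)) (trans (cong (s ℤ.*_) (ℤ.^-zeroˡ a)) (ℤ.*-identityʳ s))))

P-σ : ∀ s c a .{{_ : ℕ.NonZero c}} → -1ℤ ℤ.^ c ≡ 1ℤ → σ (P s c a) ≈ P (s ℤ.* -1ℤ ℤ.^ a) c a
P-σ s c a even = ≈-trans (P-subs -1ℤ 0 s c a periodic)
  (≡⇒≈ (cong₂ (P (s ℤ.* -1ℤ ℤ.^ a)) (ℕ.*-identityʳ c) (ℕ.*-identityʳ a)))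
  where
  periodic : ∀ i → -1ℤ ℤ.^ (i * c + a) ≡ -1ℤ ℤ.^ a
  periodic i = trans (ℤ.^-distribˡ-+-* -1ℤ (i * c) a) (trans
    (cong (ℤ._* -1ℤ ℤ.^ a) (trans (cong (-1ℤ ℤ.^_) (ℕ.*-comm i c)) (trans (sym (ℤ.^-*-assoc -1ℤ c i))
      (trans (cong (ℤ._^ i) even) (ℤ.^-zeroˡ i)))))
    (ℤ.*-identityˡ (-1ℤ ℤ.^ a)))

P-± : ∀ c a .{{_ : ℕ.NonZero c}} → P 1ℤ c a ⊗ P -1ℤ c a ≈ P 1ℤ (c * 2) (a * 2)
P-± c a = ⟶-unique (⟶-⊗ (P-⟶ 1ℤ c a) (P-⟶ -1ℤ c a))
  (⟶-cong (λ m → ≈-trans (∏-cong m factor) (∏-⊗ _ _ m)) (P-⟶ 1ℤ (c * 2) (a * 2) {{ℕ.m*n≢0 c 2}}))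
  where
  exponent : ∀ i c a → i * (c * 2) + a * 2 ≡ (i * c + a) + (i * c + a)
  exponent = ℕ.solve-∀
  mono-⊝ : ∀ k → mono -1ℤ k ≈ ⊝ mono 1ℤ k
  mono-⊝ k = ≈-trans (≈-sym (mono-⊗ -1ℤ 1ℤ 0 k)) (solve 1 (λ x → con -1ℤ :* x := :- x) ≈-refl (mono 1ℤ k))
  factor : ∀ i → fac 1ℤ (i * (c * 2) + a * 2) ≈ fac 1ℤ (i * c + a) ⊗ fac -1ℤ (i * c + a)
  factor i = ≈-trans (⊕-cong ≈-refl (⊝-cong (≈-trans (≡⇒≈ (cong X^ (exponent i c a)))
      (≈-sym (mono-⊗ 1ℤ 1ℤ (i * c + a) (i * c + a))))))
    (≈-trans (solve 1 (λ x → con 1ℤ :- x :* x := (con 1ℤ :- x) :* (con 1ℤ :- (:- x))) ≈-refl (X^ (i * c + a)))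
      (⊗-cong ≈-refl (⊕-cong ≈-refl (⊝-cong (≈-sym (mono-⊝ (i * c + a)))))))

-- The Jacobi triple product

-- G a b is the Gaussian binomial coefficient [a+b choose a] in Q = q^c.
module GaussianBinomial (c : ℕ) .{{_ : ℕ.NonZero c}} where

  Q^ : ℕ → Series
  Q^ k = X^ (k * c)

  Q^-+ : ∀ k l → Q^ k ⊗ Q^ l ≈ Q^ (k + l)
  Q^-+ k l = ≈-trans (mono-⊗ 1ℤ 1ℤ (k * c) (l * c)) (≡⇒≈ (cong X^ (sym (ℕ.*-distribʳ-+ c k l))))

  G : ℕ → ℕ → Series
  G zero    b       = 𝟙
  G (suc a) zero    = 𝟙
  G (suc a) (suc b) = G (suc a) b ⊕ Q^ (suc b) ⊗ G a (suc b)

  poch : ℕ → Series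
  poch = ∏ λ i → fac 1ℤ (i * c + c)

  poch-0 : ∀ n → poch n 0 ≡ 1ℤ
  poch-0 zero    = refl
  poch-0 (suc n) = cong₂ ℤ._*_ (poch-0 n) (agree (fac≡[]𝟙 1ℤ (ℕ.≤-trans (ℕ.>-nonZero⁻¹ c) (ℕ.m≤n+m c (n * c)))) 0 z<s)

  poch-suc : ∀ n → poch (suc n) ≈ poch n ⊗ (𝟙 ⊖ Q^ (suc n))
  poch-suc n = ⊗-cong ≈-refl (fac-cong refl (ℕ.+-comm (n * c) c))

  G-a-0 : ∀ a → G a 0 ≈ 𝟙
  G-a-0 zero    = ≈-refl
  G-a-0 (suc a) = ≈-refl

  -- The quotient (Q)_(a+b) / ((Q)_a (Q)_b) with its denominator multiplied out. It satisfies the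
  -- recursion of `G` because 1 - Q^(a+b) = (1 - Q^b) + Q^b (1 - Q^a). Symmetry and the limit of `G`
  -- follow by cancellation.
  G-poch : ∀ a b → G a b ⊗ (poch a ⊗ poch b) ≈ poch (a + b)
  G-poch zero    b       = ≈-trans (⊗-identityˡ _) (⊗-identityˡ _)
  G-poch (suc a) zero    = ≈-trans (⊗-identityˡ _) (≈-trans (⊗-identityʳ _)
    (≡⇒≈ (cong poch (sym (ℕ.+-identityʳ (suc a))))))
  G-poch (suc a) (suc b) = begin
    (G (suc a) b ⊕ Q^ (suc b) ⊗ G a (suc b)) ⊗ (poch (suc a) ⊗ poch (suc b))
      ≈⟨ ⊗-distribʳ _ _ _ ⟩
    G (suc a) b ⊗ (poch (suc a) ⊗ poch (suc b)) ⊕ Q^ (suc b) ⊗ G a (suc b) ⊗ (poch (suc a) ⊗ poch (suc b))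
      ≈⟨ ⊕-cong (⊗-cong ≈-refl (⊗-cong ≈-refl (poch-suc b))) (⊗-cong ≈-refl (⊗-cong (poch-suc a) ≈-refl)) ⟩
    G (suc a) b ⊗ (poch (suc a) ⊗ (poch b ⊗ (𝟙 ⊖ Q^ (suc b))))
      ⊕ Q^ (suc b) ⊗ G a (suc b) ⊗ (poch a ⊗ (𝟙 ⊖ Q^ (suc a)) ⊗ poch (suc b))
      ≈⟨ solve 8 (λ g p r x g′ p′ r′ y →
           g :* (p :* (r :* (con 1ℤ :- x))) :+ x :* g′ :* (p′ :* (con 1ℤ :- y) :* r′)
           := g :* (p :* r) :* (con 1ℤ :- x) :+ g′ :* (p′ :* r′) :* (x :- x :* y)) ≈-refl
           (G (suc a) b) (poch (suc a)) (poch b) (Q^ (suc b)) (G a (suc b)) (poch a) (poch (suc b)) (Q^ (suc a)) ⟩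
    G (suc a) b ⊗ (poch (suc a) ⊗ poch b) ⊗ (𝟙 ⊖ Q^ (suc b))
      ⊕ G a (suc b) ⊗ (poch a ⊗ poch (suc b)) ⊗ (Q^ (suc b) ⊖ Q^ (suc b) ⊗ Q^ (suc a))
      ≈⟨ ⊕-cong (⊗-cong (G-poch (suc a) b) ≈-refl)
           (⊗-cong (≈-trans (G-poch a (suc b)) (≡⇒≈ (cong poch (ℕ.+-suc a b)))) ≈-refl) ⟩
    poch (suc a + b) ⊗ (𝟙 ⊖ Q^ (suc b)) ⊕ poch (suc a + b) ⊗ (Q^ (suc b) ⊖ Q^ (suc b) ⊗ Q^ (suc a))
      ≈⟨ solve 3 (λ p x y → p :* (con 1ℤ :- x) :+ p :* (x :- x :* y) := p :* (con 1ℤ :- x :* y)) ≈-refl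
           (poch (suc a + b)) (Q^ (suc b)) (Q^ (suc a)) ⟩
    poch (suc a + b) ⊗ (𝟙 ⊖ Q^ (suc b) ⊗ Q^ (suc a))
      ≈⟨ ⊗-cong ≈-refl (⊕-cong ≈-refl (⊝-cong (≈-trans (Q^-+ (suc b) (suc a))
           (≡⇒≈ (cong Q^ (cong suc (trans (ℕ.+-comm b (suc a)) refl))))))) ⟩
    poch (suc a + b) ⊗ (𝟙 ⊖ Q^ (suc (suc a + b)))
      ≈⟨ ≈-sym (poch-suc (suc a + b)) ⟩
    poch (suc (suc a + b))
      ≈⟨ ≡⇒≈ (cong poch (sym (ℕ.+-suc (suc a) b))) ⟩
    poch (suc a + suc b) ∎

  poch⊗poch-0 : ∀ a b → (poch a ⊗ poch b) 0 ≡ 1ℤ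
  poch⊗poch-0 a b = cong₂ ℤ._*_ (poch-0 a) (poch-0 b)

  G-sym : ∀ a b → G a b ≈ G b a
  G-sym a b = ⊗-cancelˡ (poch a ⊗ poch b) (poch⊗poch-0 a b)
    (≈-trans (⊗-comm _ _) (≈-trans (G-poch a b) (≈-trans (≡⇒≈ (cong poch (ℕ.+-comm a b)))
      (≈-trans (≈-sym (G-poch b a)) (≈-trans (⊗-comm _ _) (⊗-cong (⊗-comm (poch b) (poch a)) ≈-refl))))))

  G-pascal′ : ∀ a b → G (suc a) (suc b) ≈ Q^ (suc a) ⊗ G (suc a) b ⊕ G a (suc b)
  G-pascal′ a b = ≈-trans (G-sym (suc a) (suc b)) (≈-trans (⊕-comm _ _)
    (⊕-cong (⊗-cong ≈-refl (G-sym b (suc a))) (G-sym (suc b) a)))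

  -- As a and b grow, the binomial coefficient tends to 1 / (Q; Q)_∞: all three finite products in
  -- its quotient form agree with (Q; Q)_∞ below m.
  G-limit : ∀ {m a b} → m ≤ a → m ≤ b → P 1ℤ c c ⊗ G a b ≡[ m ] 𝟙
  G-limit {m} {a} {b} m≤a m≤b = ⊗-cancelˡ[] (poch a ⊗ poch b) (poch⊗poch-0 a b) (≡[]-trans
    (≈⇒≡[] (solve 4 (λ p r q g → p :* r :* (q :* g) := q :* (g :* (p :* r))) ≈-refl
      (poch a) (poch b) (P 1ℤ c c) (G a b)))
    (≡[]-trans (⊗-cong[] (≡[]-sym (near a m≤a))
        (≡[]-trans (≈⇒≡[] (G-poch a b)) (≡[]-trans (near (a + b) (ℕ.≤-trans m≤a (ℕ.m≤m+n a b)))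
          (≡[]-sym (near b m≤b)))))
      (≈⇒≡[] (≈-sym (⊗-identityʳ _)))))
    where
    near : ∀ k → m ≤ k → poch k ≡[ m ] P 1ℤ c c
    near k m≤k = ≡[]-weaken m≤k (P-⟶ 1ℤ c c k)

  binomialSum : (ℕ → Series) → ℕ → Series
  binomialSum τ N = ∑ (λ i → G i (N ∸ i) ⊗ τ i) (suc N)

  N∸i≡suc : ∀ {N i} → i < N → N ∸ i ≡ suc (N ∸ suc i)
  N∸i≡suc {suc N} {i} (s≤s i≤N) = ℕ.+-∸-assoc 1 i≤N

  -- The two forms of Pascal's rule give two ways to raise N. Here the extra sum carries
  -- `τ (suc i)`, which serves to append a term at the upper end of the theta series; the primed
  -- version serves to prepend one at the lower end.
  binomialSum-suc : ∀ τ N → binomialSum τ (suc N) ≈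
    binomialSum τ N ⊕ ∑ (λ i → G i (N ∸ i) ⊗ (Q^ (N ∸ i) ⊗ τ (suc i))) (suc N)
  binomialSum-suc τ N = begin
    binomialSum τ (suc N)
      ≈⟨ ∑-head (λ i → G i (suc N ∸ i) ⊗ τ i) (suc N) ⟩
    𝟙 ⊗ τ 0 ⊕ (∑ (λ i → G (suc i) (N ∸ i) ⊗ τ (suc i)) N ⊕ G (suc N) (N ∸ N) ⊗ τ (suc N))
      ≈⟨ ⊕-cong ≈-refl (⊕-cong (≈-trans (∑-cong N λ i → step) (∑-⊕ _ _ N)) last) ⟩
    𝟙 ⊗ τ 0 ⊕ (∑ (λ i → G (suc i) (N ∸ suc i) ⊗ τ (suc i)) N
      ⊕ ∑ (λ i → G i (N ∸ i) ⊗ (Q^ (N ∸ i) ⊗ τ (suc i))) N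
      ⊕ G N (N ∸ N) ⊗ (Q^ (N ∸ N) ⊗ τ (suc N)))
      ≈⟨ solve 4 (λ a b c d → a :+ (b :+ c :+ d) := a :+ b :+ (c :+ d)) ≈-refl _ _ _ _ ⟩
    𝟙 ⊗ τ 0 ⊕ ∑ (λ i → G (suc i) (N ∸ suc i) ⊗ τ (suc i)) N
      ⊕ ∑ (λ i → G i (N ∸ i) ⊗ (Q^ (N ∸ i) ⊗ τ (suc i))) (suc N)
      ≈⟨ ⊕-cong (≈-sym (∑-head (λ i → G i (N ∸ i) ⊗ τ i) N)) ≈-refl ⟩
    _ ∎
    where
    step : ∀ {i} → i < N → G (suc i) (N ∸ i) ⊗ τ (suc i) ≈
           G (suc i) (N ∸ suc i) ⊗ τ (suc i) ⊕ G i (N ∸ i) ⊗ (Q^ (N ∸ i) ⊗ τ (suc i))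
    step {i} i<N rewrite N∸i≡suc i<N =
      solve 4 (λ a x b t → (a :+ x :* b) :* t := a :* t :+ b :* (x :* t)) ≈-refl _ _ _ (τ (suc i))
    last : G (suc N) (N ∸ N) ⊗ τ (suc N) ≈ G N (N ∸ N) ⊗ (Q^ (N ∸ N) ⊗ τ (suc N))
    last rewrite ℕ.n∸n≡0 N = ⊗-cong (≈-sym (G-a-0 N)) (≈-sym (⊗-identityˡ (τ (suc N))))

  binomialSum-suc′ : ∀ τ N → binomialSum τ (suc N) ≈
    ∑ (λ i → G i (N ∸ i) ⊗ (Q^ i ⊗ τ i)) (suc N) ⊕ binomialSum (λ i → τ (suc i)) N
  binomialSum-suc′ τ N = begin
    binomialSum τ (suc N)
      ≈⟨ ∑-head (λ i → G i (suc N ∸ i) ⊗ τ i) (suc N) ⟩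
    𝟙 ⊗ τ 0 ⊕ (∑ (λ i → G (suc i) (N ∸ i) ⊗ τ (suc i)) N ⊕ G (suc N) (N ∸ N) ⊗ τ (suc N))
      ≈⟨ ⊕-cong (⊗-cong ≈-refl (≈-sym (⊗-identityˡ (τ 0))))
           (⊕-cong (≈-trans (∑-cong N λ i → step) (∑-⊕ _ _ N)) last) ⟩
    𝟙 ⊗ (Q^ 0 ⊗ τ 0) ⊕ (∑ (λ i → G (suc i) (N ∸ suc i) ⊗ (Q^ (suc i) ⊗ τ (suc i))) N
      ⊕ ∑ (λ i → G i (N ∸ i) ⊗ τ (suc i)) N ⊕ G N (N ∸ N) ⊗ τ (suc N))
      ≈⟨ solve 4 (λ a b c d → a :+ (b :+ c :+ d) := a :+ b :+ (c :+ d)) ≈-refl _ _ _ _ ⟩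
    𝟙 ⊗ (Q^ 0 ⊗ τ 0) ⊕ ∑ (λ i → G (suc i) (N ∸ suc i) ⊗ (Q^ (suc i) ⊗ τ (suc i))) N
      ⊕ binomialSum (λ i → τ (suc i)) N
      ≈⟨ ⊕-cong (≈-sym (∑-head (λ i → G i (N ∸ i) ⊗ (Q^ i ⊗ τ i)) N)) ≈-refl ⟩
    _ ∎
    where
    step : ∀ {i} → i < N → G (suc i) (N ∸ i) ⊗ τ (suc i) ≈
           G (suc i) (N ∸ suc i) ⊗ (Q^ (suc i) ⊗ τ (suc i)) ⊕ G i (N ∸ i) ⊗ τ (suc i)
    step {i} i<N rewrite N∸i≡suc i<N = ≈-trans (⊗-cong (G-pascal′ i (N ∸ suc i)) ≈-refl)
      (solve 4 (λ a x b t → (x :* a :+ b) :* t := a :* (x :* t) :+ b :* t) ≈-refl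
        (G (suc i) (N ∸ suc i)) (Q^ (suc i)) (G i (suc (N ∸ suc i))) (τ (suc i)))
    last : G (suc N) (N ∸ N) ⊗ τ (suc N) ≈ G N (N ∸ N) ⊗ τ (suc N)
    last rewrite ℕ.n∸n≡0 N = ⊗-cong (≈-sym (G-a-0 N)) ≈-refl

-- The theta series is the sum of s^i q^(a i + c i (i - 1) / 2) over all integers i, with c = a + b.
-- As s² = 1, the powers s^(-i) and s^i are equal, so the terms of negative index are those of
-- positive index with a and b exchanged.
module TripleProduct (s : ℤ) (s²≡1 : s ℤ.* s ≡ 1ℤ) (a b : ℕ) .{{_ : ℕ.NonZero a}} .{{_ : ℕ.NonZero b}} where

  c : ℕ
  c = a + b

  instance
    c≢0 : ℕ.NonZero c
    c≢0 = ℕ.>-nonZero (ℕ.≤-trans (ℕ.>-nonZero⁻¹ a) (ℕ.m≤m+n a b))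

  open GaussianBinomial c

  -- e a i = a i + c i (i - 1) / 2, so that the two-sided theta series is the
  -- sum of s^i q^(e a i) over i ≥ 0 and of s^i q^(e b i) over i ≥ 1.
  e : ℕ → ℕ → ℕ
  e a zero    = 0
  e a (suc i) = a + (i * c + e a i)

  T : ℕ → ℕ → Series
  T a i = mono (s ℤ.^ i) (e a i)

  T-suc : ∀ a i → T a (suc i) ≈ mono s a ⊗ Q^ i ⊗ T a i
  T-suc a i = ≈-sym (≈-trans (⊗-cong (mono-⊗ s 1ℤ a (i * c)) ≈-refl)
    (≈-trans (mono-⊗ _ (s ℤ.^ i) (a + i * c) (e a i))
      (≡⇒≈ (cong₂ mono (cong (ℤ._* s ℤ.^ i) (ℤ.*-identityʳ s)) (ℕ.+-assoc a (i * c) (e a i))))))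

  -- The theta terms in a single sequence starting at index -n.
  sgn ex : ℕ → ℕ → ℕ
  sgn zero    i       = i
  sgn (suc n) zero    = suc n
  sgn (suc n) (suc i) = sgn n i
  ex zero    i       = e a i
  ex (suc n) zero    = e b (suc n)
  ex (suc n) (suc i) = ex n i

  τ : ℕ → ℕ → Series
  τ n i = mono (s ℤ.^ sgn n i) (ex n i)

  τ-0 : ∀ n → τ n 0 ≈ T b n
  τ-0 zero    = ≈-refl
  τ-0 (suc n) = ≈-refl

  u v : Series
  u = mono s a
  v = mono s b

  uv≈Q : u ⊗ v ≈ Q^ 1
  uv≈Q = ≈-trans (mono-⊗ s s a b) (≡⇒≈ (cong₂ mono s²≡1 (sym (ℕ.+-identityʳ c))))

  -- The ratio of neighbouring theta terms, with negative powers of Q cleared: lowering the index i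
  -- - n by one multiplies the term by v Q^(n-i).
  τ-down : ∀ n i → i ≤ n → Q^ i ⊗ τ (suc n) i ≈ v ⊗ Q^ n ⊗ τ n i
  τ-down n       zero    _         = ≈-trans (⊗-identityˡ _) (≈-trans (T-suc b n) (⊗-cong ≈-refl (≈-sym (τ-0 n))))
  τ-down (suc n) (suc i) (s≤s i≤n) = begin
    Q^ (suc i) ⊗ τ (suc n) i     ≈⟨ ⊗-cong (≈-sym (Q^-+ 1 i)) ≈-refl ⟩
    Q^ 1 ⊗ Q^ i ⊗ τ (suc n) i    ≈⟨ ⊗-assoc _ _ _ ⟩
    Q^ 1 ⊗ (Q^ i ⊗ τ (suc n) i)  ≈⟨ ⊗-cong ≈-refl (τ-down n i i≤n) ⟩
    Q^ 1 ⊗ (v ⊗ Q^ n ⊗ τ n i)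
      ≈⟨ solve 4 (λ q v x t → q :* (v :* x :* t) := v :* (q :* x) :* t) ≈-refl (Q^ 1) v (Q^ n) (τ n i) ⟩
    v ⊗ (Q^ 1 ⊗ Q^ n) ⊗ τ n i    ≈⟨ ⊗-cong (⊗-cong ≈-refl (Q^-+ 1 n)) ≈-refl ⟩
    v ⊗ Q^ (suc n) ⊗ τ n i ∎

  -- Raising the index i - n by one multiplies the term by u Q^(i-n); the power Q^(n+m-i) is the one
  -- that Pascal's rule supplies.
  τ-up : ∀ n m i → i ≤ n + m → u ⊗ Q^ m ⊗ τ n i ≈ Q^ (n + m ∸ i) ⊗ τ n (suc i)
  τ-up zero m i i≤m = begin
    u ⊗ Q^ m ⊗ T a i
      ≈⟨ ⊗-cong (⊗-cong ≈-refl (≈-trans (≡⇒≈ (cong Q^ (sym (ℕ.m∸n+n≡m i≤m)))) (≈-sym (Q^-+ (m ∸ i) i)))) ≈-refl ⟩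
    u ⊗ (Q^ (m ∸ i) ⊗ Q^ i) ⊗ T a i
      ≈⟨ solve 4 (λ u x y t → u :* (x :* y) :* t := x :* (u :* y :* t)) ≈-refl u (Q^ (m ∸ i)) (Q^ i) (T a i) ⟩
    Q^ (m ∸ i) ⊗ (u ⊗ Q^ i ⊗ T a i)
      ≈⟨ ⊗-cong ≈-refl (≈-sym (T-suc a i)) ⟩
    Q^ (m ∸ i) ⊗ T a (suc i) ∎
  τ-up (suc n) m zero _ = begin
    u ⊗ Q^ m ⊗ T b (suc n)
      ≈⟨ ⊗-cong ≈-refl (T-suc b n) ⟩
    u ⊗ Q^ m ⊗ (v ⊗ Q^ n ⊗ T b n)
      ≈⟨ solve 5 (λ u x v y t → u :* x :* (v :* y :* t) := u :* v :* (y :* x) :* t) ≈-refl u (Q^ m) v (Q^ n) (T b n) ⟩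
    u ⊗ v ⊗ (Q^ n ⊗ Q^ m) ⊗ T b n
      ≈⟨ ⊗-cong (≈-trans (⊗-cong uv≈Q (Q^-+ n m)) (Q^-+ 1 (n + m))) (≈-sym (τ-0 n)) ⟩
    Q^ (suc (n + m)) ⊗ τ n 0 ∎
  τ-up (suc n) m (suc i) (s≤s i≤n+m) = τ-up n m i i≤n+m

  scale-sum : ∀ y (τ τ′ : ℕ → Series) N → (∀ i → i ≤ N → y ⊗ τ i ≈ τ′ i) →
              ∑ (λ i → G i (N ∸ i) ⊗ τ′ i) (suc N) ≈ y ⊗ binomialSum τ N
  scale-sum y τ τ′ N p = ≈-trans
    (∑-cong (suc N) λ { i (s≤s i≤N) → ≈-trans (⊗-cong ≈-refl (≈-sym (p i i≤N)))
      (solve 3 (λ g y t → g :* (y :* t) := y :* (g :* t)) ≈-refl (G i (N ∸ i)) y (τ i)) })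
    (∑-⊗ y _ (suc N))

  fac≈ : ∀ d i → fac (ℤ.- s) (i * c + d) ≈ 𝟙 ⊕ mono s d ⊗ Q^ i
  fac≈ d i = ⊕-cong ≈-refl (begin
    ⊝ mono (ℤ.- s) (i * c + d)
      ≈⟨ ⊝-cong (≡⇒≈ (cong₂ mono (sym (ℤ.-1*i≡-i s)) (ℕ.+-comm (i * c) d))) ⟩
    ⊝ mono (-1ℤ ℤ.* s) (d + i * c)
      ≈⟨ ⊝-cong (≈-sym (mono-⊗ -1ℤ s 0 (d + i * c))) ⟩
    ⊝ (const -1ℤ ⊗ mono s (d + i * c))
      ≈⟨ solve 1 (λ x → :- (con -1ℤ :* x) := x) ≈-refl (mono s (d + i * c)) ⟩
    mono s (d + i * c)
      ≈⟨ ≡⇒≈ (cong (λ s → mono s (d + i * c)) (sym (ℤ.*-identityʳ s))) ⟩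
    mono (s ℤ.* 1ℤ) (d + i * c)
      ≈⟨ ≈-sym (mono-⊗ s 1ℤ d (i * c)) ⟩
    mono s d ⊗ Q^ i ∎)

  partialP : ℕ → ℕ → Series
  partialP d = ∏ λ i → fac (ℤ.- s) (i * c + d)

  oneSided : ∀ n → partialP b n ≈ binomialSum (τ n) n
  oneSided zero    = ≈-sym (≈-trans (⊕-identityˡ _) (⊗-identityˡ _))
  oneSided (suc n) = begin
    partialP b n ⊗ fac (ℤ.- s) (n * c + b)
      ≈⟨ ⊗-cong (oneSided n) (fac≈ b n) ⟩
    binomialSum (τ n) n ⊗ (𝟙 ⊕ v ⊗ Q^ n)
      ≈⟨ solve 2 (λ x y → x :* (con 1ℤ :+ y) := y :* x :+ x) ≈-refl _ (v ⊗ Q^ n) ⟩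
    v ⊗ Q^ n ⊗ binomialSum (τ n) n ⊕ binomialSum (τ n) n
      ≈⟨ ⊕-cong (≈-sym (scale-sum (v ⊗ Q^ n) (τ n) (λ i → Q^ i ⊗ τ (suc n) i) n λ i i≤n → ≈-sym (τ-down n i i≤n))) ≈-refl ⟩
    ∑ (λ i → G i (n ∸ i) ⊗ (Q^ i ⊗ τ (suc n) i)) (suc n) ⊕ binomialSum (λ i → τ (suc n) (suc i)) n
      ≈⟨ ≈-sym (binomialSum-suc′ (τ (suc n)) n) ⟩
    binomialSum (τ (suc n)) (suc n) ∎

  -- The finite triple product, a bilateral form of the q-binomial theorem. The induction on m
  -- starts from `oneSided`, itself an induction on n.
  twoSided : ∀ n m → partialP b n ⊗ partialP a m ≈ binomialSum (τ n) (n + m)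
  twoSided n zero    = ≈-trans (⊗-identityʳ _) (≈-trans (oneSided n)
    (≡⇒≈ (cong (binomialSum (τ n)) (sym (ℕ.+-identityʳ n)))))
  twoSided n (suc m) = begin
    partialP b n ⊗ (partialP a m ⊗ fac (ℤ.- s) (m * c + a))
      ≈⟨ ≈-sym (⊗-assoc _ _ _) ⟩
    partialP b n ⊗ partialP a m ⊗ fac (ℤ.- s) (m * c + a)
      ≈⟨ ⊗-cong (twoSided n m) (fac≈ a m) ⟩
    binomialSum (τ n) (n + m) ⊗ (𝟙 ⊕ u ⊗ Q^ m)
      ≈⟨ solve 2 (λ x y → x :* (con 1ℤ :+ y) := x :+ y :* x) ≈-refl _ (u ⊗ Q^ m) ⟩
    binomialSum (τ n) (n + m) ⊕ u ⊗ Q^ m ⊗ binomialSum (τ n) (n + m)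
      ≈⟨ ⊕-cong ≈-refl (≈-sym (scale-sum (u ⊗ Q^ m) (τ n) (λ i → Q^ (n + m ∸ i) ⊗ τ n (suc i)) (n + m) (τ-up n m))) ⟩
    _ ≈⟨ ≈-sym (binomialSum-suc (τ n) (n + m)) ⟩
    binomialSum (τ n) (suc (n + m))
      ≈⟨ ≡⇒≈ (cong (binomialSum (τ n)) (sym (ℕ.+-suc n m))) ⟩
    binomialSum (τ n) (n + suc m) ∎

  i≤e : ∀ d .{{_ : ℕ.NonZero d}} i → i ≤ e d i
  i≤e d zero    = z≤n
  i≤e d (suc i) = ℕ.+-mono-≤ (ℕ.>-nonZero⁻¹ d) (ℕ.≤-trans (i≤e d i) (ℕ.m≤n+m (e d i) (i * c)))

  -- With the next bound: the theta term of index i - n has order at least |i - n|.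
  n≤ex+i : ∀ n i → n ≤ ex n i + i
  n≤ex+i zero    i       = z≤n
  n≤ex+i (suc n) zero    = ℕ.≤-trans (i≤e b (suc n)) (ℕ.m≤m+n _ 0)
  n≤ex+i (suc n) (suc i) = subst (suc n ≤_) (sym (ℕ.+-suc (ex n i) i)) (s≤s (n≤ex+i n i))

  i≤ex+n : ∀ n i → i ≤ ex n i + n
  i≤ex+n zero    i       = ℕ.≤-trans (i≤e a i) (ℕ.m≤m+n _ 0)
  i≤ex+n (suc n) zero    = z≤n
  i≤ex+n (suc n) (suc i) = subst (suc i ≤_) (sym (ℕ.+-suc (ex n i) n)) (s≤s (i≤ex+n n i))

  -- The binomial coefficient has reached its limit below min(i, 2n - i) = n - |i - n|, and the
  -- theta term adds order at least |i - n|; together this is precision n.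
  term-limit : ∀ n i → i ≤ n + n → P 1ℤ c c ⊗ (G i (n + n ∸ i) ⊗ τ n i) ≡[ n ] τ n i
  term-limit n i i≤2n = ≡[]-trans
    (≈⇒≡[] (solve 3 (λ p g t → p :* (g :* t) := t :* (p :* g)) ≈-refl (P 1ℤ c c) (G i (n + n ∸ i)) (τ n i)))
    (≡[]-trans (near (ℕ.≤-total i n)) (≈⇒≡[] (⊗-identityʳ _)))
    where
    near : _ → τ n i ⊗ (P 1ℤ c c ⊗ G i (n + n ∸ i)) ≡[ n ] τ n i ⊗ 𝟙
    near (inj₁ i≤n) = ≡[]-weaken (n≤ex+i n i) (mono-⊗-cong[] _ (ex n i)
      (G-limit ℕ.≤-refl (ℕ.≤-trans i≤n (subst (n ≤_) (sym (ℕ.+-∸-assoc n i≤n)) (ℕ.m≤m+n n (n ∸ i))))))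
    near (inj₂ n≤i) = ≡[]-weaken n≤ (mono-⊗-cong[] _ (ex n i) (G-limit
      (ℕ.m≤n+o⇒m∸n≤o (n + n) i {i} (ℕ.+-mono-≤ n≤i n≤i)) ℕ.≤-refl))
      where
      n≤ : n ≤ ex n i + (n + n ∸ i)
      n≤ = ℕ.+-cancelʳ-≤ i n _ (subst (n + i ≤_)
        (sym (trans (ℕ.+-assoc (ex n i) (n + n ∸ i) i) (cong (ex n i +_) (ℕ.m∸n+n≡m i≤2n))))
        (subst (n + i ≤_) (trans (ℕ.+-comm n (ex n i + n)) (ℕ.+-assoc (ex n i) n n)) (ℕ.+-monoʳ-≤ n (i≤ex+n n i))))

  thetaTerm : ℕ → Series
  thetaTerm i = T a i ⊕ T b (suc i)

  theta : Series
  theta = limit (∑ thetaTerm)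

  theta-⟶ : ∑ thetaTerm ⟶ theta
  theta-⟶ = ∑-⟶ thetaTerm λ i → ≡[]-trans
    (⊕-cong[] (mono≡[]𝟘 _ (i≤e a i)) (mono≡[]𝟘 _ (ℕ.≤-trans (ℕ.n≤1+n i) (i≤e b (suc i)))))
    (≈⇒≡[] (⊕-identityʳ 𝟘))

  τ-negative : ∀ n i → i < n → τ n i ≈ T b (suc (n ∸ suc i))
  τ-negative (suc n) zero    _         = ≈-refl
  τ-negative (suc n) (suc i) (s<s i<n) = τ-negative n i i<n

  τ-positive : ∀ n i → τ n (n + i) ≈ T a i
  τ-positive zero    i = ≈-refl
  τ-positive (suc n) i = τ-positive n i

  ∑τ : ∀ n → ∑ (τ n) (suc (n + n)) ≡[ n ] ∑ thetaTerm n
  ∑τ n = ≡[]-trans (≈⇒≡[] (begin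
      ∑ (τ n) (suc (n + n))
        ≈⟨ ⊕-cong (∑-+ (τ n) n n) (τ-positive n n) ⟩
      ∑ (τ n) n ⊕ ∑ (λ i → τ n (n + i)) n ⊕ T a n
        ≈⟨ ⊕-cong (⊕-cong (≈-trans (∑-cong n (τ-negative n)) (≈-sym (∑-reverse (λ i → T b (suc i)) n)))
             (∑-cong n λ i _ → τ-positive n i)) ≈-refl ⟩
      ∑ (λ i → T b (suc i)) n ⊕ ∑ (T a) n ⊕ T a n
        ≈⟨ ⊕-cong (≈-trans (⊕-comm _ _) (≈-sym (∑-⊕ (T a) (λ i → T b (suc i)) n))) ≈-refl ⟩
      ∑ thetaTerm n ⊕ T a n ∎))
    -- The left sum covers the indices -n, ..., n, whereas `∑ thetaTerm n` ends at n - 1; the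
    -- surplus term of index n has order at least n.
    (≡[]-trans (⊕-cong[] (≈⇒≡[] ≈-refl) (mono≡[]𝟘 _ (i≤e a n))) (≈⇒≡[] (⊕-identityʳ _)))

  tripleProduct : P 1ℤ c c ⊗ (P (ℤ.- s) c b ⊗ P (ℤ.- s) c a) ≈ theta
  tripleProduct = ⟶-unique
    (⟶-⊗ (⟶-const {P 1ℤ c c}) (⟶-⊗ (P-⟶ (ℤ.- s) c b) (P-⟶ (ℤ.- s) c a)))
    λ n → ≡[]-trans (≈⇒≡[] (⊗-cong ≈-refl (twoSided n n)))
      (≡[]-trans (≈⇒≡[] (≈-sym (∑-⊗ (P 1ℤ c c) _ (suc (n + n)))))
        (≡[]-trans (∑-cong[] (suc (n + n)) λ { i (s≤s i≤2n) → term-limit n i i≤2n })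
          (≡[]-trans (∑τ n) (theta-⟶ n))))

-- Theta functions

module ThetaA = TripleProduct 1ℤ refl 2 1
module Thetaψ = TripleProduct 1ℤ refl 3 1
module Thetaφ = TripleProduct -1ℤ refl 1 1
module ThetaΩ = TripleProduct -1ℤ refl 5 1

-- In Ramanujan's notation these are f(q,q²), ψ(q), φ(-q) and f(-q,-q⁵).
A ψ φ Ω : Series
A = ThetaA.theta
ψ = Thetaψ.theta
φ = Thetaφ.theta
Ω = ThetaΩ.theta

mono-cong : ∀ {s t k l} → s ≡ t → k ≡ l → mono s k ≈ mono t l
mono-cong refl refl = ≈-refl

mono-neg : ∀ s k → mono (-1ℤ ℤ.* s) k ≈ ⊝ mono s k
mono-neg s k = ≈-trans (≈-sym (mono-⊗ -1ℤ s 0 k)) (solve 1 (λ x → con -1ℤ :* x := :- x) ≈-refl (mono s k))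

mono-suc : ∀ s k → mono s (suc k) ≈ X^ 1 ⊗ mono s k
mono-suc s k = ≈-sym (X⊗ (mono s k))

mono-δ3 : ∀ s k → mono s (k * 3) ≈ δ 3 (mono s k)
mono-δ3 s k = ≈-sym (δ-mono 2 s k)

mono-δ2 : ∀ s k → mono s (k * 2) ≈ δ 2 (mono s k)
mono-δ2 s k = ≈-sym (δ-mono 1 s k)

tri : ℕ → ℕ
tri zero    = 0
tri (suc j) = suc j + tri j

j≤tri : ∀ j → j ≤ tri j
j≤tri zero    = z≤n
j≤tri (suc j) = ℕ.m≤m+n (suc j) (tri j)

-- The exponents of ψ are the triangular numbers: `tri` at 2i gives 2i² + i, the exponent of index i
-- ≥ 0, and `tri` at 2i + 1 gives the exponents of negative index.
ψ-⟶ : ∑ (λ j → X^ (tri j)) ⟶ ψ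
ψ-⟶ m = ≡[]-trans (converges m) (≈⇒≡[] ψ≈)
  where
  converges : ∑ (λ j → X^ (tri j)) ⟶ limit (∑ λ j → X^ (tri j))
  converges = ∑-⟶ (λ j → X^ (tri j)) λ j → mono≡[]𝟘 1ℤ (j≤tri j)
  exponent₀ : ∀ i → tri (i * 2 + 0) ≡ Thetaψ.e 3 i
  exponent₀ zero    = refl
  exponent₀ (suc i) = trans (step i (tri (i * 2 + 0))) (cong (λ t → 3 + (i * 4 + t)) (exponent₀ i))
    where
    step : ∀ i t → suc (suc (i * 2 + 0)) + (suc (i * 2 + 0) + t) ≡ 3 + (i * 4 + t)
    step = ℕ.solve-∀
  exponent₁ : ∀ i → tri (i * 2 + 1) ≡ Thetaψ.e 1 (suc i)
  exponent₁ zero    = refl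
  exponent₁ (suc i) = trans (step i (tri (i * 2 + 1))) (cong (λ t → 1 + (suc i * 4 + t)) (exponent₁ i))
    where
    step : ∀ i t → suc (suc (i * 2 + 1)) + (suc (i * 2 + 1) + t) ≡ 1 + (suc i * 4 + t)
    step = ℕ.solve-∀
  ψ≈ : limit (∑ λ j → X^ (tri j)) ≈ ψ
  ψ≈ = ⟶-unique (⟶-subsequence (_* 2) (m≤m*k 2) converges)
    (⟶-cong (λ m → ≈-sym (≈-trans (∑-block 2 _ m) (∑-cong m λ i _ → ⊕-cong
      (≈-trans (⊕-identityˡ _) (mono-cong (sym (ℤ.^-zeroˡ i)) (exponent₀ i)))
      (mono-cong (sym (ℤ.^-zeroˡ (suc i))) (exponent₁ i))))) Thetaψ.theta-⟶)

⟶-combine₃ : ∀ {a b c A B C} → a ⟶ A → b ⟶ B → c ⟶ C → (λ m → combine₃ (a m) (b m) (c m)) ⟶ combine₃ A B C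
⟶-combine₃ p q r = ⟶-⊕ (⟶-⊕ (⟶-subs 1ℤ 3 p) (⟶-⊗ (⟶-const {X^ 1}) (⟶-subs 1ℤ 3 q)))
  (⟶-⊗ (⟶-const {X^ 2}) (⟶-subs 1ℤ 3 r))

combine₃-∑ : ∀ a b n → combine₃ (∑ a n) (∑ b n) 𝟘 ≈ ∑ (λ i → δ 3 (a i) ⊕ X^ 1 ⊗ δ 3 (b i)) n
combine₃-∑ a b n = begin
  combine₃ (∑ a n) (∑ b n) 𝟘
    ≈⟨ ⊕-cong (⊕-cong (subs-∑ 1ℤ 2 a n) (⊗-cong ≈-refl (subs-∑ 1ℤ 2 b n)))
         (≈-trans (⊗-cong ≈-refl (subs-𝟘 1ℤ 3)) (≈-trans (⊗-comm _ 𝟘) (⊗-zeroˡ _))) ⟩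
  ∑ (λ i → δ 3 (a i)) n ⊕ X^ 1 ⊗ ∑ (λ i → δ 3 (b i)) n ⊕ 𝟘
    ≈⟨ ⊕-identityʳ _ ⟩
  ∑ (λ i → δ 3 (a i)) n ⊕ X^ 1 ⊗ ∑ (λ i → δ 3 (b i)) n
    ≈⟨ ⊕-cong ≈-refl (≈-sym (∑-⊗ (X^ 1) _ n)) ⟩
  ∑ (λ i → δ 3 (a i)) n ⊕ ∑ (λ i → X^ 1 ⊗ δ 3 (b i)) n
    ≈⟨ ≈-sym (∑-⊕ _ _ n) ⟩
  ∑ (λ i → δ 3 (a i) ⊕ X^ 1 ⊗ δ 3 (b i)) n ∎

-- Triangular numbers sorted by j modulo 3: j = 3i + 1 gives 9 tri(i) + 1, while j = 3i and j = 3i +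
-- 2 give three times the exponents of the two halves of `A`.
ψ-dissection : ψ ≈ combine₃ A (δ 3 ψ) 𝟘
ψ-dissection = ⟶-unique (⟶-subsequence (_* 3) (m≤m*k 3) ψ-⟶)
  (⟶-cong (λ m → ≈-sym (≈-trans (∑-block 3 _ m) (≈-trans (∑-cong m λ i _ → block i)
      (≈-sym (≈-trans (⊕-cong (⊕-cong ≈-refl (⊗-cong ≈-refl (subs-cong 1ℤ 3 (subs-∑ 1ℤ 2 _ m)))) ≈-refl)
        (combine₃-∑ ThetaA.thetaTerm (λ i → δ 3 (X^ (tri i))) m))))))
    (⟶-combine₃ ThetaA.theta-⟶ (⟶-subs 1ℤ 3 ψ-⟶) (⟶-const {𝟘})))
  where
  exponent₀ : ∀ i → tri (i * 3 + 0) ≡ ThetaA.e 2 i * 3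
  exponent₀ zero    = refl
  exponent₀ (suc i) = trans (cong (λ t → suc (suc (suc (i * 3 + 0))) + (suc (suc (i * 3 + 0)) + (suc (i * 3 + 0) + t))) (exponent₀ i))
    (step i (ThetaA.e 2 i))
    where
    step : ∀ i t → suc (suc (suc (i * 3 + 0))) + (suc (suc (i * 3 + 0)) + (suc (i * 3 + 0) + t * 3)) ≡ (2 + (i * 3 + t)) * 3
    step = ℕ.solve-∀
  exponent₁ : ∀ i → tri (i * 3 + 1) ≡ suc (tri i * 3 * 3)
  exponent₁ zero    = refl
  exponent₁ (suc i) = trans (cong (λ t → suc (suc (suc (i * 3 + 1))) + (suc (suc (i * 3 + 1)) + (suc (i * 3 + 1) + t))) (exponent₁ i))
    (step i (tri i))
    where
    step : ∀ i t → suc (suc (suc (i * 3 + 1))) + (suc (suc (i * 3 + 1)) + (suc (i * 3 + 1) + suc (t * 3 * 3))) ≡ suc ((suc i + t) * 3 * 3)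
    step = ℕ.solve-∀
  exponent₂ : ∀ i → tri (i * 3 + 2) ≡ ThetaA.e 1 (suc i) * 3
  exponent₂ zero    = refl
  exponent₂ (suc i) = trans (cong (λ t → suc (suc (suc (i * 3 + 2))) + (suc (suc (i * 3 + 2)) + (suc (i * 3 + 2) + t))) (exponent₂ i))
    (step i (ThetaA.e 1 (suc i)))
    where
    step : ∀ i t → suc (suc (suc (i * 3 + 2))) + (suc (suc (i * 3 + 2)) + (suc (i * 3 + 2) + t * 3)) ≡ (1 + (suc i * 3 + t)) * 3
    step = ℕ.solve-∀
  block : ∀ i → ∑ (λ r → X^ (tri (i * 3 + r))) 3 ≈ δ 3 (ThetaA.thetaTerm i) ⊕ X^ 1 ⊗ δ 3 (δ 3 (X^ (tri i)))
  block i = begin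
    𝟘 ⊕ X^ (tri (i * 3 + 0)) ⊕ X^ (tri (i * 3 + 1)) ⊕ X^ (tri (i * 3 + 2))
      ≈⟨ ⊕-cong (⊕-cong (≈-trans (⊕-identityˡ _) (≈-trans (mono-cong (sym (ℤ.^-zeroˡ i)) (exponent₀ i)) (mono-δ3 (1ℤ ℤ.^ i) (ThetaA.e 2 i))))
           (≈-trans (mono-cong {1ℤ} refl (exponent₁ i)) (≈-trans (mono-suc 1ℤ (tri i * 3 * 3))
             (⊗-cong ≈-refl (≈-trans (mono-δ3 1ℤ (tri i * 3)) (subs-cong 1ℤ 3 (mono-δ3 1ℤ (tri i))))))))
           (≈-trans (mono-cong (sym (ℤ.^-zeroˡ (suc i))) (exponent₂ i)) (mono-δ3 (1ℤ ℤ.^ suc i) (ThetaA.e 1 (suc i)))) ⟩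
    δ 3 (ThetaA.T 2 i) ⊕ X^ 1 ⊗ δ 3 (δ 3 (X^ (tri i))) ⊕ δ 3 (ThetaA.T 1 (suc i))
      ≈⟨ solve 3 (λ a b c → a :+ b :+ c := a :+ c :+ b) ≈-refl (δ 3 (ThetaA.T 2 i)) _ (δ 3 (ThetaA.T 1 (suc i))) ⟩
    δ 3 (ThetaA.T 2 i) ⊕ δ 3 (ThetaA.T 1 (suc i)) ⊕ X^ 1 ⊗ δ 3 (δ 3 (X^ (tri i)))
      ≈⟨ ⊕-cong (≈-sym (subs-⊕ 1ℤ 2 _ _)) ≈-refl ⟩
    _ ∎

-- The terms of (φ - 1) / 2, starting at the square 1; a series of its own makes the divisibility of
-- φ - 1 by 2 explicit.
h : ℕ → Series
h i = mono (-1ℤ ℤ.^ suc i) (suc i * suc i)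

H : Series
H = limit (∑ h)

H-⟶ : ∑ h ⟶ H
H-⟶ = ∑-⟶ h λ i → mono≡[]𝟘 _ (ℕ.≤-trans (ℕ.n≤1+n i) (ℕ.m≤m*n (suc i) (suc i)))

φ≈1+2H : φ ≈ 𝟙 ⊕ const (ℤ.+ 2) ⊗ H
φ≈1+2H = ⟶-unique Thetaφ.theta-⟶ λ m → ≡[]-trans (partial m)
    (⊕-cong[] (≈⇒≡[] ≈-refl) (⊗-cong[] (≈⇒≡[] ≈-refl) (H-⟶ m)))
  where
  T : ℕ → Series
  T = Thetaφ.T 1
  square : ∀ i → Thetaφ.e 1 i ≡ i * i
  square zero    = refl
  square (suc i) = trans (cong (λ t → 1 + (i * 2 + t)) (square i)) (step i)
    where
    step : ∀ i → 1 + (i * 2 + i * i) ≡ suc i * suc i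
    step = ℕ.solve-∀
  -- `thetaTerm i` pairs index i with -(i + 1). Adding the term of index n completes the pairs of
  -- opposite indices, whose terms are equal.
  telescope : ∀ n → ∑ Thetaφ.thetaTerm n ⊕ T n ≈ 𝟙 ⊕ const (ℤ.+ 2) ⊗ ∑ (λ i → T (suc i)) n
  telescope zero    = ≈-trans (⊕-identityˡ 𝟙) (≈-sym (≈-trans
    (⊕-cong ≈-refl (≈-trans (⊗-comm _ 𝟘) (⊗-zeroˡ _))) (⊕-identityʳ 𝟙)))
  telescope (suc n) = begin
    ∑ Thetaφ.thetaTerm n ⊕ (T n ⊕ T (suc n)) ⊕ T (suc n)
      ≈⟨ solve 3 (λ s a b → s :+ (a :+ b) :+ b := s :+ a :+ con (ℤ.+ 2) :* b) ≈-refl _ (T n) (T (suc n)) ⟩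
    ∑ Thetaφ.thetaTerm n ⊕ T n ⊕ const (ℤ.+ 2) ⊗ T (suc n)
      ≈⟨ ⊕-cong (telescope n) ≈-refl ⟩
    𝟙 ⊕ const (ℤ.+ 2) ⊗ ∑ (λ i → T (suc i)) n ⊕ const (ℤ.+ 2) ⊗ T (suc n)
      ≈⟨ solve 2 (λ s b → con 1ℤ :+ con (ℤ.+ 2) :* s :+ con (ℤ.+ 2) :* b := con 1ℤ :+ con (ℤ.+ 2) :* (s :+ b)) ≈-refl
           (∑ (λ i → T (suc i)) n) (T (suc n)) ⟩
    𝟙 ⊕ const (ℤ.+ 2) ⊗ (∑ (λ i → T (suc i)) n ⊕ T (suc n)) ∎
  partial : ∀ m → ∑ Thetaφ.thetaTerm m ≡[ m ] 𝟙 ⊕ const (ℤ.+ 2) ⊗ ∑ h m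
  partial m = ≡[]-trans (≡[]-sym (≡[]-trans
      (⊕-cong[] (≈⇒≡[] ≈-refl) (mono≡[]𝟘 _ (Thetaφ.i≤e 1 m))) (≈⇒≡[] (⊕-identityʳ _))))
    (≈⇒≡[] (≈-trans (telescope m) (⊕-cong ≈-refl (⊗-cong ≈-refl
      (∑-cong m λ i _ → mono-cong refl (square (suc i)))))))

-- Squares modulo 3: multiples of 3 give H(q⁹), while (3i + 1)² and (3i + 2)² are 1 plus three times
-- the exponents 3i² + 2i and 3i² + 4i + 1 of `Ω`, with reversed signs.
H-dissection : H ≈ combine₃ (δ 3 H) (⊝ Ω) 𝟘
H-dissection = ⟶-unique (⟶-subsequence (_* 3) (m≤m*k 3) H-⟶)
  (⟶-cong (λ m → ≈-sym (≈-trans (∑-block 3 _ m) (≈-trans (∑-cong m λ i _ → block i)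
      (≈-trans (≈-sym (combine₃-∑ (λ i → δ 3 (h i)) (λ i → const -1ℤ ⊗ ThetaΩ.thetaTerm i) m))
        (⊕-cong (⊕-cong (subs-cong 1ℤ 3 (≈-sym (subs-∑ 1ℤ 2 h m)))
          (⊗-cong ≈-refl (subs-cong 1ℤ 3 (≈-trans (∑-⊗ (const -1ℤ) _ m)
            (solve 1 (λ x → con -1ℤ :* x := :- x) ≈-refl _))))) ≈-refl)))))
    (⟶-combine₃ (⟶-subs 1ℤ 3 H-⟶) (⟶-⊝ ThetaΩ.theta-⟶) (⟶-const {𝟘})))
  where
  s : ℕ → ℤ
  s i = -1ℤ ℤ.^ i
  signs : ∀ i r → s (i * 3 + r) ≡ s i ℤ.* s r
  signs zero    r = sym (ℤ.*-identityˡ (s r))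
  signs (suc i) r = trans (cong (λ x → -1ℤ ℤ.* (-1ℤ ℤ.* (-1ℤ ℤ.* x))) (signs i r)) (step (s i) (s r))
    where
    step : ∀ x y → -1ℤ ℤ.* (-1ℤ ℤ.* (-1ℤ ℤ.* (x ℤ.* y))) ≡ -1ℤ ℤ.* x ℤ.* y
    step = solve-∀
  sign₀ : ∀ i → s (suc (i * 3 + 0)) ≡ -1ℤ ℤ.* s i
  sign₀ i = cong (-1ℤ ℤ.*_) (trans (signs i 0) (ℤ.*-identityʳ (s i)))
  sign₁ : ∀ i → s (suc (i * 3 + 1)) ≡ -1ℤ ℤ.* s (suc i)
  sign₁ i = cong (-1ℤ ℤ.*_) (trans (signs i 1) (ℤ.*-comm (s i) -1ℤ))
  sign₂ : ∀ i → s (suc (i * 3 + 2)) ≡ s (suc i)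
  sign₂ i = cong (-1ℤ ℤ.*_) (trans (signs i 2) (ℤ.*-identityʳ (s i)))
  e₅ : ∀ i → ThetaΩ.e 5 i ≡ 3 * (i * i) + 2 * i
  e₅ zero    = refl
  e₅ (suc i) = trans (cong (λ t → 5 + (i * 6 + t)) (e₅ i)) (step i)
    where
    step : ∀ i → 5 + (i * 6 + (3 * (i * i) + 2 * i)) ≡ 3 * (suc i * suc i) + 2 * suc i
    step = ℕ.solve-∀
  e₁ : ∀ i → ThetaΩ.e 1 (suc i) ≡ 3 * (i * i) + 4 * i + 1
  e₁ zero    = refl
  e₁ (suc i) = trans (cong (λ t → 1 + (suc i * 6 + t)) (e₁ i)) (step i)
    where
    step : ∀ i → 1 + (suc i * 6 + (3 * (i * i) + 4 * i + 1)) ≡ 3 * (suc i * suc i) + 4 * suc i + 1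
    step = ℕ.solve-∀
  exponent₀ : ∀ i → suc (i * 3 + 0) * suc (i * 3 + 0) ≡ suc (ThetaΩ.e 5 i * 3)
  exponent₀ i = trans (step i) (cong (λ t → suc (t * 3)) (sym (e₅ i)))
    where
    step : ∀ i → suc (i * 3 + 0) * suc (i * 3 + 0) ≡ suc ((3 * (i * i) + 2 * i) * 3)
    step = ℕ.solve-∀
  exponent₁ : ∀ i → suc (i * 3 + 1) * suc (i * 3 + 1) ≡ suc (ThetaΩ.e 1 (suc i) * 3)
  exponent₁ i = trans (step i) (cong (λ t → suc (t * 3)) (sym (e₁ i)))
    where
    step : ∀ i → suc (i * 3 + 1) * suc (i * 3 + 1) ≡ suc ((3 * (i * i) + 4 * i + 1) * 3)
    step = ℕ.solve-∀
  exponent₂ : ∀ i → suc (i * 3 + 2) * suc (i * 3 + 2) ≡ suc i * suc i * 3 * 3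
  exponent₂ = ℕ.solve-∀
  single : ∀ {x y} t k → x ≡ -1ℤ ℤ.* t → y ≡ suc (k * 3) → mono x y ≈ X^ 1 ⊗ δ 3 (⊝ mono t k)
  single t k refl refl = ≈-trans (mono-suc (-1ℤ ℤ.* t) (k * 3)) (⊗-cong ≈-refl
    (≈-trans (mono-δ3 (-1ℤ ℤ.* t) k) (subs-cong 1ℤ 3 (mono-neg t k))))
  block : ∀ i → ∑ (λ r → h (i * 3 + r)) 3 ≈ δ 3 (δ 3 (h i)) ⊕ X^ 1 ⊗ δ 3 (const -1ℤ ⊗ ThetaΩ.thetaTerm i)
  block i = begin
    𝟘 ⊕ h (i * 3 + 0) ⊕ h (i * 3 + 1) ⊕ h (i * 3 + 2)
      ≈⟨ ⊕-cong (⊕-cong (≈-trans (⊕-identityˡ _) (single (s i) (ThetaΩ.e 5 i) (sign₀ i) (exponent₀ i)))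
            (single (s (suc i)) (ThetaΩ.e 1 (suc i)) (sign₁ i) (exponent₁ i)))
           (≈-trans (mono-cong (sign₂ i) (exponent₂ i)) (≈-trans (mono-δ3 (s (suc i)) (suc i * suc i * 3)) (subs-cong 1ℤ 3 (mono-δ3 (s (suc i)) (suc i * suc i))))) ⟩
    X^ 1 ⊗ δ 3 (⊝ t₁) ⊕ X^ 1 ⊗ δ 3 (⊝ t₂) ⊕ δ 3 (δ 3 (h i))
      ≈⟨ solve 4 (λ x a b c → x :* a :+ x :* b :+ c := c :+ x :* (a :+ b)) ≈-refl
           (X^ 1) (δ 3 (⊝ t₁)) (δ 3 (⊝ t₂)) (δ 3 (δ 3 (h i))) ⟩
    δ 3 (δ 3 (h i)) ⊕ X^ 1 ⊗ (δ 3 (⊝ t₁) ⊕ δ 3 (⊝ t₂))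
      ≈⟨ ⊕-cong ≈-refl (⊗-cong ≈-refl (≈-trans (≈-sym (subs-⊕ 1ℤ 2 _ _)) (subs-cong 1ℤ 3
           (solve 2 (λ a b → :- a :+ :- b := con -1ℤ :* (a :+ b)) ≈-refl t₁ t₂)))) ⟩
    _ ∎
    where
    t₁ t₂ : Series
    t₁ = ThetaΩ.T 5 i
    t₂ = ThetaΩ.T 1 (suc i)

φ-dissection : φ ≈ combine₃ (δ 3 φ) (const (ℤ.- ℤ.+ 2) ⊗ Ω) 𝟘
φ-dissection = begin
  φ ≈⟨ φ≈1+2H ⟩
  𝟙 ⊕ const (ℤ.+ 2) ⊗ H
    ≈⟨ ⊕-cong ≈-refl (⊗-cong ≈-refl H-dissection) ⟩
  𝟙 ⊕ const (ℤ.+ 2) ⊗ (δ 3 (δ 3 H) ⊕ X^ 1 ⊗ δ 3 (⊝ Ω) ⊕ X^ 2 ⊗ δ 3 𝟘)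
    ≈⟨ ⊕-cong ≈-refl (⊗-cong ≈-refl (⊕-cong (⊕-cong ≈-refl (⊗-cong ≈-refl (subs-⊝ 1ℤ 2 Ω))) vanish)) ⟩
  𝟙 ⊕ const (ℤ.+ 2) ⊗ (δ 3 (δ 3 H) ⊕ X^ 1 ⊗ ⊝ δ 3 Ω ⊕ const 0ℤ)
    ≈⟨ solve 3 (λ a x b → con 1ℤ :+ con (ℤ.+ 2) :* (a :+ x :* (:- b) :+ con 0ℤ) :=
         con 1ℤ :+ con (ℤ.+ 2) :* a :+ x :* (con (ℤ.- ℤ.+ 2) :* b) :+ con 0ℤ) ≈-refl (δ 3 (δ 3 H)) (X^ 1) (δ 3 Ω) ⟩
  𝟙 ⊕ const (ℤ.+ 2) ⊗ δ 3 (δ 3 H) ⊕ X^ 1 ⊗ (const (ℤ.- ℤ.+ 2) ⊗ δ 3 Ω) ⊕ const 0ℤ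
    ≈⟨ ≈-sym (⊕-cong (⊕-cong δδφ (⊗-cong ≈-refl (≈-trans (subs-⊗ 1ℤ 2 _ Ω) (⊗-cong (subs-const 1ℤ 2 _) ≈-refl)))) vanish) ⟩
  combine₃ (δ 3 φ) (const (ℤ.- ℤ.+ 2) ⊗ Ω) 𝟘 ∎
  where
  vanish : X^ 2 ⊗ δ 3 𝟘 ≈ const 0ℤ
  vanish = ≈-trans (⊗-cong ≈-refl (subs-𝟘 1ℤ 3)) (≈-trans (⊗-comm _ 𝟘) (≈-trans (⊗-zeroˡ _)
    (pointwise λ { zero → refl ; (suc n) → refl })))
  δ3-1+2 : ∀ f → δ 3 (𝟙 ⊕ const (ℤ.+ 2) ⊗ f) ≈ 𝟙 ⊕ const (ℤ.+ 2) ⊗ δ 3 f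
  δ3-1+2 f = ≈-trans (subs-⊕ 1ℤ 2 _ _) (⊕-cong (subs-const 1ℤ 2 1ℤ)
    (≈-trans (subs-⊗ 1ℤ 2 _ f) (⊗-cong (subs-const 1ℤ 2 (ℤ.+ 2)) ≈-refl)))
  δδφ : δ 3 (δ 3 φ) ≈ 𝟙 ⊕ const (ℤ.+ 2) ⊗ δ 3 (δ 3 H)
  δδφ = ≈-trans (subs-cong 1ℤ 3 (≈-trans (subs-cong 1ℤ 3 φ≈1+2H) (δ3-1+2 H))) (δ3-1+2 (δ 3 H))

-- An odd square is (2i + 1)² = 8 tri(i) + 1, and it carries the sign -1.
sec-2-1-φ : sec 2 1 φ ≈ const (ℤ.- ℤ.+ 2) ⊗ δ 2 (δ 2 ψ)
sec-2-1-φ = begin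
  sec 2 1 φ
    ≈⟨ sec-cong 2 1 (≈-trans φ≈1+2H (⊕-cong (≈-sym (≈-trans (⊗-identityˡ _) (subs-const 1ℤ 1 1ℤ))) ≈-refl)) ⟩
  sec 2 1 (X^ 0 ⊗ δ 2 𝟙 ⊕ const (ℤ.+ 2) ⊗ H)
    ≈⟨ ≈-trans (sec-⊕ 2 1 _ _) (⊕-cong (sec-X^δ≢ 1 0 1 𝟙 z<s (s<s z<s) λ ()) (sec-const⊗ 2 1 (ℤ.+ 2) H)) ⟩
  𝟘 ⊕ const (ℤ.+ 2) ⊗ sec 2 1 H
    ≈⟨ ≈-trans (⊕-identityˡ _) (⊗-cong ≈-refl sec-H) ⟩
  const (ℤ.+ 2) ⊗ ⊝ δ 2 (δ 2 ψ)
    ≈⟨ solve 1 (λ x → con (ℤ.+ 2) :* (:- x) := con (ℤ.- ℤ.+ 2) :* x) ≈-refl (δ 2 (δ 2 ψ)) ⟩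
  const (ℤ.- ℤ.+ 2) ⊗ δ 2 (δ 2 ψ) ∎
  where
  s : ℕ → ℤ
  s i = -1ℤ ℤ.^ i
  signs : ∀ i r → s (i * 2 + r) ≡ s r
  signs zero    r = refl
  signs (suc i) r = trans (step (s (i * 2 + r))) (signs i r)
    where
    step : ∀ x → -1ℤ ℤ.* (-1ℤ ℤ.* x) ≡ x
    step = solve-∀
  tri-8 : ∀ i → 8 * tri i ≡ 4 * (i * i) + 4 * i
  tri-8 zero    = refl
  tri-8 (suc i) = trans (ℕ.*-distribˡ-+ 8 (suc i) (tri i)) (trans (cong (8 * suc i +_) (tri-8 i)) (step i))
    where
    step : ∀ i → 8 * suc i + (4 * (i * i) + 4 * i) ≡ 4 * (suc i * suc i) + 4 * suc i
    step = ℕ.solve-∀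
  exponent₀ : ∀ i → suc (i * 2 + 0) * suc (i * 2 + 0) ≡ suc (tri i * 2 * 2 * 2)
  exponent₀ i = trans (step₁ i) (trans (cong suc (sym (tri-8 i))) (step₂ (tri i)))
    where
    step₁ : ∀ i → suc (i * 2 + 0) * suc (i * 2 + 0) ≡ suc (4 * (i * i) + 4 * i)
    step₁ = ℕ.solve-∀
    step₂ : ∀ t → suc (8 * t) ≡ suc (t * 2 * 2 * 2)
    step₂ = ℕ.solve-∀
  exponent₁ : ∀ i → suc (i * 2 + 1) * suc (i * 2 + 1) ≡ (suc i * suc i * 2) * 2
  exponent₁ = ℕ.solve-∀
  even : ℕ → Series
  even i = X^ (suc i * suc i * 2)
  K : Series
  K = limit (∑ even)
  K-⟶ : ∑ even ⟶ K
  K-⟶ = ∑-⟶ even λ i → mono≡[]𝟘 1ℤ (ℕ.≤-trans (ℕ.n≤1+n i) (ℕ.≤-trans (ℕ.m≤m*n (suc i) (suc i)) (ℕ.m≤m*n _ 2)))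
  block : ∀ i → ∑ (λ r → h (i * 2 + r)) 2 ≈ δ 2 (even i) ⊕ X^ 1 ⊗ δ 2 (const -1ℤ ⊗ δ 2 (δ 2 (X^ (tri i))))
  block i = ≈-trans (⊕-cong
    (≈-trans (⊕-identityˡ _) (≈-trans (mono-cong (cong (-1ℤ ℤ.*_) (signs i 0)) (exponent₀ i))
      (≈-trans (mono-suc -1ℤ (tri i * 2 * 2 * 2)) (⊗-cong ≈-refl (≈-trans (mono-δ2 -1ℤ (tri i * 2 * 2)) (subs-cong 1ℤ 2
        (≈-trans (≈-sym (mono-⊗ -1ℤ 1ℤ 0 (tri i * 2 * 2))) (⊗-cong ≈-refl
          (≈-trans (mono-δ2 1ℤ (tri i * 2)) (subs-cong 1ℤ 2 (mono-δ2 1ℤ (tri i)))))))))))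
    )
    (≈-trans (mono-cong (cong (-1ℤ ℤ.*_) (signs i 1)) (exponent₁ i)) (mono-δ2 1ℤ (suc i * suc i * 2))))
    (⊕-comm _ _)
  H≈ : H ≈ δ 2 K ⊕ X^ 1 ⊗ δ 2 (⊝ δ 2 (δ 2 ψ))
  H≈ = ⟶-unique (⟶-subsequence (_* 2) (m≤m*k 2) H-⟶)
    (⟶-cong (λ m → ≈-sym (≈-trans (∑-block 2 h m) (≈-trans (∑-cong m λ i _ → block i)
        (≈-trans (∑-⊕ _ _ m) (⊕-cong (≈-sym (subs-∑ 1ℤ 1 even m))
          (≈-trans (∑-⊗ (X^ 1) _ m) (⊗-cong ≈-refl (≈-trans (≈-sym (subs-∑ 1ℤ 1 _ m))
            (subs-cong 1ℤ 2 (≈-trans (∑-⊗ (const -1ℤ) _ m) (≈-trans (solve 1 (λ x → con -1ℤ :* x := :- x) ≈-refl _)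
              (⊝-cong (≈-trans (≈-sym (subs-∑ 1ℤ 1 _ m)) (subs-cong 1ℤ 2 (≈-sym (subs-∑ 1ℤ 1 _ m))))))))))))))))
      (⟶-⊕ (⟶-subs 1ℤ 2 K-⟶) (⟶-⊗ (⟶-const {X^ 1}) (⟶-subs 1ℤ 2 (⟶-⊝ (⟶-subs 1ℤ 2 (⟶-subs 1ℤ 2 ψ-⟶)))))))
  sec-H : sec 2 1 H ≈ ⊝ δ 2 (δ 2 ψ)
  sec-H = ≈-trans (sec-cong 2 1 (≈-trans H≈ (⊕-cong (≈-sym (⊗-identityˡ (δ 2 K))) ≈-refl)))
    (≈-trans (sec-⊕ 2 1 _ _) (≈-trans (⊕-cong (sec-X^δ≢ 1 0 1 K z<s (s<s z<s) λ ()) (sec-X^δ 1 1 _ (s<s z<s)))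
      (⊕-identityˡ _)))

-- Product formulas

P⁺ P⁻ : ℕ → ℕ → Series
P⁺ = P 1ℤ
P⁻ = P -1ℤ

-- F k = (q^k; q^k)_∞ and O = (-q; q²)_∞.
F : ℕ → Series
F k = P⁺ k k

O : Series
O = P⁻ 2 1

∏₂ : ∀ h → ∏ h 2 ≈ h 0 ⊗ h 1
∏₂ h = ⊗-cong (⊗-identityˡ (h 0)) ≈-refl

∏₃ : ∀ h → ∏ h 3 ≈ h 0 ⊗ h 1 ⊗ h 2
∏₃ h = ⊗-cong (∏₂ h) ≈-refl

split₂ : ∀ s c a .{{_ : ℕ.NonZero c}} → P s c a ≈ P s (2 * c) a ⊗ P s (2 * c) (1 * c + a)
split₂ s c a = ≈-trans (P-split 2 s c a) (∏₂ λ r → P s (2 * c) (r * c + a))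

split₃ : ∀ s c a .{{_ : ℕ.NonZero c}} → P s c a ≈ P s (3 * c) a ⊗ P s (3 * c) (1 * c + a) ⊗ P s (3 * c) (2 * c + a)
split₃ s c a = ≈-trans (P-split 3 s c a) (∏₃ λ r → P s (3 * c) (r * c + a))

F1-mod2 : F 1 ≈ P⁺ 2 1 ⊗ F 2
F1-mod2 = split₂ 1ℤ 1 1

F1-mod3 : F 1 ≈ P⁺ 3 1 ⊗ P⁺ 3 2 ⊗ F 3
F1-mod3 = split₃ 1ℤ 1 1

F2-mod4 : F 2 ≈ P⁺ 4 2 ⊗ F 4
F2-mod4 = split₂ 1ℤ 2 2

F2-mod6 : F 2 ≈ P⁺ 6 2 ⊗ P⁺ 6 4 ⊗ F 6
F2-mod6 = split₃ 1ℤ 2 2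

F3-mod6 : F 3 ≈ P⁺ 6 3 ⊗ F 6
F3-mod6 = split₂ 1ℤ 3 3

δF : ∀ k l .{{_ : ℕ.NonZero l}} → δ (suc k) (F l) ≈ F (l * suc k)
δF k l = P-δ k 1ℤ l l

ψ-product : ψ ≈ O ⊗ F 4
ψ-product = ≈-trans (≈-sym Thetaψ.tripleProduct) (≈-trans (⊗-comm _ _)
  (⊗-cong (≈-sym (split₂ -1ℤ 2 1)) ≈-refl))

O⊗F1⊗F4 : O ⊗ F 1 ⊗ F 4 ≈ F 2 ⊗ F 2
O⊗F1⊗F4 = begin
  O ⊗ F 1 ⊗ F 4              ≈⟨ ⊗-cong (⊗-cong ≈-refl F1-mod2) ≈-refl ⟩
  O ⊗ (P⁺ 2 1 ⊗ F 2) ⊗ F 4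
    ≈⟨ solve 4 (λ o p f₂ f₄ → o :* (p :* f₂) :* f₄ := p :* o :* f₄ :* f₂) ≈-refl O (P⁺ 2 1) (F 2) (F 4) ⟩
  P⁺ 2 1 ⊗ O ⊗ F 4 ⊗ F 2     ≈⟨ ⊗-cong (⊗-cong (P-± 2 1) ≈-refl) ≈-refl ⟩
  P⁺ 4 2 ⊗ F 4 ⊗ F 2         ≈⟨ ⊗-cong (≈-sym F2-mod4) ≈-refl ⟩
  F 2 ⊗ F 2 ∎

-- That is, ψ = f₂² / f₁. The three identities after it read A = f₂ f₃² / (f₁ f₆), φ = f₁² / f₂ and
-- Ω = f₁ f₆² / (f₂ f₃).
ψ⊗F1 : ψ ⊗ F 1 ≈ F 2 ⊗ F 2
ψ⊗F1 = ≈-trans (⊗-cong ψ-product ≈-refl) (≈-trans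
  (solve 3 (λ o f₄ f₁ → o :* f₄ :* f₁ := o :* f₁ :* f₄) ≈-refl O (F 4) (F 1)) O⊗F1⊗F4)

A⊗F1⊗F6 : A ⊗ F 1 ⊗ F 6 ≈ F 2 ⊗ (F 3 ⊗ F 3)
A⊗F1⊗F6 = begin
  A ⊗ F 1 ⊗ F 6
    ≈⟨ ⊗-cong (⊗-cong (≈-sym ThetaA.tripleProduct) F1-mod3) ≈-refl ⟩
  F 3 ⊗ (P⁻ 3 1 ⊗ P⁻ 3 2) ⊗ (P⁺ 3 1 ⊗ P⁺ 3 2 ⊗ F 3) ⊗ F 6
    ≈⟨ solve 6 (λ f₃ a b c d f₆ → f₃ :* (a :* b) :* (c :* d :* f₃) :* f₆ := c :* a :* (d :* b) :* f₆ :* (f₃ :* f₃))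
         ≈-refl (F 3) (P⁻ 3 1) (P⁻ 3 2) (P⁺ 3 1) (P⁺ 3 2) (F 6) ⟩
  P⁺ 3 1 ⊗ P⁻ 3 1 ⊗ (P⁺ 3 2 ⊗ P⁻ 3 2) ⊗ F 6 ⊗ (F 3 ⊗ F 3)
    ≈⟨ ⊗-cong (⊗-cong (⊗-cong (P-± 3 1) (P-± 3 2)) ≈-refl) ≈-refl ⟩
  P⁺ 6 2 ⊗ P⁺ 6 4 ⊗ F 6 ⊗ (F 3 ⊗ F 3)
    ≈⟨ ⊗-cong (≈-sym F2-mod6) ≈-refl ⟩
  F 2 ⊗ (F 3 ⊗ F 3) ∎

φ⊗F2 : φ ⊗ F 2 ≈ F 1 ⊗ F 1
φ⊗F2 = begin
  φ ⊗ F 2                          ≈⟨ ⊗-cong (≈-sym Thetaφ.tripleProduct) ≈-refl ⟩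
  F 2 ⊗ (P⁺ 2 1 ⊗ P⁺ 2 1) ⊗ F 2
    ≈⟨ solve 2 (λ f p → f :* (p :* p) :* f := p :* f :* (p :* f)) ≈-refl (F 2) (P⁺ 2 1) ⟩
  P⁺ 2 1 ⊗ F 2 ⊗ (P⁺ 2 1 ⊗ F 2)    ≈⟨ ≈-sym (⊗-cong F1-mod2 F1-mod2) ⟩
  F 1 ⊗ F 1 ∎

Ω⊗F2⊗F3 : Ω ⊗ F 2 ⊗ F 3 ≈ F 1 ⊗ (F 6 ⊗ F 6)
Ω⊗F2⊗F3 = begin
  Ω ⊗ F 2 ⊗ F 3
    ≈⟨ ⊗-cong (⊗-cong (≈-sym ThetaΩ.tripleProduct) ≈-refl) F3-mod6 ⟩
  F 6 ⊗ (P⁺ 6 1 ⊗ P⁺ 6 5) ⊗ F 2 ⊗ (P⁺ 6 3 ⊗ F 6)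
    ≈⟨ solve 5 (λ f₆ a b f₂ c → f₆ :* (a :* b) :* f₂ :* (c :* f₆) := a :* c :* b :* f₂ :* (f₆ :* f₆))
         ≈-refl (F 6) (P⁺ 6 1) (P⁺ 6 5) (F 2) (P⁺ 6 3) ⟩
  P⁺ 6 1 ⊗ P⁺ 6 3 ⊗ P⁺ 6 5 ⊗ F 2 ⊗ (F 6 ⊗ F 6)
    ≈⟨ ⊗-cong (≈-sym (≈-trans F1-mod2 (⊗-cong (split₃ 1ℤ 2 1) ≈-refl))) ≈-refl ⟩
  F 1 ⊗ (F 6 ⊗ F 6) ∎

X^-cube : ∀ i r → X^ i ⊗ X^ i ⊗ X^ i ⊗ X^ r ≈ X^ (i * 3 + r)
X^-cube i r = ≈-trans (⊗-cong (≈-trans (⊗-cong (mono-⊗ 1ℤ 1ℤ i i) ≈-refl) (mono-⊗ 1ℤ 1ℤ (i + i) i)) ≈-refl)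
  (≈-trans (mono-⊗ 1ℤ 1ℤ (i + i + i) r) (≡⇒≈ (cong X^ (exponent i r))))
  where
  exponent : ∀ i r → i + i + i + r ≡ i * 3 + r
  exponent = ℕ.solve-∀

-- The factors 1 - q^{3i+r} with r = 1, 2 are their own norms.
norm-P₁ : norm (P⁺ 3 1) ≈ P⁺ 3 1
norm-P₁ = ⟶-unique (⟶-norm (P-⟶ 1ℤ 3 1))
  (⟶-cong (λ m → ≈-sym (≈-trans (norm-∏ (λ i → fac 1ℤ (i * 3 + 1)) (m * 3)) (∏-cong (m * 3) factor)))
    (⟶-subsequence (_* 3) (m≤m*k 3) (P-⟶ 1ℤ 3 1)))
  where
  factor : ∀ i → norm (fac 1ℤ (i * 3 + 1)) ≈ fac 1ℤ (i * 3 + 1)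
  factor i = begin
    norm (fac 1ℤ (i * 3 + 1))
      ≈⟨ norm-combine₃ 𝟙 (⊝ X^ i) (const 0ℤ) split ⟩
    cubic 𝟙 (⊝ X^ i) (const 0ℤ)
      ≈⟨ solve 2 (λ x y → con 1ℤ :* con 1ℤ :* con 1ℤ :+ x :* (:- y :* (:- y) :* (:- y)) :+ x :* x :* (con 0ℤ :* con 0ℤ :* con 0ℤ)
           :- con (ℤ.+ 3) :* x :* con 1ℤ :* (:- y) :* con 0ℤ := con 1ℤ :- (y :* y :* y) :* x) ≈-refl (X^ 1) (X^ i) ⟩
    𝟙 ⊖ (X^ i ⊗ X^ i ⊗ X^ i) ⊗ X^ 1
      ≈⟨ ⊕-cong ≈-refl (⊝-cong (X^-cube i 1)) ⟩
    fac 1ℤ (i * 3 + 1) ∎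
    where
    split : fac 1ℤ (i * 3 + 1) ≈ combine₃ 𝟙 (⊝ X^ i) (const 0ℤ)
    split = ≈-sym (begin
      δ 3 𝟙 ⊕ X^ 1 ⊗ δ 3 (⊝ X^ i) ⊕ X^ 2 ⊗ δ 3 (const 0ℤ)
        ≈⟨ ⊕-cong (⊕-cong (subs-const 1ℤ 2 1ℤ) (⊗-cong ≈-refl (≈-trans (subs-⊝ 1ℤ 2 (X^ i)) (⊝-cong (δ-mono 2 1ℤ i)))))
             (⊗-cong ≈-refl (subs-const 1ℤ 2 0ℤ)) ⟩
      𝟙 ⊕ X^ 1 ⊗ ⊝ X^ (i * 3) ⊕ X^ 2 ⊗ const 0ℤ
        ≈⟨ solve 3 (λ x y z → con 1ℤ :+ x :* (:- y) :+ z :* con 0ℤ := con 1ℤ :- y :* x) ≈-refl (X^ 1) (X^ (i * 3)) (X^ 2) ⟩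
      𝟙 ⊖ X^ (i * 3) ⊗ X^ 1
        ≈⟨ ⊕-cong ≈-refl (⊝-cong (mono-⊗ 1ℤ 1ℤ (i * 3) 1)) ⟩
      fac 1ℤ (i * 3 + 1) ∎)

norm-P₂ : norm (P⁺ 3 2) ≈ P⁺ 3 2
norm-P₂ = ⟶-unique (⟶-norm (P-⟶ 1ℤ 3 2))
  (⟶-cong (λ m → ≈-sym (≈-trans (norm-∏ (λ i → fac 1ℤ (i * 3 + 2)) (m * 3)) (∏-cong (m * 3) factor)))
    (⟶-subsequence (_* 3) (m≤m*k 3) (P-⟶ 1ℤ 3 2)))
  where
  factor : ∀ i → norm (fac 1ℤ (i * 3 + 2)) ≈ fac 1ℤ (i * 3 + 2)
  factor i = begin
    norm (fac 1ℤ (i * 3 + 2))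
      ≈⟨ norm-combine₃ 𝟙 (const 0ℤ) (⊝ X^ i) split ⟩
    cubic 𝟙 (const 0ℤ) (⊝ X^ i)
      ≈⟨ solve 2 (λ x y → con 1ℤ :* con 1ℤ :* con 1ℤ :+ x :* (con 0ℤ :* con 0ℤ :* con 0ℤ) :+ x :* x :* (:- y :* (:- y) :* (:- y))
           :- con (ℤ.+ 3) :* x :* con 1ℤ :* con 0ℤ :* (:- y) := con 1ℤ :- (y :* y :* y) :* (x :* x)) ≈-refl (X^ 1) (X^ i) ⟩
    𝟙 ⊖ (X^ i ⊗ X^ i ⊗ X^ i) ⊗ (X^ 1 ⊗ X^ 1)
      ≈⟨ ⊕-cong ≈-refl (⊝-cong (≈-trans (⊗-cong ≈-refl (mono-⊗ 1ℤ 1ℤ 1 1)) (X^-cube i 2))) ⟩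
    fac 1ℤ (i * 3 + 2) ∎
    where
    split : fac 1ℤ (i * 3 + 2) ≈ combine₃ 𝟙 (const 0ℤ) (⊝ X^ i)
    split = ≈-sym (begin
      δ 3 𝟙 ⊕ X^ 1 ⊗ δ 3 (const 0ℤ) ⊕ X^ 2 ⊗ δ 3 (⊝ X^ i)
        ≈⟨ ⊕-cong (⊕-cong (subs-const 1ℤ 2 1ℤ) (⊗-cong ≈-refl (subs-const 1ℤ 2 0ℤ)))
             (⊗-cong ≈-refl (≈-trans (subs-⊝ 1ℤ 2 (X^ i)) (⊝-cong (δ-mono 2 1ℤ i)))) ⟩
      𝟙 ⊕ X^ 1 ⊗ const 0ℤ ⊕ X^ 2 ⊗ ⊝ X^ (i * 3)
        ≈⟨ solve 3 (λ x y z → con 1ℤ :+ x :* con 0ℤ :+ z :* (:- y) := con 1ℤ :- y :* z) ≈-refl (X^ 1) (X^ (i * 3)) (X^ 2) ⟩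
      𝟙 ⊖ X^ (i * 3) ⊗ X^ 2
        ≈⟨ ⊕-cong ≈-refl (⊝-cong (mono-⊗ 1ℤ 1ℤ (i * 3) 2)) ⟩
      fac 1ℤ (i * 3 + 2) ∎)

-- The factors of f₁ with exponents prime to 3 make up f₁ / f₃ and are fixed by the norm; the others
-- form f₁(q³), whose norm is f₁³.
norm-F1 : norm (F 1) ⊗ F 3 ≈ F 1 ⊗ (F 1 ⊗ F 1 ⊗ F 1)
norm-F1 = begin
  norm (F 1) ⊗ F 3
    ≈⟨ ⊗-cong (begin
         norm (F 1)
           ≈⟨ norm-cong (≈-trans F1-mod3 (⊗-cong ≈-refl (≈-sym (δF 2 1)))) ⟩
         norm (P⁺ 3 1 ⊗ P⁺ 3 2 ⊗ δ 3 (F 1))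
           ≈⟨ ≈-trans (norm-⊗ _ _) (⊗-cong (norm-⊗ _ _) ≈-refl) ⟩
         norm (P⁺ 3 1) ⊗ norm (P⁺ 3 2) ⊗ norm (δ 3 (F 1))
           ≈⟨ ⊗-cong (⊗-cong norm-P₁ norm-P₂) (norm-δ (F 1)) ⟩
         P⁺ 3 1 ⊗ P⁺ 3 2 ⊗ (F 1 ⊗ F 1 ⊗ F 1) ∎) ≈-refl ⟩
  P⁺ 3 1 ⊗ P⁺ 3 2 ⊗ (F 1 ⊗ F 1 ⊗ F 1) ⊗ F 3
    ≈⟨ solve 4 (λ a b c d → a :* b :* c :* d := a :* b :* d :* c) ≈-refl (P⁺ 3 1) (P⁺ 3 2) (F 1 ⊗ F 1 ⊗ F 1) (F 3) ⟩
  P⁺ 3 1 ⊗ P⁺ 3 2 ⊗ F 3 ⊗ (F 1 ⊗ F 1 ⊗ F 1)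
    ≈⟨ ⊗-cong (≈-sym F1-mod3) ≈-refl ⟩
  F 1 ⊗ (F 1 ⊗ F 1 ⊗ F 1) ∎

δ3-⊗ : ∀ {f g f′ g′} → δ 3 f ≈ f′ → δ 3 g ≈ g′ → δ 3 (f ⊗ g) ≈ f′ ⊗ g′
δ3-⊗ p q = ≈-trans (subs-⊗ 1ℤ 2 _ _) (⊗-cong p q)

norm-F2 : norm (F 2) ⊗ F 6 ≈ F 2 ⊗ (F 2 ⊗ F 2 ⊗ F 2)
norm-F2 = begin
  norm (F 2) ⊗ F 6
    ≈⟨ ⊗-cong (≈-trans (norm-cong (≈-sym (δF 1 1))) (norm-δ2 (F 1))) (≈-sym (δF 1 3)) ⟩
  δ 2 (norm (F 1)) ⊗ δ 2 (F 3)
    ≈⟨ ≈-sym (subs-⊗ 1ℤ 1 _ _) ⟩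
  δ 2 (norm (F 1) ⊗ F 3)
    ≈⟨ subs-cong 1ℤ 2 norm-F1 ⟩
  δ 2 (F 1 ⊗ (F 1 ⊗ F 1 ⊗ F 1))
    ≈⟨ δ2-⊗ (δF 1 1) (δ2-⊗ (δ2-⊗ (δF 1 1) (δF 1 1)) (δF 1 1)) ⟩
  F 2 ⊗ (F 2 ⊗ F 2 ⊗ F 2) ∎

-- Multiplicativity applied to ψ f₁ = f₂² gives norm ψ = f₂⁸ f₃ / (f₁⁴ f₆²).
norm-ψ : norm ψ ⊗ (F 1 ⊗ (F 1 ⊗ F 1 ⊗ F 1)) ⊗ (F 6 ⊗ F 6) ≈
         F 2 ⊗ (F 2 ⊗ F 2 ⊗ F 2) ⊗ (F 2 ⊗ (F 2 ⊗ F 2 ⊗ F 2)) ⊗ F 3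
norm-ψ = begin
  norm ψ ⊗ (F 1 ⊗ (F 1 ⊗ F 1 ⊗ F 1)) ⊗ (F 6 ⊗ F 6)
    ≈⟨ ⊗-cong (⊗-cong ≈-refl (≈-sym norm-F1)) ≈-refl ⟩
  norm ψ ⊗ (norm (F 1) ⊗ F 3) ⊗ (F 6 ⊗ F 6)
    ≈⟨ solve 4 (λ n m f₃ f₆ → n :* (m :* f₃) :* (f₆ :* f₆) := n :* m :* (f₆ :* f₆) :* f₃) ≈-refl
         (norm ψ) (norm (F 1)) (F 3) (F 6) ⟩
  norm ψ ⊗ norm (F 1) ⊗ (F 6 ⊗ F 6) ⊗ F 3
    ≈⟨ ⊗-cong (⊗-cong (≈-trans (≈-sym (norm-⊗ ψ (F 1))) (≈-trans (norm-cong ψ⊗F1) (norm-⊗ (F 2) (F 2)))) ≈-refl) ≈-refl ⟩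
  norm (F 2) ⊗ norm (F 2) ⊗ (F 6 ⊗ F 6) ⊗ F 3
    ≈⟨ solve 3 (λ m f₆ f₃ → m :* m :* (f₆ :* f₆) :* f₃ := m :* f₆ :* (m :* f₆) :* f₃) ≈-refl (norm (F 2)) (F 6) (F 3) ⟩
  norm (F 2) ⊗ F 6 ⊗ (norm (F 2) ⊗ F 6) ⊗ F 3
    ≈⟨ ⊗-cong (⊗-cong norm-F2 norm-F2) ≈-refl ⟩
  F 2 ⊗ (F 2 ⊗ F 2 ⊗ F 2) ⊗ (F 2 ⊗ (F 2 ⊗ F 2 ⊗ F 2)) ⊗ F 3 ∎

-- Relations between φ, ψ and the f_k, and sections modulo 3

φ₂ φ₃ φ₄ ψ₂ ψ₃ ψ₄ : Series
φ₂ = δ 2 φ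
φ₃ = δ 3 φ
φ₄ = δ 2 φ₂
ψ₂ = δ 2 ψ
ψ₃ = δ 3 ψ
ψ₄ = δ 2 ψ₂

F-0 : ∀ k → F (suc k) 0 ≡ 1ℤ
F-0 k = P-0 1ℤ (suc k) k

⊗-0 : ∀ {f g} → f 0 ≡ 1ℤ → g 0 ≡ 1ℤ → (f ⊗ g) 0 ≡ 1ℤ
⊗-0 p q = cong₂ ℤ._*_ p q

unit-factor : ∀ f g {h} → f ⊗ g ≈ h → g 0 ≡ 1ℤ → h 0 ≡ 1ℤ → f 0 ≡ 1ℤ
unit-factor f g p g₀ h₀ = trans (sym (ℤ.*-identityʳ (f 0)))
  (trans (cong (f 0 ℤ.*_) (sym g₀)) (trans (coeff p 0) h₀))

ψ-0 : ψ 0 ≡ 1ℤ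
ψ-0 = unit-factor ψ (F 1) ψ⊗F1 (F-0 0) (⊗-0 {F 2} {F 2} (F-0 1) (F-0 1))

φ-0 : φ 0 ≡ 1ℤ
φ-0 = unit-factor φ (F 2) φ⊗F2 (F-0 1) (⊗-0 {F 1} {F 1} (F-0 0) (F-0 0))

F1⊗F2 : F 1 ⊗ F 2 ≈ φ ⊗ ψ
F1⊗F2 = ⊗-cancelˡ (F 1 ⊗ F 2) (⊗-0 {F 1} {F 2} (F-0 0) (F-0 1)) (begin
  F 1 ⊗ F 2 ⊗ (F 1 ⊗ F 2)
    ≈⟨ solve 2 (λ x y → x :* y :* (x :* y) := x :* x :* (y :* y)) ≈-refl (F 1) (F 2) ⟩
  F 1 ⊗ F 1 ⊗ (F 2 ⊗ F 2)
    ≈⟨ ⊗-cong (≈-sym φ⊗F2) (≈-sym ψ⊗F1) ⟩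
  φ ⊗ F 2 ⊗ (ψ ⊗ F 1)
    ≈⟨ solve 4 (λ p x s y → p :* x :* (s :* y) := y :* x :* (p :* s)) ≈-refl φ (F 2) ψ (F 1) ⟩
  F 1 ⊗ F 2 ⊗ (φ ⊗ ψ) ∎)

F1³ : F 1 ⊗ F 1 ⊗ F 1 ≈ φ ⊗ φ ⊗ ψ
F1³ = ⊗-cancelˡ (F 2) (F-0 1) (begin
  F 2 ⊗ (F 1 ⊗ F 1 ⊗ F 1)
    ≈⟨ solve 2 (λ x y → y :* (x :* x :* x) := x :* x :* (x :* y)) ≈-refl (F 1) (F 2) ⟩
  F 1 ⊗ F 1 ⊗ (F 1 ⊗ F 2)
    ≈⟨ ⊗-cong (≈-sym φ⊗F2) F1⊗F2 ⟩
  φ ⊗ F 2 ⊗ (φ ⊗ ψ)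
    ≈⟨ solve 3 (λ p y s → p :* y :* (p :* s) := y :* (p :* p :* s)) ≈-refl φ (F 2) ψ ⟩
  F 2 ⊗ (φ ⊗ φ ⊗ ψ) ∎)

F2³ : F 2 ⊗ F 2 ⊗ F 2 ≈ φ₂ ⊗ φ₂ ⊗ ψ₂
F2³ = ≈-trans (≈-sym (δ2-⊗ (δ2-⊗ (δF 1 1) (δF 1 1)) (δF 1 1)))
  (≈-trans (subs-cong 1ℤ 2 F1³) (δ2-⊗ (δ2-⊗ ≈-refl ≈-refl) ≈-refl))

F3³ : F 3 ⊗ F 3 ⊗ F 3 ≈ φ₃ ⊗ φ₃ ⊗ ψ₃
F3³ = ≈-trans (≈-sym (δ3-⊗ (δ3-⊗ (δF 2 1) (δF 2 1)) (δF 2 1)))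
  (≈-trans (subs-cong 1ℤ 3 F1³) (δ3-⊗ (δ3-⊗ ≈-refl ≈-refl) ≈-refl))

-- Both sides are f₂³. After q ↦ q² it rewrites φ(-q²) ψ(q²)², which arises in the congruence modulo
-- 8, so that φ occurs only squared.
φψψ : φ ⊗ ψ ⊗ ψ ≈ φ₂ ⊗ φ₂ ⊗ ψ₂
φψψ = ≈-trans (⊗-cancelˡ (F 1) (F-0 0) (begin
  F 1 ⊗ (φ ⊗ ψ ⊗ ψ)        ≈⟨ solve 2 (λ f ps → f :* ps := ps :* f) ≈-refl (F 1) (φ ⊗ ψ ⊗ ψ) ⟩
  φ ⊗ ψ ⊗ ψ ⊗ F 1          ≈⟨ ≈-trans (⊗-assoc _ _ _) (⊗-cong (≈-sym F1⊗F2) ψ⊗F1) ⟩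
  F 1 ⊗ F 2 ⊗ (F 2 ⊗ F 2)
    ≈⟨ solve 2 (λ x y → x :* y :* (y :* y) := x :* (y :* y :* y)) ≈-refl (F 1) (F 2) ⟩
  F 1 ⊗ (F 2 ⊗ F 2 ⊗ F 2) ∎)) F2³

φ₂ψ₂ψ₂ : φ₂ ⊗ ψ₂ ⊗ ψ₂ ≈ φ₄ ⊗ φ₄ ⊗ ψ₄
φ₂ψ₂ψ₂ = ≈-trans (≈-sym (δ2-⊗ (δ2-⊗ ≈-refl ≈-refl) ≈-refl))
  (≈-trans (subs-cong 1ℤ 2 φψψ) (δ2-⊗ (δ2-⊗ ≈-refl ≈-refl) ≈-refl))

Ω⊗A : Ω ⊗ A ≈ F 3 ⊗ F 6
Ω⊗A = ⊗-cancelˡ (F 2 ⊗ F 3 ⊗ (F 1 ⊗ F 6))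
  (⊗-0 {F 2 ⊗ F 3} {F 1 ⊗ F 6} (⊗-0 {F 2} {F 3} (F-0 1) (F-0 2)) (⊗-0 {F 1} {F 6} (F-0 0) (F-0 5))) (begin
  F 2 ⊗ F 3 ⊗ (F 1 ⊗ F 6) ⊗ (Ω ⊗ A)
    ≈⟨ solve 6 (λ f₂ f₃ f₁ f₆ o a → f₂ :* f₃ :* (f₁ :* f₆) :* (o :* a) := o :* f₂ :* f₃ :* (a :* f₁ :* f₆)) ≈-refl
         (F 2) (F 3) (F 1) (F 6) Ω A ⟩
  Ω ⊗ F 2 ⊗ F 3 ⊗ (A ⊗ F 1 ⊗ F 6)
    ≈⟨ ⊗-cong Ω⊗F2⊗F3 A⊗F1⊗F6 ⟩
  F 1 ⊗ (F 6 ⊗ F 6) ⊗ (F 2 ⊗ (F 3 ⊗ F 3))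
    ≈⟨ solve 4 (λ f₁ f₆ f₂ f₃ → f₁ :* (f₆ :* f₆) :* (f₂ :* (f₃ :* f₃)) := f₂ :* f₃ :* (f₁ :* f₆) :* (f₃ :* f₆)) ≈-refl
         (F 1) (F 6) (F 2) (F 3) ⟩
  F 2 ⊗ F 3 ⊗ (F 1 ⊗ F 6) ⊗ (F 3 ⊗ F 6) ∎)

-- The quotient (φ² - 1) / 4.
H₂ : Series
H₂ = H ⊕ H ⊗ H

φ² : φ ⊗ φ ≈ 𝟙 ⊕ const (ℤ.+ 4) ⊗ H₂
φ² = ≈-trans (⊗-cong φ≈1+2H φ≈1+2H) (solve 1 (λ h →
  (con 1ℤ :+ con (ℤ.+ 2) :* h) :* (con 1ℤ :+ con (ℤ.+ 2) :* h) := con 1ℤ :+ con (ℤ.+ 4) :* (h :+ h :* h)) ≈-refl H)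

subs-1+c⊗ : ∀ s k c f → subs s (suc k) (𝟙 ⊕ const c ⊗ f) ≈ 𝟙 ⊕ const c ⊗ subs s (suc k) f
subs-1+c⊗ s k c f = ≈-trans (subs-⊕ s k _ _) (⊕-cong (subs-const s k 1ℤ)
  (≈-trans (subs-⊗ s k _ f) (⊗-cong (subs-const s k c) ≈-refl)))

φ²-δ : ∀ k f g → f ⊗ f ≈ 𝟙 ⊕ const (ℤ.+ 4) ⊗ g → δ (suc k) f ⊗ δ (suc k) f ≈ 𝟙 ⊕ const (ℤ.+ 4) ⊗ δ (suc k) g
φ²-δ k f g p = ≈-trans (≈-sym (subs-⊗ 1ℤ k f f)) (≈-trans (subs-cong 1ℤ (suc k) p) (subs-1+c⊗ 1ℤ k _ g))

-- The exponents of ψ are 0 or 1 modulo 3, so those of ψ(q²) are 0 or 2.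
sec-3-1-ψ₂ : sec 3 1 ψ₂ ≈ 𝟘
sec-3-1-ψ₂ = ≈-trans (sec-cong 3 1 (≈-trans (subs-cong 1ℤ 2 ψ-dissection) (δ2-combine₃ A ψ₃ 𝟘)))
  (≈-trans (sec-combine₃-1 _ _ _) (≈-trans (⊗-cong ≈-refl (subs-𝟘 1ℤ 2)) (≈-trans (⊗-comm _ 𝟘) (⊗-zeroˡ _))))

sec-3-2-ψ : sec 3 2 ψ ≈ 𝟘
sec-3-2-ψ = ≈-trans (sec-cong 3 2 ψ-dissection) (sec-combine₃-2 _ _ _)

-- Doubling carries residue 1 to residue 2, so this is `δ 2` of section 1 of φψ, which the
-- dissections give as φ(-q³) ψ(q³) - 2ΩA = f₃ f₆ - 2 f₃ f₆. The outcome is a series in q³, which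
-- makes a second section modulo 3 possible.
sec-3-2-φ₂ψ₂ : sec 3 2 (φ₂ ⊗ ψ₂) ≈ ⊝ δ 3 (δ 2 (F 1 ⊗ F 2))
sec-3-2-φ₂ψ₂ = begin
  sec 3 2 (φ₂ ⊗ ψ₂)
    ≈⟨ sec-cong 3 2 (≈-trans (≈-sym (subs-⊗ 1ℤ 1 φ ψ)) (≈-trans (subs-cong 1ℤ 2
         (≈-trans (⊗-cong φ-dissection ψ-dissection) (combine₃-⊗ _ _ _ _ _ _))) (δ2-combine₃ _ _ _))) ⟩
  sec 3 2 (combine₃ _ _ _)
    ≈⟨ sec-combine₃-2 _ _ _ ⟩
  δ 2 (φ₃ ⊗ ψ₃ ⊕ const (ℤ.- ℤ.+ 2) ⊗ Ω ⊗ A ⊕ X^ 1 ⊗ (𝟘 ⊗ 𝟘))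
    ≈⟨ subs-cong 1ℤ 2 (begin
         φ₃ ⊗ ψ₃ ⊕ const (ℤ.- ℤ.+ 2) ⊗ Ω ⊗ A ⊕ X^ 1 ⊗ (𝟘 ⊗ 𝟘)
           ≈⟨ ≈-trans (⊕-cong ≈-refl (≈-trans (⊗-cong ≈-refl (⊗-zeroˡ 𝟘)) (≈-trans (⊗-comm _ 𝟘) (⊗-zeroˡ _)))) (⊕-identityʳ _) ⟩
         φ₃ ⊗ ψ₃ ⊕ const (ℤ.- ℤ.+ 2) ⊗ Ω ⊗ A
           ≈⟨ ⊕-cong (≈-trans (≈-sym (subs-⊗ 1ℤ 2 φ ψ)) (≈-trans (subs-cong 1ℤ 3 (≈-sym F1⊗F2)) (δ3-⊗ (δF 2 1) (δF 2 2))))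
                (≈-trans (⊗-assoc _ _ _) (⊗-cong ≈-refl Ω⊗A)) ⟩
         F 3 ⊗ F 6 ⊕ const (ℤ.- ℤ.+ 2) ⊗ (F 3 ⊗ F 6)
           ≈⟨ solve 1 (λ x → x :+ con (ℤ.- ℤ.+ 2) :* x := :- x) ≈-refl (F 3 ⊗ F 6) ⟩
         ⊝ (F 3 ⊗ F 6)
           ≈⟨ ⊝-cong (≈-sym (δ3-⊗ (δF 2 1) (δF 2 2))) ⟩
         ⊝ δ 3 (F 1 ⊗ F 2) ∎) ⟩
  δ 2 (⊝ δ 3 (F 1 ⊗ F 2))
    ≈⟨ ≈-trans (subs-⊝ 1ℤ 1 _) (⊝-cong (δ-comm 1 2 (F 1 ⊗ F 2))) ⟩
  ⊝ δ 3 (δ 2 (F 1 ⊗ F 2)) ∎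

-- Congruences for the coefficients of 1 / ((q;q⁶)(q⁵;q⁶)(q⁴;q⁴))

module Congruences (D : Series) (D-product : D ⊗ (P⁺ 6 1 ⊗ P⁺ 6 5 ⊗ F 4) ≈ 𝟙) where

  σD : Series
  σD = σ D

  σD-product : σD ⊗ (P⁻ 6 1 ⊗ P⁻ 6 5 ⊗ F 4) ≈ 𝟙
  σD-product = begin
    σD ⊗ (P⁻ 6 1 ⊗ P⁻ 6 5 ⊗ F 4)
      ≈⟨ ⊗-cong ≈-refl (≈-sym (⊗-cong (⊗-cong (P-σ 1ℤ 6 1 refl) (P-σ 1ℤ 6 5 refl)) (P-σ 1ℤ 4 4 refl))) ⟩
    σD ⊗ (σ (P⁺ 6 1) ⊗ σ (P⁺ 6 5) ⊗ σ (F 4))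
      ≈⟨ ≈-sym (≈-trans (subs-⊗ -1ℤ 0 _ _) (⊗-cong ≈-refl (≈-trans (subs-⊗ -1ℤ 0 _ _)
           (⊗-cong (subs-⊗ -1ℤ 0 _ _) ≈-refl)))) ⟩
    σ (D ⊗ (P⁺ 6 1 ⊗ P⁺ 6 5 ⊗ F 4))
      ≈⟨ ≈-trans (subs-cong -1ℤ 1 D-product) (subs-const -1ℤ 0 1ℤ) ⟩
    𝟙 ∎

  -- (-q; q²)_∞ splits into exponents 1, 3 and 5 modulo 6. Those at 1 and 5, together with f₄, are
  -- exactly the denominator of `σD`; only (-q³; q⁶)_∞ remains.
  ψ⊗σD : ψ ⊗ σD ≈ δ 3 O
  ψ⊗σD = begin
    ψ ⊗ σD
      ≈⟨ ⊗-cong (≈-trans ψ-product (⊗-cong (split₃ -1ℤ 2 1) ≈-refl)) ≈-refl ⟩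
    P⁻ 6 1 ⊗ P⁻ 6 3 ⊗ P⁻ 6 5 ⊗ F 4 ⊗ σD
      ≈⟨ solve 5 (λ a b c f d → a :* b :* c :* f :* d := d :* (a :* c :* f) :* b) ≈-refl
           (P⁻ 6 1) (P⁻ 6 3) (P⁻ 6 5) (F 4) σD ⟩
    σD ⊗ (P⁻ 6 1 ⊗ P⁻ 6 5 ⊗ F 4) ⊗ P⁻ 6 3
      ≈⟨ ≈-trans (⊗-cong σD-product ≈-refl) (⊗-identityˡ _) ⟩
    P⁻ 6 3
      ≈⟨ ≈-sym (P-δ 2 -1ℤ 2 1) ⟩
    δ 3 O ∎

  -- (a + xb)(a² - xab + x²b²) = a³ + x³b³
  ψ-adjugate : Series
  ψ-adjugate = combine₃ (A ⊗ A) (⊝ (A ⊗ ψ₃)) (ψ₃ ⊗ ψ₃)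

  ψ⊗adjugate : δ 3 (norm ψ) ≈ ψ-adjugate ⊗ ψ
  ψ⊗adjugate = begin
    δ 3 (norm ψ)
      ≈⟨ subs-cong 1ℤ 3 (≈-trans (norm-combine₃ A ψ₃ 𝟘 ψ-dissection) (cubic-cong {A} ≈-refl ≈-refl 𝟘≈)) ⟩
    δ 3 (cubic A ψ₃ (const 0ℤ))
      ≈⟨ subs-cong 1ℤ 3 (solve 3 (λ a b x → a :* a :* a :+ x :* (b :* b :* b) :+ x :* x :* (con 0ℤ :* con 0ℤ :* con 0ℤ)
           :- con (ℤ.+ 3) :* x :* a :* b :* con 0ℤ := a :* a :* a :+ x :* (b :* b :* b)) ≈-refl A ψ₃ (X^ 1)) ⟩
    δ 3 (A ⊗ A ⊗ A ⊕ X^ 1 ⊗ (ψ₃ ⊗ ψ₃ ⊗ ψ₃))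
      ≈⟨ ≈-trans (subs-⊕ 1ℤ 2 _ _) (⊕-cong (δ3-⊗ (δ3-⊗ ≈-refl ≈-refl) ≈-refl)
           (δ3-⊗ (≈-trans (δ-mono 2 1ℤ 1) (≈-sym X³)) (δ3-⊗ (δ3-⊗ ≈-refl ≈-refl) ≈-refl))) ⟩
    δ 3 A ⊗ δ 3 A ⊗ δ 3 A ⊕ X^ 1 ⊗ (X^ 1 ⊗ X^ 1) ⊗ (δ 3 ψ₃ ⊗ δ 3 ψ₃ ⊗ δ 3 ψ₃)
      ≈⟨ solve 3 (λ a b x → a :* a :* a :+ x :* (x :* x) :* (b :* b :* b) :=
           (a :* a :+ x :* (:- (a :* b)) :+ x :* x :* (b :* b)) :* (a :+ x :* b :+ x :* x :* con 0ℤ)) ≈-refl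
           (δ 3 A) (δ 3 ψ₃) (X^ 1) ⟩
    (δ 3 A ⊗ δ 3 A ⊕ X^ 1 ⊗ ⊝ (δ 3 A ⊗ δ 3 ψ₃) ⊕ X^ 1 ⊗ X^ 1 ⊗ (δ 3 ψ₃ ⊗ δ 3 ψ₃))
      ⊗ (δ 3 A ⊕ X^ 1 ⊗ δ 3 ψ₃ ⊕ X^ 1 ⊗ X^ 1 ⊗ const 0ℤ)
      ≈⟨ ⊗-cong (≈-sym (⊕-cong (⊕-cong (δ3-⊗ ≈-refl ≈-refl)
             (⊗-cong ≈-refl (≈-trans (subs-⊝ 1ℤ 2 _) (⊝-cong (δ3-⊗ ≈-refl ≈-refl)))))
             (⊗-cong (≈-sym X²) (δ3-⊗ ≈-refl ≈-refl))))
           (⊕-cong ≈-refl (⊗-cong X² (≈-trans (≈-sym 𝟘≈) (≈-sym (subs-𝟘 1ℤ 3))))) ⟩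
    ψ-adjugate ⊗ combine₃ A ψ₃ 𝟘
      ≈⟨ ⊗-cong ≈-refl (≈-sym ψ-dissection) ⟩
    ψ-adjugate ⊗ ψ ∎
    where
    𝟘≈ : 𝟘 ≈ const 0ℤ
    𝟘≈ = pointwise λ { zero → refl ; (suc n) → refl }
    X² : X^ 1 ⊗ X^ 1 ≈ X^ 2
    X² = mono-⊗ 1ℤ 1ℤ 1 1
    X³ : X^ 1 ⊗ (X^ 1 ⊗ X^ 1) ≈ X^ 3
    X³ = ≈-trans (⊗-cong ≈-refl X²) (mono-⊗ 1ℤ 1ℤ 1 2)

  E : Series
  E = sec 3 1 σD

  -- Multiplying `σD` by the norm of ψ, taken at q³, leaves the adjugate times O(q³). Norm and O
  -- enter as series in q³, so the section only picks the middle coefficient of the adjugate.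
  norm-ψ⊗E : norm ψ ⊗ E ≈ ⊝ (O ⊗ (A ⊗ ψ₃))
  norm-ψ⊗E = begin
    norm ψ ⊗ E
      ≈⟨ ≈-sym (sec-δ⊗ 2 1 (norm ψ) σD (s<s z<s)) ⟩
    sec 3 1 (δ 3 (norm ψ) ⊗ σD)
      ≈⟨ sec-cong 3 1 (≈-trans (⊗-cong ψ⊗adjugate ≈-refl) (≈-trans (⊗-assoc _ _ _)
           (≈-trans (⊗-cong ≈-refl ψ⊗σD) (⊗-comm _ _)))) ⟩
    sec 3 1 (δ 3 O ⊗ ψ-adjugate)
      ≈⟨ sec-δ⊗ 2 1 O ψ-adjugate (s<s z<s) ⟩
    O ⊗ sec 3 1 ψ-adjugate
      ≈⟨ ⊗-cong ≈-refl (sec-combine₃-1 _ _ _) ⟩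
    O ⊗ ⊝ (A ⊗ ψ₃)
      ≈⟨ solve 2 (λ o a → o :* (:- a) := :- (o :* a)) ≈-refl O (A ⊗ ψ₃) ⟩
    ⊝ (O ⊗ (A ⊗ ψ₃)) ∎

  ψ₃⊗F3 : ψ₃ ⊗ F 3 ≈ F 6 ⊗ F 6
  ψ₃⊗F3 = ≈-trans (≈-sym (δ3-⊗ ≈-refl (δF 2 1))) (≈-trans (subs-cong 1ℤ 3 ψ⊗F1) (δ3-⊗ (δF 2 2) (δF 2 2)))

  -- The product formulas for norm ψ, O, A and ψ(q³) are inserted. The f₁² left over becomes φ f₂,
  -- so that φ is the only known factor that is not a series in q².
  E-product : F 2 ⊗ F 2 ⊗ F 2 ⊗ F 2 ⊗ F 4 ⊗ E ≈ ⊝ (F 6 ⊗ F 6 ⊗ F 6 ⊗ φ)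
  E-product = ⊗-cancelˡ M M-0 (begin
    M ⊗ (F 2 ⊗ F 2 ⊗ F 2 ⊗ F 2 ⊗ F 4 ⊗ E)
      ≈⟨ solve 4 (λ f₂ f₃ f₄ e → f₂ :* f₂ :* (f₂ :* f₂) :* (f₃ :* f₃) :* (f₂ :* f₂ :* f₂ :* f₂ :* f₄ :* e) :=
           f₂ :* (f₂ :* f₂ :* f₂) :* (f₂ :* (f₂ :* f₂ :* f₂)) :* f₃ :* (f₃ :* f₄ :* e)) ≈-refl (F 2) (F 3) (F 4) E ⟩
    F 2 ⊗ (F 2 ⊗ F 2 ⊗ F 2) ⊗ (F 2 ⊗ (F 2 ⊗ F 2 ⊗ F 2)) ⊗ F 3 ⊗ (F 3 ⊗ F 4 ⊗ E)
      ≈⟨ ⊗-cong (≈-sym norm-ψ) ≈-refl ⟩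
    norm ψ ⊗ (F 1 ⊗ (F 1 ⊗ F 1 ⊗ F 1)) ⊗ (F 6 ⊗ F 6) ⊗ (F 3 ⊗ F 4 ⊗ E)
      ≈⟨ solve 6 (λ n f₁ f₆ f₃ f₄ e → n :* (f₁ :* (f₁ :* f₁ :* f₁)) :* (f₆ :* f₆) :* (f₃ :* f₄ :* e) :=
           n :* e :* (f₁ :* f₄ :* (f₁ :* f₆) :* f₃ :* (f₁ :* f₁) :* f₆)) ≈-refl (norm ψ) (F 1) (F 6) (F 3) (F 4) E ⟩
    norm ψ ⊗ E ⊗ (F 1 ⊗ F 4 ⊗ (F 1 ⊗ F 6) ⊗ F 3 ⊗ (F 1 ⊗ F 1) ⊗ F 6)
      ≈⟨ ⊗-cong norm-ψ⊗E ≈-refl ⟩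
    ⊝ (O ⊗ (A ⊗ ψ₃)) ⊗ (F 1 ⊗ F 4 ⊗ (F 1 ⊗ F 6) ⊗ F 3 ⊗ (F 1 ⊗ F 1) ⊗ F 6)
      ≈⟨ solve 7 (λ o a p f₁ f₄ f₆ f₃ → :- (o :* (a :* p)) :* (f₁ :* f₄ :* (f₁ :* f₆) :* f₃ :* (f₁ :* f₁) :* f₆) :=
           :- (o :* f₁ :* f₄ :* (a :* f₁ :* f₆) :* (p :* f₃) :* (f₁ :* f₁) :* f₆)) ≈-refl O A ψ₃ (F 1) (F 4) (F 6) (F 3) ⟩
    ⊝ (O ⊗ F 1 ⊗ F 4 ⊗ (A ⊗ F 1 ⊗ F 6) ⊗ (ψ₃ ⊗ F 3) ⊗ (F 1 ⊗ F 1) ⊗ F 6)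
      ≈⟨ ⊝-cong (⊗-cong (⊗-cong (⊗-cong (⊗-cong O⊗F1⊗F4 A⊗F1⊗F6) ψ₃⊗F3) (≈-sym φ⊗F2)) ≈-refl) ⟩
    ⊝ (F 2 ⊗ F 2 ⊗ (F 2 ⊗ (F 3 ⊗ F 3)) ⊗ (F 6 ⊗ F 6) ⊗ (φ ⊗ F 2) ⊗ F 6)
      ≈⟨ solve 4 (λ f₂ f₃ f₆ p → :- (f₂ :* f₂ :* (f₂ :* (f₃ :* f₃)) :* (f₆ :* f₆) :* (p :* f₂) :* f₆) :=
           f₂ :* f₂ :* (f₂ :* f₂) :* (f₃ :* f₃) :* (:- (f₆ :* f₆ :* f₆ :* p))) ≈-refl (F 2) (F 3) (F 6) φ ⟩
    M ⊗ ⊝ (F 6 ⊗ F 6 ⊗ F 6 ⊗ φ) ∎)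
    where
    -- f₂⁴ f₃², the factor shared by both sides once all denominators are multiplied out.
    M : Series
    M = F 2 ⊗ F 2 ⊗ (F 2 ⊗ F 2) ⊗ (F 3 ⊗ F 3)
    F2² : (F 2 ⊗ F 2) 0 ≡ 1ℤ
    F2² = ⊗-0 {F 2} {F 2} (F-0 1) (F-0 1)
    M-0 : M 0 ≡ 1ℤ
    M-0 = ⊗-0 {F 2 ⊗ F 2 ⊗ (F 2 ⊗ F 2)} {F 3 ⊗ F 3} (⊗-0 {F 2 ⊗ F 2} {F 2 ⊗ F 2} F2² F2²) (⊗-0 {F 3} {F 3} (F-0 2) (F-0 2))

  G : Series
  G = sec 2 1 E

  G-product : F 1 ⊗ F 1 ⊗ F 1 ⊗ F 1 ⊗ F 2 ⊗ G ≈ F 3 ⊗ F 3 ⊗ F 3 ⊗ (const (ℤ.+ 2) ⊗ ψ₄)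
  G-product = begin
    F 1 ⊗ F 1 ⊗ F 1 ⊗ F 1 ⊗ F 2 ⊗ G
      ≈⟨ ≈-sym (sec-δ⊗ 1 1 _ E (s<s z<s)) ⟩
    sec 2 1 (δ 2 (F 1 ⊗ F 1 ⊗ F 1 ⊗ F 1 ⊗ F 2) ⊗ E)
      ≈⟨ sec-cong 2 1 (begin
           δ 2 (F 1 ⊗ F 1 ⊗ F 1 ⊗ F 1 ⊗ F 2) ⊗ E
             ≈⟨ ⊗-cong (δ2-⊗ (δ2-⊗ (δ2-⊗ (δ2-⊗ (δF 1 1) (δF 1 1)) (δF 1 1)) (δF 1 1)) (δF 1 2)) ≈-refl ⟩
           F 2 ⊗ F 2 ⊗ F 2 ⊗ F 2 ⊗ F 4 ⊗ E
             ≈⟨ E-product ⟩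
           ⊝ (F 6 ⊗ F 6 ⊗ F 6 ⊗ φ)
             ≈⟨ ⊝-cong (⊗-cong (≈-sym (δ2-⊗ (δ2-⊗ (δF 1 3) (δF 1 3)) (δF 1 3))) ≈-refl) ⟩
           ⊝ (δ 2 (F 3 ⊗ F 3 ⊗ F 3) ⊗ φ) ∎) ⟩
    sec 2 1 (⊝ (δ 2 (F 3 ⊗ F 3 ⊗ F 3) ⊗ φ))
      ≈⟨ ≈-trans (sec-⊝ 2 1 _) (⊝-cong (sec-δ⊗ 1 1 _ φ (s<s z<s))) ⟩
    ⊝ (F 3 ⊗ F 3 ⊗ F 3 ⊗ sec 2 1 φ)
      ≈⟨ ⊝-cong (⊗-cong ≈-refl sec-2-1-φ) ⟩
    ⊝ (F 3 ⊗ F 3 ⊗ F 3 ⊗ (const (ℤ.- ℤ.+ 2) ⊗ ψ₄))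
      ≈⟨ solve 2 (λ f p → :- (f :* (con (ℤ.- ℤ.+ 2) :* p)) := f :* (con (ℤ.+ 2) :* p)) ≈-refl (F 3 ⊗ F 3 ⊗ F 3) ψ₄ ⟩
    F 3 ⊗ F 3 ⊗ F 3 ⊗ (const (ℤ.+ 2) ⊗ ψ₄) ∎

  -- f₁⁴ f₂ = φ² f₂³ = φ² φ(-q²)² ψ(q²), and f₃³ is treated likewise: φ now occurs only in squares,
  -- each congruent to 1 modulo 4.
  G-theta : φ ⊗ φ ⊗ (φ₂ ⊗ φ₂) ⊗ ψ₂ ⊗ G ≈ const (ℤ.+ 2) ⊗ (φ₃ ⊗ φ₃) ⊗ ψ₃ ⊗ ψ₄
  G-theta = begin
    φ ⊗ φ ⊗ (φ₂ ⊗ φ₂) ⊗ ψ₂ ⊗ G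
      ≈⟨ ⊗-cong (≈-trans (⊗-assoc _ _ _) (⊗-cong ≈-refl (≈-sym F2³))) ≈-refl ⟩
    φ ⊗ φ ⊗ (F 2 ⊗ F 2 ⊗ F 2) ⊗ G
      ≈⟨ solve 3 (λ p f g → p :* p :* (f :* f :* f) :* g := p :* f :* (p :* f) :* f :* g) ≈-refl φ (F 2) G ⟩
    φ ⊗ F 2 ⊗ (φ ⊗ F 2) ⊗ F 2 ⊗ G
      ≈⟨ ⊗-cong (⊗-cong (⊗-cong φ⊗F2 φ⊗F2) ≈-refl) ≈-refl ⟩
    F 1 ⊗ F 1 ⊗ (F 1 ⊗ F 1) ⊗ F 2 ⊗ G
      ≈⟨ ⊗-cong (⊗-cong (≈-sym (⊗-assoc _ _ _)) ≈-refl) ≈-refl ⟩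
    F 1 ⊗ F 1 ⊗ F 1 ⊗ F 1 ⊗ F 2 ⊗ G
      ≈⟨ G-product ⟩
    F 3 ⊗ F 3 ⊗ F 3 ⊗ (const (ℤ.+ 2) ⊗ ψ₄)
      ≈⟨ ⊗-cong F3³ ≈-refl ⟩
    φ₃ ⊗ φ₃ ⊗ ψ₃ ⊗ (const (ℤ.+ 2) ⊗ ψ₄)
      ≈⟨ solve 3 (λ p s t → p :* s :* (con (ℤ.+ 2) :* t) := con (ℤ.+ 2) :* p :* s :* t) ≈-refl (φ₃ ⊗ φ₃) ψ₃ ψ₄ ⟩
    const (ℤ.+ 2) ⊗ (φ₃ ⊗ φ₃) ⊗ ψ₃ ⊗ ψ₄ ∎

  Z : Series
  Z = φ₂ ⊗ ψ₂ ⊗ ψ₃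

  -- Multiplied by V, both G and 2Z become 2 ψ(q³) ψ(q⁴) times squares of φ: φ(-q³)² for G, and
  -- φ(-q)² φ(-q²)² φ(-q⁴)² for 2Z. These agree modulo 4, the factor 2 raises this to 8, and V has
  -- constant term 1.
  G≡2Z-mod8 : ∀ n → ℤ.+ 8 ℤ.∣ (G ⊖ const (ℤ.+ 2) ⊗ Z) n
  G≡2Z-mod8 n = ⊗-cancel-∣ {N = suc n} V (G ⊖ const (ℤ.+ 2) ⊗ Z) V-0
    (λ k _ → subst (ℤ.+ 8 ℤ.∣_) (sym (trans (coeff difference k) (const-⊗ (ℤ.+ 8) _ k))) (ℤ.∣m⇒∣m*n _ (ℤ.∣-refl {ℤ.+ 8}))) n ℕ.≤-refl
    where
    V : Series
    V = φ ⊗ φ ⊗ (φ₂ ⊗ φ₂) ⊗ ψ₂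
    V-0 : V 0 ≡ 1ℤ
    V-0 = ⊗-0 {φ ⊗ φ ⊗ (φ₂ ⊗ φ₂)} {ψ₂} (⊗-0 {φ ⊗ φ} {φ₂ ⊗ φ₂} (⊗-0 {φ} {φ} φ-0 φ-0) (⊗-0 {φ₂} {φ₂} φ-0 φ-0)) ψ-0
    s₁ s₂ s₃ s₄ : Series
    s₁ = H₂
    s₂ = δ 2 H₂
    s₃ = δ 3 H₂
    s₄ = δ 2 s₂
    φ₂² : φ₂ ⊗ φ₂ ≈ 𝟙 ⊕ const (ℤ.+ 4) ⊗ s₂
    φ₂² = φ²-δ 1 φ H₂ φ²
    -- A quarter of φ(-q³)² - φ(-q)² φ(-q²)² φ(-q⁴)².
    R : Series
    R = s₃ ⊖ (s₁ ⊕ s₂ ⊕ s₄ ⊕ const (ℤ.+ 4) ⊗ (s₁ ⊗ s₂ ⊕ s₁ ⊗ s₄ ⊕ s₂ ⊗ s₄) ⊕ const (ℤ.+ 16) ⊗ s₁ ⊗ s₂ ⊗ s₄)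
    difference : V ⊗ (G ⊖ const (ℤ.+ 2) ⊗ Z) ≈ const (ℤ.+ 8) ⊗ (ψ₃ ⊗ ψ₄ ⊗ R)
    difference = begin
      V ⊗ (G ⊖ const (ℤ.+ 2) ⊗ Z)
        ≈⟨ solve 6 (λ v w p₂ t₂ t₃ g → v :* w :* t₂ :* (g :- con (ℤ.+ 2) :* (p₂ :* t₂ :* t₃)) :=
             v :* w :* t₂ :* g :- con (ℤ.+ 2) :* v :* w :* (p₂ :* t₂ :* t₂) :* t₃) ≈-refl (φ ⊗ φ) (φ₂ ⊗ φ₂) φ₂ ψ₂ ψ₃ G ⟩
      V ⊗ G ⊖ const (ℤ.+ 2) ⊗ (φ ⊗ φ) ⊗ (φ₂ ⊗ φ₂) ⊗ (φ₂ ⊗ ψ₂ ⊗ ψ₂) ⊗ ψ₃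
        ≈⟨ ⊕-cong G-theta (⊝-cong (⊗-cong (⊗-cong ≈-refl φ₂ψ₂ψ₂) ≈-refl)) ⟩
      const (ℤ.+ 2) ⊗ (φ₃ ⊗ φ₃) ⊗ ψ₃ ⊗ ψ₄ ⊖ const (ℤ.+ 2) ⊗ (φ ⊗ φ) ⊗ (φ₂ ⊗ φ₂) ⊗ (φ₄ ⊗ φ₄ ⊗ ψ₄) ⊗ ψ₃
        ≈⟨ ⊕-cong (⊗-cong (⊗-cong (⊗-cong ≈-refl (φ²-δ 2 φ H₂ φ²)) ≈-refl) ≈-refl)
             (⊝-cong (⊗-cong (⊗-cong (⊗-cong (⊗-cong ≈-refl φ²) φ₂²) (⊗-cong (φ²-δ 1 φ₂ s₂ φ₂²) ≈-refl)) ≈-refl)) ⟩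
      const (ℤ.+ 2) ⊗ (𝟙 ⊕ const (ℤ.+ 4) ⊗ s₃) ⊗ ψ₃ ⊗ ψ₄
        ⊖ const (ℤ.+ 2) ⊗ (𝟙 ⊕ const (ℤ.+ 4) ⊗ s₁) ⊗ (𝟙 ⊕ const (ℤ.+ 4) ⊗ s₂) ⊗ ((𝟙 ⊕ const (ℤ.+ 4) ⊗ s₄) ⊗ ψ₄) ⊗ ψ₃
        ≈⟨ solve 6 (λ s₁ s₂ s₃ s₄ t₃ t₄ → let 1+4 = λ s → con 1ℤ :+ con (ℤ.+ 4) :* s in
             con (ℤ.+ 2) :* 1+4 s₃ :* t₃ :* t₄ :- con (ℤ.+ 2) :* 1+4 s₁ :* 1+4 s₂ :* (1+4 s₄ :* t₄) :* t₃ :=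
             con (ℤ.+ 8) :* (t₃ :* t₄ :* (s₃ :- (s₁ :+ s₂ :+ s₄ :+ con (ℤ.+ 4) :* (s₁ :* s₂ :+ s₁ :* s₄ :+ s₂ :* s₄)
               :+ con (ℤ.+ 16) :* s₁ :* s₂ :* s₄)))) ≈-refl s₁ s₂ s₃ s₄ ψ₃ ψ₄ ⟩
      const (ℤ.+ 8) ⊗ (ψ₃ ⊗ ψ₄ ⊗ R) ∎

  G-∣ : ∀ d n → d ℤ.∣ ℤ.+ 8 → d ℤ.∣ ℤ.+ 2 ℤ.* Z n → d ℤ.∣ G n
  G-∣ d n d∣8 d∣2Z = ℤ.∣m+n∣n⇒∣m {m = G n} {ℤ.- (ℤ.+ 2 ℤ.* Z n)}
    (subst (d ℤ.∣_) value (ℤ.∣-trans d∣8 (G≡2Z-mod8 n))) (ℤ.∣m⇒∣-m {m = ℤ.+ 2 ℤ.* Z n} d∣2Z)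
    where
    value : (G ⊖ const (ℤ.+ 2) ⊗ Z) n ≡ G n ℤ.- ℤ.+ 2 ℤ.* Z n
    value = trans (⊕-coeff G _ n) (cong (λ z → G n ℤ.+ z)
      (trans (⊝-coeff (const (ℤ.+ 2) ⊗ Z) n) (cong ℤ.-_ (const-⊗ (ℤ.+ 2) Z n))))

  -- In φ(-q²) = 1 + 2 H(q²) the term 1 contributes ψ(q²) ψ(q³), whose section vanishes: ψ(q³) moves
  -- out and ψ(q²) has no exponent 1 modulo 3.
  sec-3-1-Z : sec 3 1 Z ≈ const (ℤ.+ 2) ⊗ sec 3 1 (δ 2 H ⊗ ψ₂ ⊗ ψ₃)
  sec-3-1-Z = begin
    sec 3 1 Z
      ≈⟨ sec-cong 3 1 (≈-trans (⊗-cong (⊗-cong (≈-trans (subs-cong 1ℤ 2 φ≈1+2H) (subs-1+c⊗ 1ℤ 1 (ℤ.+ 2) H)) ≈-refl) ≈-refl)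
           (solve 3 (λ h a b → (con 1ℤ :+ con (ℤ.+ 2) :* h) :* a :* b := b :* a :+ con (ℤ.+ 2) :* (h :* a :* b)) ≈-refl
             (δ 2 H) ψ₂ ψ₃)) ⟩
    sec 3 1 (ψ₃ ⊗ ψ₂ ⊕ const (ℤ.+ 2) ⊗ (δ 2 H ⊗ ψ₂ ⊗ ψ₃))
      ≈⟨ ≈-trans (sec-⊕ 3 1 _ _) (⊕-cong (sec-δ⊗ 2 1 ψ ψ₂ (s<s z<s)) (sec-const⊗ 3 1 (ℤ.+ 2) _)) ⟩
    ψ ⊗ sec 3 1 ψ₂ ⊕ const (ℤ.+ 2) ⊗ sec 3 1 (δ 2 H ⊗ ψ₂ ⊗ ψ₃)
      ≈⟨ ⊕-cong (≈-trans (⊗-cong ≈-refl sec-3-1-ψ₂) (≈-trans (⊗-comm ψ 𝟘) (⊗-zeroˡ ψ))) ≈-refl ⟩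
    𝟘 ⊕ const (ℤ.+ 2) ⊗ sec 3 1 (δ 2 H ⊗ ψ₂ ⊗ ψ₃)
      ≈⟨ ⊕-identityˡ _ ⟩
    const (ℤ.+ 2) ⊗ sec 3 1 (δ 2 H ⊗ ψ₂ ⊗ ψ₃) ∎

  -- The first section is -ψ times a series in q³. That series moves out of the second section, and
  -- ψ has no exponent 2 modulo 3.
  sec-9-8-Z : sec 3 2 (sec 3 2 Z) ≈ 𝟘
  sec-9-8-Z = begin
    sec 3 2 (sec 3 2 Z)
      ≈⟨ sec-cong 3 2 (begin
           sec 3 2 (φ₂ ⊗ ψ₂ ⊗ ψ₃)
             ≈⟨ sec-cong 3 2 (⊗-comm _ _) ⟩
           sec 3 2 (ψ₃ ⊗ (φ₂ ⊗ ψ₂))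
             ≈⟨ sec-δ⊗ 2 2 ψ _ (s<s (s<s z<s)) ⟩
           ψ ⊗ sec 3 2 (φ₂ ⊗ ψ₂)
             ≈⟨ ⊗-cong ≈-refl sec-3-2-φ₂ψ₂ ⟩
           ψ ⊗ ⊝ δ 3 (δ 2 (F 1 ⊗ F 2))
             ≈⟨ solve 2 (λ p f → p :* (:- f) := f :* (:- p)) ≈-refl ψ (δ 3 (δ 2 (F 1 ⊗ F 2))) ⟩
           δ 3 (δ 2 (F 1 ⊗ F 2)) ⊗ ⊝ ψ ∎) ⟩
    sec 3 2 (δ 3 (δ 2 (F 1 ⊗ F 2)) ⊗ ⊝ ψ)
      ≈⟨ sec-δ⊗ 2 2 _ (⊝ ψ) (s<s (s<s z<s)) ⟩
    δ 2 (F 1 ⊗ F 2) ⊗ sec 3 2 (⊝ ψ)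
      ≈⟨ ⊗-cong ≈-refl (≈-trans (sec-⊝ 3 2 ψ) (≈-trans (⊝-cong sec-3-2-ψ) (pointwise (⊝-coeff 𝟘)))) ⟩
    δ 2 (F 1 ⊗ F 2) ⊗ 𝟘
      ≈⟨ ≈-trans (⊗-comm _ 𝟘) (⊗-zeroˡ _) ⟩
    𝟘 ∎

  D≡G : ∀ n → D (6 * n + 4) ≡ G n
  D≡G n = sym (trans (σ-coeff D ((n * 2 + 1) * 3 + 1)) (trans
    (cong₂ (λ s k → s ℤ.* D k) (sign n) (index n)) (ℤ.*-identityˡ _)))
    where
    index : ∀ n → (n * 2 + 1) * 3 + 1 ≡ 6 * n + 4
    index = ℕ.solve-∀
    double : ∀ n → (n * 2 + 1) * 3 + 1 ≡ 2 * (3 * n + 2)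
    double = ℕ.solve-∀
    sign : ∀ n → -1ℤ ℤ.^ ((n * 2 + 1) * 3 + 1) ≡ 1ℤ
    sign n = trans (cong (-1ℤ ℤ.^_) (double n)) (trans (sym (ℤ.^-*-assoc -1ℤ 2 (3 * n + 2))) (ℤ.^-zeroˡ (3 * n + 2)))

  2∣D : ∀ n → ℤ.+ 2 ℤ.∣ D (6 * n + 4)
  2∣D n = subst (ℤ.+ 2 ℤ.∣_) (sym (D≡G n))
    (G-∣ (ℤ.+ 2) n (ℤ.divides (ℤ.+ 4) refl) (ℤ.∣m⇒∣m*n (Z n) ℤ.∣-refl))

  4∣D : ∀ n → ℤ.+ 4 ℤ.∣ D (18 * n + 10)
  4∣D n = subst (λ k → ℤ.+ 4 ℤ.∣ D k) (index n) (subst (ℤ.+ 4 ℤ.∣_) (sym (D≡G (n * 3 + 1)))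
    (G-∣ (ℤ.+ 4) (n * 3 + 1) (ℤ.divides (ℤ.+ 2) refl)
      (subst (λ z → ℤ.+ 4 ℤ.∣ ℤ.+ 2 ℤ.* z) (sym (trans (coeff sec-3-1-Z n) (const-⊗ (ℤ.+ 2) _ n)))
        (subst (ℤ.+ 4 ℤ.∣_) (ℤ.*-assoc (ℤ.+ 2) (ℤ.+ 2) _) (ℤ.∣m⇒∣m*n _ (ℤ.∣-refl {ℤ.+ 4}))))))
    where
    index : ∀ n → 6 * (n * 3 + 1) + 4 ≡ 18 * n + 10
    index = ℕ.solve-∀

  8∣D : ∀ n → ℤ.+ 8 ℤ.∣ D (54 * n + 52)
  8∣D n = subst (λ k → ℤ.+ 8 ℤ.∣ D k) (index n) (subst (ℤ.+ 8 ℤ.∣_) (sym (D≡G m))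
    (G-∣ (ℤ.+ 8) m ℤ.∣-refl (subst (λ z → ℤ.+ 8 ℤ.∣ ℤ.+ 2 ℤ.* z) (sym (coeff sec-9-8-Z n)) (ℤ.divides 0ℤ refl))))
    where
    -- Residue 2 modulo 3 taken twice, that is m = 9n + 8.
    m : ℕ
    m = (n * 3 + 2) * 3 + 2
    index : ∀ n → 6 * ((n * 3 + 2) * 3 + 2) + 4 ≡ 54 * n + 52
    index = ℕ.solve-∀

-- The generating function of dp

unique∧⇔⇒length≡ : ∀ {xs ys : List (List ℕ)} → Unique xs → Unique ys →
                   (∀ {ps} → ps ∈ xs ⇔ ps ∈ ys) → length xs ≡ length ys
unique∧⇔⇒length≡ xs! ys! xs∼ys = ↭-length (∼bag⇒↭ (unique∧set⇒bag xs! ys! xs∼ys))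

-- The bound m on the parts is the parameter along which the product is built up, one factor at a
-- time.
IsRestricted : ℕ → ℕ → List ℕ → Set
IsRestricted m n ps = IsDP n ps × All (_≤ m) ps

opaque
  restricted : ℕ → ℕ → List (List ℕ)
  restricted m n = filter (all? (_≤? m)) (dpPartitions n)

  ∈-restricted : ∀ {m n ps} → ps ∈ restricted m n ⇔ IsRestricted m n ps
  ∈-restricted {m} {n} {ps} = mk⇔
    (λ ps∈ → let ps∈dp , ps≤m = ∈-filter⁻ (all? (_≤? m)) {xs = dpPartitions n} ps∈ in
      Equivalence.to (∈-dpPartitions n ps) ps∈dp , ps≤m)
    (λ { (dp-ps , ps≤m) → ∈-filter⁺ (all? (_≤? m)) (Equivalence.from (∈-dpPartitions n ps) dp-ps) ps≤m })

  restricted-unique : ∀ m n → Unique (restricted m n)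
  restricted-unique m n = filter⁺ (all? (_≤? m)) (dpPartitions-unique n)

  length-restricted-0-0 : length (restricted 0 0) ≡ 1
  length-restricted-0-0 = refl

head-largest : ∀ {p ps} → Linked _≥_ (p ∷ ps) → All (_≤ p) ps
head-largest L with Linked⇒AllPairs (λ x≥y y≥z → ℕ.≤-trans y≥z x≥y) L
... | p≥ps ∷ _ = p≥ps

∷-linked : ∀ {p ps} → All (_≤ p) ps → Linked _≥_ ps → Linked _≥_ (p ∷ ps)
∷-linked []        []  = [-]
∷-linked (p≥q ∷ _) L   = p≥q ∷ L

IsDP-∷⁻ : ∀ {n p ps} → IsDP (p + n) (p ∷ ps) → AllowedPart p × IsRestricted p n ps
IsDP-∷⁻ {n} {p} ((L , _ ∷ ps>0 , sum≡) , a ∷ as) =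
  a , ((Linked.tail L , ps>0 , ℕ.+-cancelˡ-≡ p _ n sum≡) , as) , head-largest L

IsDP-∷⁺ : ∀ {n m ps} → AllowedPart (suc m) → IsRestricted (suc m) n ps → IsDP (suc m + n) (suc m ∷ ps)
IsDP-∷⁺ a (((L , ps>0 , refl) , as) , ps≤) = (∷-linked ps≤ L , z<s ∷ ps>0 , refl) , a ∷ as

-- The head is the largest part: either it is at most m and bounds all parts, or it equals m + 1.
restricted-suc : ∀ {m n ps} → IsRestricted (suc m) n ps → IsRestricted m n ps ⊎ ∃ λ qs → ps ≡ suc m ∷ qs
restricted-suc (d , []) = inj₁ (d , [])
restricted-suc (d@((L , _) , _) , p≤1+m ∷ _) with ℕ.m≤n⇒m<n∨m≡n p≤1+m
... | inj₁ (s≤s p≤m) = inj₁ (d , p≤m ∷ All.map (λ q≤p → ℕ.≤-trans q≤p p≤m) (head-largest L))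
... | inj₂ refl      = inj₂ (_ , refl)

weaken : ∀ {m n ps} → IsRestricted m n ps → IsRestricted (suc m) n ps
weaken (d , ps≤m) = d , All.map ℕ.m≤n⇒m≤1+n ps≤m

count : ℕ → Series
count m n = ℤ.+ length (restricted m n)

count-same : ∀ {m n} → (∀ qs → ¬ IsDP n (suc m ∷ qs)) → count (suc m) n ≡ count m n
count-same {m} {n} absent = cong ℤ.+_ (unique∧⇔⇒length≡ (restricted-unique (suc m) n) (restricted-unique m n)
  (mk⇔ (λ ps∈ → Equivalence.from ∈-restricted (smaller (Equivalence.to ∈-restricted ps∈)))
       (λ ps∈ → Equivalence.from ∈-restricted (weaken (Equivalence.to ∈-restricted ps∈)))))
  where
  smaller : ∀ {ps} → IsRestricted (suc m) n ps → IsRestricted m n ps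
  smaller r with restricted-suc {m} r
  ... | inj₁ r′          = r′
  ... | inj₂ (qs , refl) = ⊥-elim (absent qs (proj₁ r))

-- A partition that contains m + 1 has it as head, and the head is removed. The rest may contain m +
-- 1 again, hence `count (suc m)` in the last summand.
count-new : ∀ m k → AllowedPart (suc m) → count (suc m) (suc m + k) ≡ count m (suc m + k) ℤ.+ count (suc m) k
count-new m k a = trans
  (cong ℤ.+_ (trans (unique∧⇔⇒length≡ (restricted-unique (suc m) (suc m + k)) new-unique (mk⇔ to from))
    (trans (length-++ old) (cong (length old +_) (length-map (suc m ∷_) (restricted (suc m) k))))))
  (ℤ.pos-+ (length old) _)
  where
  old new : List (List ℕ)
  old = restricted m (suc m + k)
  new = old ++ map (suc m ∷_) (restricted (suc m) k)
  new-unique : Unique new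
  new-unique = ++⁺ (restricted-unique m (suc m + k)) (map⁺ ∷-injectiveʳ (restricted-unique (suc m) k)) disjoint
    where
    disjoint : ∀ {ps} → ¬ (ps ∈ old × ps ∈ map (suc m ∷_) (restricted (suc m) k))
    disjoint (ps∈old , ps∈map) with ∈-map⁻ (suc m ∷_) ps∈map
    ... | _ , _ , refl with Equivalence.to ∈-restricted ps∈old
    ... | _ , 1+m≤m ∷ _ = ℕ.1+n≰n 1+m≤m
  to : ∀ {ps} → ps ∈ restricted (suc m) (suc m + k) → ps ∈ new
  to ps∈ with restricted-suc {m} (Equivalence.to ∈-restricted ps∈)
  ... | inj₁ r           = ∈-++⁺ˡ (Equivalence.from ∈-restricted r)
  ... | inj₂ (qs , refl) = ∈-++⁺ʳ old (∈-map⁺ (suc m ∷_)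
    (Equivalence.from ∈-restricted (proj₂ (IsDP-∷⁻ (proj₁ (Equivalence.to ∈-restricted ps∈))))))
  from : ∀ {ps} → ps ∈ new → ps ∈ restricted (suc m) (suc m + k)
  from ps∈ with ∈-++⁻ old ps∈
  ... | inj₁ ps∈old = Equivalence.from ∈-restricted (weaken (Equivalence.to ∈-restricted ps∈old))
  ... | inj₂ ps∈map with ∈-map⁻ (suc m ∷_) ps∈map
  ...   | qs , qs∈ , refl = let r = Equivalence.to ∈-restricted qs∈ in
    Equivalence.from ∈-restricted (IsDP-∷⁺ a r , ℕ.≤-refl ∷ proj₂ r)

IsDP-∷-≤ : ∀ {n p qs} → IsDP n (p ∷ qs) → p ≤ n
IsDP-∷-≤ {p = p} {qs} ((_ , _ , refl) , _) = ℕ.m≤m+n p (sum qs)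

count-allowed : ∀ m → AllowedPart (suc m) → count (suc m) ≈ count m ⊕ X^ (suc m) ⊗ count (suc m)
count-allowed m a = pointwise λ n → trans (coefficient n (n ℕ.<? suc m)) (sym (⊕-coeff (count m) _ n))
  where
  coefficient : ∀ n → Dec (n < suc m) → count (suc m) n ≡ count m n ℤ.+ (X^ (suc m) ⊗ count (suc m)) n
  coefficient n (yes n<1+m) = trans (count-same λ qs d → ℕ.<⇒≱ n<1+m (IsDP-∷-≤ d))
    (sym (trans (cong (λ x → count m n ℤ.+ x) (mono-⊗-coeff-< 1ℤ (suc m) (count (suc m)) n<1+m)) (ℤ.+-identityʳ _)))
  coefficient n (no n≮1+m) = subst (λ n → count (suc m) n ≡ count m n ℤ.+ (X^ (suc m) ⊗ count (suc m)) n)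
    (ℕ.m+[n∸m]≡n (ℕ.≮⇒≥ n≮1+m))
    (trans (count-new m k a) (cong (λ x → count m (suc m + k) ℤ.+ x)
      (sym (trans (mono-⊗-coeff-+ 1ℤ (suc m) (count (suc m)) k) (ℤ.*-identityˡ _)))))
    where
    k : ℕ
    k = n ∸ suc m

count-forbidden : ∀ m → ¬ AllowedPart (suc m) → count (suc m) ≈ count m
count-forbidden m ¬a = pointwise λ n → count-same λ { _ (_ , a ∷ _) → ¬a a }

count-0 : count 0 ≈ 𝟙
count-0 = pointwise λ
  { zero    → cong ℤ.+_ length-restricted-0-0
  ; (suc n) → cong ℤ.+_ (unique∧⇔⇒length≡ (restricted-unique 0 (suc n)) []
      (mk⇔ (λ ps∈ → ⊥-elim (none (Equivalence.to ∈-restricted ps∈))) λ ())) }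
  where
  none : ∀ {n ps} → ¬ IsRestricted 0 (suc n) ps
  none (((_ , [] , ()) , _) , [])
  none (((_ , p>0 ∷ _ , _) , _) , p≤0 ∷ _) = ℕ.<⇒≱ p>0 p≤0

D : Series
D n = ℤ.+ dp n

-- Parts of a partition of n are at most n, so the bound m excludes nothing when n < m.
count-⟶ : count ⟶ D
count-⟶ m = below λ n n<m → cong ℤ.+_ (unique∧⇔⇒length≡ (restricted-unique m n) (dpPartitions-unique n)
  (λ {ps} → mk⇔ (λ ps∈ → Equivalence.from (∈-dpPartitions n ps) (proj₁ (Equivalence.to ∈-restricted ps∈)))
    (λ ps∈ → let d = Equivalence.to (∈-dpPartitions n ps) ps∈ in Equivalence.from ∈-restricted
      (d , All.map (λ p≤n → ℕ.≤-trans p≤n (ℕ.<⇒≤ n<m)) (parts≤ d)))))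
  where
  parts≤ : ∀ {n ps} → IsDP n ps → All (_≤ n) ps
  parts≤ {ps = []}    _ = []
  parts≤ {ps = p ∷ _} d@((L , _) , _) =
    IsDP-∷-≤ d ∷ All.map (λ q≤p → ℕ.≤-trans q≤p (IsDP-∷-≤ d)) (head-largest L)

-- Takes a Boolean and not a decision, so that periodicity only has to compare truth values of
-- admissibility.
weight : Bool → ℕ → Series
weight b k = if b then fac 1ℤ k else 𝟙

partFactor : ℕ → Series
partFactor i = weight (does (allowedPart? (suc i))) (suc i)

count⊗∏ : ∀ m → count m ⊗ ∏ partFactor m ≈ 𝟙
count⊗∏ zero    = ≈-trans (⊗-identityʳ _) count-0
count⊗∏ (suc m) = ≈-trans (step (allowedPart? (suc m))) (count⊗∏ m)
  where
  step : (a? : Dec (AllowedPart (suc m))) →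
         count (suc m) ⊗ (∏ partFactor m ⊗ weight (does a?) (suc m)) ≈ count m ⊗ ∏ partFactor m
  step (yes a) = begin
    count (suc m) ⊗ (∏ partFactor m ⊗ (𝟙 ⊖ X^ (suc m)))
      ≈⟨ solve 3 (λ c p x → c :* (p :* (con 1ℤ :- x)) := (c :- x :* c) :* p) ≈-refl
           (count (suc m)) (∏ partFactor m) (X^ (suc m)) ⟩
    (count (suc m) ⊖ X^ (suc m) ⊗ count (suc m)) ⊗ ∏ partFactor m
      ≈⟨ ⊗-cong (⊕-cong (count-allowed m a) ≈-refl) ≈-refl ⟩
    (count m ⊕ X^ (suc m) ⊗ count (suc m) ⊖ X^ (suc m) ⊗ count (suc m)) ⊗ ∏ partFactor m
      ≈⟨ ⊗-cong (solve 2 (λ a b → a :+ b :- b := a) ≈-refl (count m) (X^ (suc m) ⊗ count (suc m))) ≈-refl ⟩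
    count m ⊗ ∏ partFactor m ∎
  step (no ¬a) = ⊗-cong (count-forbidden m ¬a) (⊗-identityʳ _)

-- 12 is the least common multiple of the moduli 4 and 6.
allowed-periodic : ∀ i p → AllowedPart (i * 12 + p) ⇔ AllowedPart p
allowed-periodic i p = mk⇔
  (Sum.map (λ 4∣ → ∣m+n∣m⇒∣n 4∣ 4∣12i) (Sum.map (trans (sym mod-6)) (trans (sym mod-6))))
  (Sum.map (∣m∣n⇒∣m+n 4∣12i) (Sum.map (trans mod-6) (trans mod-6)))
  where
  4∣12i : 4 ∣ i * 12
  4∣12i = divides (i * 3) (sym (ℕ.*-assoc i 3 4))
  mod-6 : (i * 12 + p) % 6 ≡ p % 6
  mod-6 = trans (cong (_% 6) (trans (ℕ.+-comm (i * 12) p) (cong (p +_) (sym (ℕ.*-assoc i 2 6)))))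
    ([m+kn]%n≡m%n p (i * 2) 6)

D-product : D ⊗ (P⁺ 6 1 ⊗ P⁺ 6 5 ⊗ F 4) ≈ 𝟙
D-product = ⟶-unique
  -- Twelve consecutive integers contain two terms of each progression modulo 6 and three multiples
  -- of 4; hence the lengths 2m, 2m and 3m against 12m.
  (⟶-⊗ (⟶-subsequence (_* 12) (m≤m*k 12) count-⟶)
    (⟶-⊗ (⟶-⊗ (progression 2 6 1) (progression 2 6 5)) (progression 3 4 4)))
  λ m → ≈⇒≡[] (≈-trans (⊗-cong ≈-refl (≈-sym (regroup m))) (count⊗∏ (m * 12)))
  where
  progression : ∀ k c a .{{_ : ℕ.NonZero k}} .{{_ : ℕ.NonZero c}} →
                (λ m → ∏ (λ i → fac 1ℤ (i * c + a)) (m * k)) ⟶ P⁺ c a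
  progression k c a = ⟶-subsequence (_* k) (m≤m*k k) (P-⟶ 1ℤ c a)
  partFactor-periodic : ∀ i r → partFactor (i * 12 + r) ≈ weight (does (allowedPart? (suc r))) (i * 12 + suc r)
  partFactor-periodic i r = ≡⇒≈ (trans
    (cong (λ k → weight (does (allowedPart? k)) k) (sym (ℕ.+-suc (i * 12) r)))
    (cong (λ b → weight b (i * 12 + suc r))
      (does-⇔ (allowed-periodic i (suc r)) (allowedPart? (i * 12 + suc r)) (allowedPart? (suc r)))))
  f : ℕ → ℕ → Series
  f i p = fac 1ℤ (i * 12 + p)
  block : ∀ i → ∏ (λ r → partFactor (i * 12 + r)) 12 ≈
    ∏ (λ r → fac 1ℤ ((i * 2 + r) * 6 + 1)) 2 ⊗ ∏ (λ r → fac 1ℤ ((i * 2 + r) * 6 + 5)) 2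
      ⊗ ∏ (λ r → fac 1ℤ ((i * 3 + r) * 4 + 4)) 3
  block i = begin
    ∏ (λ r → partFactor (i * 12 + r)) 12
      ≈⟨ ∏-cong 12 (partFactor-periodic i) ⟩
    -- Among 1, ..., 12 the admissible parts are 1, 5, 7, 11 and 4, 8, 12. The two kinds are
    -- disjoint by parity, so each factor occurs once.
    𝟙 ⊗ f i 1 ⊗ 𝟙 ⊗ 𝟙 ⊗ f i 4 ⊗ f i 5 ⊗ 𝟙 ⊗ f i 7 ⊗ f i 8 ⊗ 𝟙 ⊗ 𝟙 ⊗ f i 11 ⊗ f i 12
      ≈⟨ solve 7 (λ a b c d e g h →
           con 1ℤ :* a :* con 1ℤ :* con 1ℤ :* b :* c :* con 1ℤ :* d :* e :* con 1ℤ :* con 1ℤ :* g :* h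
           := con 1ℤ :* a :* d :* (con 1ℤ :* c :* g) :* (con 1ℤ :* b :* e :* h)) ≈-refl
           (f i 1) (f i 4) (f i 5) (f i 7) (f i 8) (f i 11) (f i 12) ⟩
    𝟙 ⊗ f i 1 ⊗ f i 7 ⊗ (𝟙 ⊗ f i 5 ⊗ f i 11) ⊗ (𝟙 ⊗ f i 4 ⊗ f i 8 ⊗ f i 12)
      ≈⟨ ⊗-cong (⊗-cong (⊗-cong (⊗-cong ≈-refl (e₆ 0 1)) (e₆ 1 1)) (⊗-cong (⊗-cong ≈-refl (e₆ 0 5)) (e₆ 1 5)))
           (⊗-cong (⊗-cong (⊗-cong ≈-refl (e₄ 0)) (e₄ 1)) (e₄ 2)) ⟩
    _ ∎
    where
    e₆ : ∀ r a → f i (r * 6 + a) ≈ fac 1ℤ ((i * 2 + r) * 6 + a)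
    e₆ r a = fac-cong refl (exponent i r a)
      where
      exponent : ∀ i r a → i * 12 + (r * 6 + a) ≡ (i * 2 + r) * 6 + a
      exponent = ℕ.solve-∀
    e₄ : ∀ r → f i (r * 4 + 4) ≈ fac 1ℤ ((i * 3 + r) * 4 + 4)
    e₄ r = fac-cong refl (exponent i r)
      where
      exponent : ∀ i r → i * 12 + (r * 4 + 4) ≡ (i * 3 + r) * 4 + 4
      exponent = ℕ.solve-∀
  regroup : ∀ m → ∏ partFactor (m * 12) ≈
    ∏ (λ i → fac 1ℤ (i * 6 + 1)) (m * 2) ⊗ ∏ (λ i → fac 1ℤ (i * 6 + 5)) (m * 2) ⊗ ∏ (λ i → fac 1ℤ (i * 4 + 4)) (m * 3)
  regroup m = begin
    ∏ partFactor (m * 12)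
      ≈⟨ ≈-trans (∏-block 12 partFactor m) (∏-cong m block) ⟩
    ∏ (λ i → g₁ i ⊗ g₅ i ⊗ g₄ i) m
      ≈⟨ ≈-trans (∏-⊗ (λ i → g₁ i ⊗ g₅ i) g₄ m) (⊗-cong (∏-⊗ g₁ g₅ m) ≈-refl) ⟩
    ∏ g₁ m ⊗ ∏ g₅ m ⊗ ∏ g₄ m
      ≈⟨ ≈-sym (⊗-cong (⊗-cong (∏-block 2 (λ i → fac 1ℤ (i * 6 + 1)) m) (∏-block 2 (λ i → fac 1ℤ (i * 6 + 5)) m))
           (∏-block 3 (λ i → fac 1ℤ (i * 4 + 4)) m)) ⟩
    _ ∎
    where
    g₁ g₅ g₄ : ℕ → Series
    g₁ i = ∏ (λ r → fac 1ℤ ((i * 2 + r) * 6 + 1)) 2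
    g₅ i = ∏ (λ r → fac 1ℤ ((i * 2 + r) * 6 + 5)) 2
    g₄ i = ∏ (λ r → fac 1ℤ ((i * 3 + r) * 4 + 4)) 3

open Congruences D D-product

theorem1p2 : ∀ (n : ℕ) → (2 ∣ dp (6 * n + 4)) × (4 ∣ dp (18 * n + 10)) × (8 ∣ dp (54 * n + 52))
theorem1p2 n = ℤ.∣⇒∣ᵤ (2∣D n) , ℤ.∣⇒∣ᵤ (4∣D n) , ℤ.∣⇒∣ᵤ (8∣D n)
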